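{- For any $d$ with $\sqrt{n}\le d\le n-1$, there is a $d$-regular graph $G$ on $n$ vertices with $\mathcal{R}(G)=O(d\cdot\log n)$. Moreover, for any $d$ with $1\le d\le\sqrt{n}$, there is a graph $G$ on $n$ vertices with minimum degree $d$ and maximum degree $d+1$ such that $\mathcal{R}(G)=O(\sqrt{n}\cdot\log^2 n)$.
   Context: Graphs $G=(V,E)$ are finite, undirected, simple and connected, with $n=|V|$ vertices. A random walk on $G$ moves at each step from its current vertex to a neighbor chosen uniformly at random. The cover time $\mathsf{COV}(s)$ is the expected number of steps for the walk started at $s$ to visit all vertices, and $\mathsf{COV}(G)=\max_{s\in V}\mathsf{COV}(s)$. Randomized broadcast algorithm $\mathsf{RBA}$ (push algorithm): at time $0$ only a vertex $s$ knows a rumor; at each time step $t=1,2,\dots$ every vertex that knows the rumor chooses a neighbor uniformly at random and informs it of the rumor. $I_t$ is the set of informed vertices at time $t$ (so $I_0=\{s\}$). The expected broadcast time is $\mathbf{E}[\mathsf{RBA}(G)]:=\max_{s\in V}\mathbf{E}[\min\{t\in\mathbb{N}: I_t=V\}]$, where the expectation is for the process with $I_0=\{s\}$. Finally, $\mathcal{R}(G):=\mathsf{COV}(G)/\mathbf{E}[\mathsf{RBA}(G)]$.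
   Formalization: The first claim assumes nd is even, since otherwise no d-regular graph on n vertices exists (e.g. n=5, d=3); the second assumes d≥2, since for d=1 the only connected graph is the path, where R(G)=Θ(n). -}

module Defs where

open import Data.Bool using (if_then_else_)
open import Data.Bool.Properties using () renaming (_≟_ to _≟ᵇ_)
open import Data.Fin using (Fin)
open import Data.Fin.Subset using (Subset; ⊥; ⊤; ⁅_⁆; _∪_)
open import Data.Fin.Subset.Properties using (_∈?_)
import Data.Integer as ℤ
open import Data.List using (List; []; _∷_; [_]; map; concatMap; filter; foldr; length; allFin)
open import Data.Nat as ℕ using (ℕ; zero; suc)
open import Data.Nat.Logarithm using (⌊log₂_⌋)
open import Data.Product using (_×_; _,_; ∃)
open import Data.Rational using (ℚ; 0ℚ; 1ℚ; _/_; _+_; _*_; _÷_; _⊔_; _≤_; _<_; ≢-nonZero)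
open import Data.Rational.Properties using (_≟_)
open import Data.Vec.Properties using (≡-dec)
open import Level using (0ℓ)
open import Relation.Binary using (Rel; Symmetric; Decidable)
open import Relation.Binary.Construct.Closure.ReflexiveTransitive using (Star)
open import Relation.Binary.PropositionalEquality using (_≡_)
open import Relation.Nullary using (¬_; yes; no; does)

-- A real number is presented by a rational sequence converging to it. All the sequences below converge (for the
-- expectations this uses that graphs are connected), so the termwise
-- operations compute the product, quotient and maximum of the limits.
Real : Set
Real = ℕ → ℚ

infix  4 _≤ᴿ_
infixl 7 _*ᴿ_ _÷ᴿ_

_≤ᴿ_ : Real → Real → Set
x ≤ᴿ y = ∀ ε → 0ℚ < ε → ∃ λ N₀ → ∀ N → N₀ ℕ.≤ N → x N ≤ y N + ε

fromℕ : ℕ → ℚ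
fromℕ m = ℤ.+ m / 1

constᴿ : ℕ → Real
constᴿ m _ = fromℕ m

_*ᴿ_ : Real → Real → Real
(x *ᴿ y) N = x N * y N

-- Division by zero yields zero; when the limit of the divisor is nonzero this
-- affects only finitely many terms.
_÷₀_ : ℚ → ℚ → ℚ
p ÷₀ q with q ≟ 0ℚ
... | yes _  = 0ℚ
... | no q≢0 = (p ÷ q) {{≢-nonZero q≢0}}

_÷ᴿ_ : Real → Real → Real
(x ÷ᴿ y) N = x N ÷₀ y N

-- Used for nonnegative reals only, so that starting from 0 is harmless.
maxᴿ : ∀ {n} → (Fin n → Real) → Real
maxᴿ {n} x N = foldr (λ s m → x s N ⊔ m) 0ℚ (allFin n)

⌊√_⌋ : ℕ → ℕ
⌊√ zero ⌋  = zero
⌊√ suc m ⌋ = next ⌊√ m ⌋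
  where
  next : ℕ → ℕ
  next r = if does (suc r ℕ.* suc r ℕ.≤? suc m) then suc r else r

-- √m = lim ⌊√(m k²)⌋ / k
√ᴿ : ℕ → Real
√ᴿ m N = ℤ.+ ⌊√ m ℕ.* (suc N ℕ.* suc N) ⌋ / suc N

-- log₂ m = lim ⌊log₂ (m ^ k)⌋ / k
logᴿ : ℕ → Real
logᴿ m N = ℤ.+ ⌊log₂ (m ℕ.^ suc N) ⌋ / suc N

-- Finite distributions as lists of weighted outcomes.
Dist : Set → Set
Dist A = List (ℚ × A)

return : ∀ {A : Set} → A → Dist A
return x = [ 1ℚ , x ]

infixl 1 _>>=_

_>>=_ : ∀ {A B : Set} → Dist A → (A → Dist B) → Dist B
D >>= f = concatMap (λ { (p , x) → map (λ { (q , y) → p * q , y }) (f x) }) D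

uniform : ∀ {A : Set} → List A → Dist A
uniform []           = []
uniform xs@(_ ∷ xs′) = map (λ x → ℤ.+ 1 / suc (length xs′) , x) xs

expect : ∀ {A : Set} → Dist A → (A → ℚ) → ℚ
expect D f = foldr (λ { (p , x) e → p * f x + e }) 0ℚ D

-- The first N states X₀ = x, X₁, …, X_{N-1} of a Markov chain.
trajectory : ∀ {S : Set} → (S → Dist S) → S → ℕ → Dist (List S)
trajectory step x zero    = return []
trajectory step x (suc N) =
  step x >>= λ y → trajectory step y N >>= λ ys → return (x ∷ ys)

record Graph (n : ℕ) : Set₁ where
  field
    Adj       : Rel (Fin n) 0ℓ
    adj?      : Decidable Adj
    symmetric : Symmetric Adj
    loopless  : ∀ v → ¬ Adj v v
    connected : ∀ u v → Star Adj u v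

  neighbours : Fin n → List (Fin n)
  neighbours v = filter (adj? v) (allFin n)

  degree : Fin n → ℕ
  degree v = length (neighbours v)

module _ {n : ℕ} (G : Graph n) where
  open Graph G

  Regular : ℕ → Set
  Regular d = ∀ v → degree v ≡ d

  MinDegree : ℕ → Set
  MinDegree d = (∀ v → d ℕ.≤ degree v) × ∃ λ v → degree v ≡ d

  MaxDegree : ℕ → Set
  MaxDegree d = (∀ v → degree v ℕ.≤ d) × ∃ λ v → degree v ≡ d

  -- For T = min { t | I_t = V }, the value min(T, N) computed from the list
  -- I₀, …, I_{N-1}.
  timeToFull : List (Subset n) → ℕ
  timeToFull []       = 0
  timeToFull (I ∷ Is) = if does (≡-dec _≟ᵇ_ I ⊤) then 0 else suc (timeToFull Is)

  walkStep : Fin n → Dist (Fin n)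
  walkStep v = uniform (neighbours v)

  -- The sets A ∪ {X₀, …, X_t}, t = 0, …, N-1.
  visited : Subset n → List (Fin n) → List (Subset n)
  visited A []       = []
  visited A (v ∷ vs) = let A′ = A ∪ ⁅ v ⁆ in A′ ∷ visited A′ vs

  -- An expectation E[T] is the limit of E[min(T, N)] as N → ∞.
  COVfrom : Fin n → Real
  COVfrom s N = expect (trajectory walkStep s N) λ vs → fromℕ (timeToFull (visited ⊥ vs))

  COV : Real
  COV = maxᴿ COVfrom

  pushStep : Subset n → Dist (Subset n)
  pushStep I = foldr
    (λ u D → D >>= λ J → uniform (neighbours u) >>= λ v → return (J ∪ ⁅ v ⁆))
    (return I)
    (filter (_∈? I) (allFin n))

  RBAfrom : Fin n → Real
  RBAfrom s N = expect (trajectory pushStep ⁅ s ⁆ N) λ Is → fromℕ (timeToFull Is)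

  RBA : Real
  RBA = maxᴿ RBAfrom

  ℛ : Real
  ℛ = COV ÷ᴿ RBA

{-# OPTIONS --safe #-}
module Submission where

-- Vertices are the residues modulo n. The walk on such a graph hits every vertex in time at most 2|E|·R as soon as the
-- oscillation inequality (f u - f v)² ≤ R · E(f) holds for the Dirichlet form E: apply it to the truncated expected
-- hitting time f at its maximum, where E(f) is controlled because f - Pf ≤ 1. Summing hitting potentials over the
-- unvisited vertices gives a quantity that decays geometrically, whence a cover time O(2|E|·R·log n). The broadcast time
-- is at least the diameter.
-- For generators m, …, m + c with m = 2^L c ≈ √n the oscillation inequality holds with R = O((L + 1) / c). A point is
-- compared with the average over a window of width c, then the window is doubled repeatedly up to width m, using only
-- the generators m and m + c, in disjoint stretches of the cycle; windows of width m are carried to each other along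
-- every generator m + j and the results averaged over j. As all steps have length O(√n), the diameter is of order √n.
-- When d ≥ √n, generators 1, …, d/2 (and the antipode for odd d) already contain such a family with L = 0, so R = O(1/d).
-- When d ≤ √n, one edge is added or removed to get the degrees d and d + 1; for d = 2 the generator m is used only at the
-- multiples of 5 on a cycle. These modifications change the Dirichlet form by a bounded factor.

open import Defs
open import Data.Bool using (Bool; true; false; if_then_else_; _∧_; _∨_; not)
open import Data.Bool.Properties using (∨-comm) renaming (_≟_ to _≟ᵇ_)
open import Data.Fin using (Fin; zero; suc; toℕ; fromℕ<)
import Data.Fin.Properties as Finₚ
open import Data.Fin.Subset using (Subset; ⊥; ⊤; ⁅_⁆; _∪_; _∈_; _⊆_)
open import Data.Fin.Subset.Properties using (_∈?_; x∈⁅x⁆; x∈⁅y⁆⇒x≡y; ⊆-antisym; ⊆⊤; ∈⊤; p⊆p∪q; q⊆p∪q; x∈p∪q⁻)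
import Data.Integer as ℤ
import Data.Integer.Properties as ℤₚ
open import Data.List using (List; []; _∷_; map; filter; foldr; length; allFin; tabulate; _++_)
import Data.List.Properties as Listₚ
open import Data.List.Membership.Propositional using () renaming (_∈_ to _∈ˡ_)
open import Data.List.Membership.Propositional.Properties using (∈-allFin)
open import Data.List.Relation.Unary.All using (All; []; _∷_)
import Data.List.Relation.Unary.All as All
import Data.List.Relation.Unary.All.Properties as Allₚ
open import Data.List.Relation.Unary.Any using (here; there)
open import Data.Nat using (ℕ; _+_; _*_; _≤_; _<_)
open import Data.Nat using (zero; suc; s≤s; z≤n; _^_; _∸_; _≤?_; _<?_; _≟_; NonZero; _⊓_)
import Data.Nat as ℕ
open import Data.Nat.DivMod using (_%_; m%n<n; m<n⇒m%n≡m; m%n%n≡m%n; [m+n]%n≡m%n; %-distribˡ-+; %-distribˡ-*; n%n≡0; m*n%n≡0; m∣n⇒o%n%m≡o%m; m≡m%n+[m/n]*n)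
import Data.Nat.DivMod as ℕ/
open import Data.Nat.Divisibility using (_∣_)
open import Data.Nat.Divisibility using (divides; ∣-refl; ∣m+n∣m⇒∣n; m∣m*n; ∣1⇒≡1)
open import Data.Nat.Logarithm using (⌊log₂_⌋; ⌊log₂⌋-mono-≤; ⌊log₂[2^n]⌋≡n)
open import Data.Nat.Properties using (*-identityʳ; *-identityˡ; *-mono-≤; *-monoʳ-≤; *-monoˡ-≤; +-assoc; +-cancelʳ-<; +-comm; +-identityʳ; +-mono-≤; +-monoʳ-≤; +-monoˡ-≤; +-suc; <-irrefl; <-trans; <-≤-trans; <⇒≢; <⇒≤; <⇒≱; m+[n∸m]≡n; m<m+n; m<n⇒m<1+n; m∸n+n≡m; m∸n≤m; m≤m+n; m≤n+m; n<1+n; n≤1+n; suc-pred; ∸-monoʳ-<; ≤-<-trans; ≤-antisym; ≤-refl; ≤-reflexive; ≤-trans; ≤⇒≯; ≮⇒≥; ≰⇒>)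
import Data.Nat.Properties as ℕₚ
import Data.Nat.Tactic.RingSolver as ℕ-Solver
open import Data.Product using (_×_; ∃-syntax; Σ-syntax)
open import Data.Product using (_,_; proj₁; proj₂)
open import Data.Rational using (ℚ; 0ℚ; 1ℚ; nonNegative; positive; _/_; _⊔_; 1/_; ≢-nonZero; toℚᵘ) renaming (_+_ to _⊕_; _*_ to _⊗_; _-_ to _⊖_; -_ to ⊖_; _≤_ to _≼_; _<_ to _≺_)
open import Data.Rational.Properties using (+-*-commutativeRing; toℚᵘ-injective; toℚᵘ-fromℚᵘ; toℚᵘ-homo-+; toℚᵘ-homo-*; toℚᵘ-cancel-≤; toℚᵘ-mono-≤) renaming (≤-refl to ≼-refl; ≤-trans to ≼-trans; ≤-reflexive to ≼-reflexive; ≤-total to ≼-total; +-mono-≤ to ⊕-mono)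
import Data.Rational.Properties as ℚₚ
import Data.Rational.Unnormalised as ℚᵘ
import Data.Rational.Unnormalised.Properties as ℚᵘₚ
open import Data.Sum using (_⊎_; inj₁; inj₂)
open import Data.Unit using (tt) renaming (⊤ to Unit)
open import Data.Vec.Properties using (≡-dec)
open import Level using (0ℓ)
open import Relation.Binary.Construct.Closure.ReflexiveTransitive using (Star; ε; _◅_; _◅◅_; reverse)
open import Relation.Binary.PropositionalEquality using (_≡_; _≢_; refl; sym; trans; cong; cong₂; subst; subst₂; module ≡-Reasoning)
open import Relation.Nullary using (¬_; Dec; yes; no; does; contradiction)
open import Relation.Nullary.Decidable using (dec⇒maybe; dec-true; dec-false)
open import Tactic.RingSolver using (solve-∀)
open import Tactic.RingSolver.Core.AlmostCommutativeRing using (AlmostCommutativeRing; fromCommutativeRing)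

-- Rational arithmetic and finite sums

-- Two demands conflict: a broadcast of order √n forces all steps to have length O(√n), while a
-- degree of order c leaves few step lengths to keep potential differences small. A single point
-- cannot be transported cheaply, as few edges leave it. The sum over a window can, because the
-- differences met on the way sit at distinct points of the cycle, so Cauchy-Schwarz charges each
-- edge once. The width only doubles at each stage, and after normalisation every stage has the same
-- weight. Hence L + 1 stages cost a factor L + 1 and no more, their stretches being disjoint. As L
-- is at most log n, this is the second logarithm of the sparse case; the other one comes from
-- covering. Hitting times are truncated because expectations are given only as limits of truncated
-- ones; every potential is then a rational number and no convergence has to be shown. Truncation
-- spoils the equation f = 1 + Pf, but concavity in the truncation time bounds the defect.

ℚ-ring : AlmostCommutativeRing 0ℓ 0ℓ
ℚ-ring = fromCommutativeRing +-*-commutativeRing (λ x → dec⇒maybe (0ℚ ℚₚ.≟ x))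

fromℕ-homo-+ : ∀ m n → fromℕ (m + n) ≡ fromℕ m ⊕ fromℕ n
fromℕ-homo-+ m n = toℚᵘ-injective (begin
  toℚᵘ (fromℕ (m + n)) ≈⟨ toℚᵘ-fromℚᵘ (ℚᵘ.mkℚᵘ (ℤ.+ (m + n)) 0) ⟩
  ℚᵘ.mkℚᵘ (ℤ.+ (m + n)) 0 ≈⟨ ℚᵘ.*≡* (cong₂ ℤ._*_ {y = ℤ.+ m ℤ.* ℤ.1ℤ ℤ.+ ℤ.+ n ℤ.* ℤ.1ℤ} (cong₂ ℤ._+_ (sym (ℤₚ.*-identityʳ (ℤ.+ m))) (sym (ℤₚ.*-identityʳ (ℤ.+ n)))) refl) ⟩
  ℚᵘ.mkℚᵘ (ℤ.+ m) 0 ℚᵘ.+ ℚᵘ.mkℚᵘ (ℤ.+ n) 0 ≈⟨ ℚᵘₚ.+-cong (ℚᵘₚ.≃-sym (toℚᵘ-fromℚᵘ (ℚᵘ.mkℚᵘ (ℤ.+ m) 0))) (ℚᵘₚ.≃-sym (toℚᵘ-fromℚᵘ (ℚᵘ.mkℚᵘ (ℤ.+ n) 0))) ⟩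
  toℚᵘ (fromℕ m) ℚᵘ.+ toℚᵘ (fromℕ n) ≈⟨ toℚᵘ-homo-+ (fromℕ m) (fromℕ n) ⟨
  toℚᵘ (fromℕ m ⊕ fromℕ n) ∎)
  where open ℚᵘₚ.≃-Reasoning

fromℕ-homo-* : ∀ m n → fromℕ (m * n) ≡ fromℕ m ⊗ fromℕ n
fromℕ-homo-* m n = toℚᵘ-injective (begin
  toℚᵘ (fromℕ (m * n)) ≈⟨ toℚᵘ-fromℚᵘ (ℚᵘ.mkℚᵘ (ℤ.+ (m * n)) 0) ⟩
  ℚᵘ.mkℚᵘ (ℤ.+ (m * n)) 0 ≈⟨ ℚᵘ.*≡* (cong (ℤ._* ℤ.1ℤ) (ℤₚ.pos-* m n)) ⟩
  ℚᵘ.mkℚᵘ (ℤ.+ m) 0 ℚᵘ.* ℚᵘ.mkℚᵘ (ℤ.+ n) 0 ≈⟨ ℚᵘₚ.*-cong (ℚᵘₚ.≃-sym (toℚᵘ-fromℚᵘ (ℚᵘ.mkℚᵘ (ℤ.+ m) 0))) (ℚᵘₚ.≃-sym (toℚᵘ-fromℚᵘ (ℚᵘ.mkℚᵘ (ℤ.+ n) 0))) ⟩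
  toℚᵘ (fromℕ m) ℚᵘ.* toℚᵘ (fromℕ n) ≈⟨ toℚᵘ-homo-* (fromℕ m) (fromℕ n) ⟨
  toℚᵘ (fromℕ m ⊗ fromℕ n) ∎)
  where open ℚᵘₚ.≃-Reasoning

fromℕ-mono : ∀ {m n} → m ≤ n → fromℕ m ≼ fromℕ n
fromℕ-mono {m} {n} m≤n = toℚᵘ-cancel-≤ (ℚᵘₚ.≤-respˡ-≃ (ℚᵘₚ.≃-sym (toℚᵘ-fromℚᵘ (ℚᵘ.mkℚᵘ (ℤ.+ m) 0)))
  (ℚᵘₚ.≤-respʳ-≃ (ℚᵘₚ.≃-sym (toℚᵘ-fromℚᵘ (ℚᵘ.mkℚᵘ (ℤ.+ n) 0)))
  (ℚᵘ.*≤* (ℤₚ.*-monoʳ-≤-nonNeg ℤ.1ℤ (ℤ.+≤+ m≤n)))))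

fromℕ-cancel : ∀ {m n} → fromℕ m ≼ fromℕ n → m ≤ n
fromℕ-cancel {m} {n} p with ℚᵘₚ.≤-respˡ-≃ (toℚᵘ-fromℚᵘ (ℚᵘ.mkℚᵘ (ℤ.+ m) 0)) (ℚᵘₚ.≤-respʳ-≃ (toℚᵘ-fromℚᵘ (ℚᵘ.mkℚᵘ (ℤ.+ n) 0)) (toℚᵘ-mono-≤ p))
... | ℚᵘ.*≤* q = ℤₚ.drop‿+≤+ (subst₂ ℤ._≤_ (ℤₚ.*-identityʳ (ℤ.+ m)) (ℤₚ.*-identityʳ (ℤ.+ n)) q)

fromℕ-injective : ∀ {m n} → fromℕ m ≡ fromℕ n → m ≡ n
fromℕ-injective eq = ≤-antisym (fromℕ-cancel (≼-reflexive eq)) (fromℕ-cancel (≼-reflexive (sym eq)))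

fromℕ-nonNeg : ∀ n → 0ℚ ≼ fromℕ n
fromℕ-nonNeg n = fromℕ-mono {0} {n} z≤n

fromℕ-suc : ∀ n → fromℕ (suc n) ≡ fromℕ n ⊕ 1ℚ
fromℕ-suc n = trans (cong fromℕ (+-comm 1 n)) (fromℕ-homo-+ n 1)

⊗-monoʳ : ∀ {a b c} → 0ℚ ≼ c → a ≼ b → c ⊗ a ≼ c ⊗ b
⊗-monoʳ {c = c} 0≤c = ℚₚ.*-monoˡ-≤-nonNeg c {{nonNegative 0≤c}}

⊗-monoˡ : ∀ {a b c} → 0ℚ ≼ c → a ≼ b → a ⊗ c ≼ b ⊗ c
⊗-monoˡ {c = c} 0≤c = ℚₚ.*-monoʳ-≤-nonNeg c {{nonNegative 0≤c}}

⊗-mono : ∀ {a b c d} → 0ℚ ≼ a → 0ℚ ≼ d → a ≼ b → c ≼ d → a ⊗ c ≼ b ⊗ d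
⊗-mono 0≤a 0≤d a≤b c≤d = ≼-trans (⊗-monoʳ 0≤a c≤d) (⊗-monoˡ 0≤d a≤b)

⊕-monoʳ : ∀ {a b} c → a ≼ b → c ⊕ a ≼ c ⊕ b
⊕-monoʳ c = ⊕-mono (≼-refl {c})

⊕-monoˡ : ∀ {a b} c → a ≼ b → a ⊕ c ≼ b ⊕ c
⊕-monoˡ c p = ⊕-mono p (≼-refl {c})

⊗-nonNeg : ∀ {a b} → 0ℚ ≼ a → 0ℚ ≼ b → 0ℚ ≼ a ⊗ b
⊗-nonNeg {a} {b} 0≤a 0≤b = subst (_≼ a ⊗ b) (ℚₚ.*-zeroʳ a) (⊗-monoʳ 0≤a 0≤b)

⊕-nonNeg : ∀ {a b} → 0ℚ ≼ a → 0ℚ ≼ b → 0ℚ ≼ a ⊕ b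
⊕-nonNeg = ⊕-mono

a≼a⊕b : ∀ {a b} → 0ℚ ≼ b → a ≼ a ⊕ b
a≼a⊕b {a} {b} 0≤b = subst (_≼ a ⊕ b) (ℚₚ.+-identityʳ a) (⊕-monoʳ a 0≤b)

b≼a⊕b : ∀ {a b} → 0ℚ ≼ a → b ≼ a ⊕ b
b≼a⊕b {a} {b} 0≤a = subst (_≼ a ⊕ b) (ℚₚ.+-identityˡ b) (⊕-monoˡ b 0≤a)

≼-by-difference : ∀ {a b c} → 0ℚ ≼ c → b ≡ a ⊕ c → a ≼ b
≼-by-difference {a} 0≤c refl = a≼a⊕b 0≤c

difference-nonNeg : ∀ {a b} → a ≼ b → 0ℚ ≼ b ⊖ a
difference-nonNeg {a} {b} a≤b = subst (_≼ b ⊖ a) (ℚₚ.+-inverseʳ a) (⊕-monoˡ (⊖ a) a≤b)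

⊕-cancelʳ : ∀ {a b} c → a ⊕ c ≼ b ⊕ c → a ≼ b
⊕-cancelʳ {a} {b} c p = subst₂ _≼_ (eq a c) (eq b c) (⊕-monoˡ (⊖ c) p)
  where
  eq : ∀ a c → a ⊕ c ⊕ (⊖ c) ≡ a
  eq = solve-∀ ℚ-ring

⊗-cancelˡ : ∀ {a b c} → 0ℚ ≺ c → c ⊗ a ≼ c ⊗ b → a ≼ b
⊗-cancelˡ {c = c} 0<c = ℚₚ.*-cancelˡ-≤-pos c {{positive 0<c}}

sq : ℚ → ℚ
sq a = a ⊗ a

sq-nonNeg : ∀ a → 0ℚ ≼ sq a
sq-nonNeg a with ≼-total 0ℚ a
... | inj₁ 0≤a = ⊗-nonNeg 0≤a 0≤a
... | inj₂ a≤0 = subst (0ℚ ≼_) (eq a) (⊗-nonNeg 0≤-a 0≤-a)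
  where
  0≤-a : 0ℚ ≼ ⊖ a
  0≤-a = ℚₚ.neg-antimono-≤ a≤0
  eq : ∀ a → ⊖ a ⊗ ⊖ a ≡ a ⊗ a
  eq = solve-∀ ℚ-ring

sq-cancel-≼ : ∀ {a b} → 0ℚ ≼ b → sq a ≼ sq b → a ≼ b
sq-cancel-≼ {a} {b} 0≤b a²≤b² with ℚₚ._≤?_ a b
... | yes a≤b = a≤b
... | no a≰b = contradiction (ℚₚ.<-≤-trans (ℚₚ.≤-<-trans b²≤ba ba<a²) a²≤b²) (ℚₚ.<-irrefl refl)
  where
  b<a : b ≺ a
  b<a = ℚₚ.≰⇒> a≰b
  b²≤ba : sq b ≼ b ⊗ a
  b²≤ba = ⊗-monoʳ 0≤b (ℚₚ.<⇒≤ b<a)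
  ba<a² : b ⊗ a ≺ sq a
  ba<a² = ℚₚ.*-monoˡ-<-pos a {{positive (ℚₚ.≤-<-trans 0≤b b<a)}} b<a

-- Read "A² ≼ p U" as: A is a sum of p terms of total energy U. Such bounds add up.
cauchy-schwarz-⊕ : ∀ A B {p q U V} → 0ℚ ≼ p → 0ℚ ≼ q → 0ℚ ≼ U → 0ℚ ≼ V →
  sq A ≼ p ⊗ U → sq B ≼ q ⊗ V → sq (A ⊕ B) ≼ (p ⊕ q) ⊗ (U ⊕ V)
cauchy-schwarz-⊕ A B {p} {q} {U} {V} 0≤p 0≤q 0≤U 0≤V hA hB =
  subst₂ _≼_ (sym (expand₁ A B)) (sym (expand₂ p q U V)) (⊕-mono (⊕-mono hA hB) 2AB≤)
  where
  expand₁ : ∀ A B → (A ⊕ B) ⊗ (A ⊕ B) ≡ A ⊗ A ⊕ B ⊗ B ⊕ (A ⊗ B ⊕ A ⊗ B)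
  expand₁ = solve-∀ ℚ-ring
  expand₂ : ∀ p q U V → (p ⊕ q) ⊗ (U ⊕ V) ≡ p ⊗ U ⊕ q ⊗ V ⊕ (p ⊗ V ⊕ q ⊗ U)
  expand₂ = solve-∀ ℚ-ring
  expand₃ : ∀ A B → (A ⊗ B ⊕ A ⊗ B) ⊗ (A ⊗ B ⊕ A ⊗ B) ≡ (1ℚ ⊕ 1ℚ) ⊗ (1ℚ ⊕ 1ℚ) ⊗ (A ⊗ A ⊗ (B ⊗ B))
  expand₃ = solve-∀ ℚ-ring
  expand₄ : ∀ p q U V → (p ⊗ V ⊕ q ⊗ U) ⊗ (p ⊗ V ⊕ q ⊗ U) ≡ (1ℚ ⊕ 1ℚ) ⊗ (1ℚ ⊕ 1ℚ) ⊗ (p ⊗ U ⊗ (q ⊗ V)) ⊕ (p ⊗ V ⊖ q ⊗ U) ⊗ (p ⊗ V ⊖ q ⊗ U)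
  expand₄ = solve-∀ ℚ-ring
  -- AM-GM with squares in place of roots, which need not be rational: 4A²B² ≤ 4(pU)(qV) ≤ (pV +
  -- qU)².
  2AB≤ : A ⊗ B ⊕ A ⊗ B ≼ p ⊗ V ⊕ q ⊗ U
  2AB≤ = sq-cancel-≼ (⊕-nonNeg (⊗-nonNeg 0≤p 0≤V) (⊗-nonNeg 0≤q 0≤U))
    (≼-trans (≼-reflexive (expand₃ A B))
    (≼-trans (⊗-monoʳ (fromℕ-nonNeg 4) (⊗-mono (sq-nonNeg A) (⊗-nonNeg 0≤q 0≤V) hA hB))
    (≼-by-difference (sq-nonNeg (p ⊗ V ⊖ q ⊗ U)) (expand₄ p q U V))))

∑ : ℕ → (ℕ → ℚ) → ℚ
∑ zero    f = 0ℚ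
∑ (suc n) f = ∑ n f ⊕ f n

∑-cong : ∀ n {f g} → (∀ i → i < n → f i ≡ g i) → ∑ n f ≡ ∑ n g
∑-cong zero    h = refl
∑-cong (suc n) h = cong₂ _⊕_ (∑-cong n (λ i i<n → h i (m<n⇒m<1+n i<n))) (h n ≤-refl)

∑-mono : ∀ n {f g} → (∀ i → i < n → f i ≼ g i) → ∑ n f ≼ ∑ n g
∑-mono zero    h = ≼-refl
∑-mono (suc n) h = ⊕-mono (∑-mono n (λ i i<n → h i (m<n⇒m<1+n i<n))) (h n ≤-refl)

∑-nonNeg : ∀ n {f} → (∀ i → 0ℚ ≼ f i) → 0ℚ ≼ ∑ n f
∑-nonNeg zero    h = ≼-refl
∑-nonNeg (suc n) h = ⊕-nonNeg (∑-nonNeg n h) (h n)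

∑-distrib-⊕ : ∀ n f g → ∑ n (λ i → f i ⊕ g i) ≡ ∑ n f ⊕ ∑ n g
∑-distrib-⊕ zero    f g = refl
∑-distrib-⊕ (suc n) f g = trans (cong (_⊕ (f n ⊕ g n)) (∑-distrib-⊕ n f g)) (eq (∑ n f) (∑ n g) (f n) (g n))
  where
  eq : ∀ a b c d → a ⊕ b ⊕ (c ⊕ d) ≡ a ⊕ c ⊕ (b ⊕ d)
  eq = solve-∀ ℚ-ring

∑-distribˡ-⊗ : ∀ n a f → ∑ n (λ i → a ⊗ f i) ≡ a ⊗ ∑ n f
∑-distribˡ-⊗ zero    a f = sym (ℚₚ.*-zeroʳ a)
∑-distribˡ-⊗ (suc n) a f = trans (cong (_⊕ a ⊗ f n) (∑-distribˡ-⊗ n a f)) (sym (ℚₚ.*-distribˡ-+ a (∑ n f) (f n)))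

∑-const : ∀ n a → ∑ n (λ _ → a) ≡ fromℕ n ⊗ a
∑-const zero    a = sym (ℚₚ.*-zeroˡ a)
∑-const (suc n) a = begin
  ∑ n (λ _ → a) ⊕ a ≡⟨ cong (_⊕ a) (∑-const n a) ⟩
  fromℕ n ⊗ a ⊕ a ≡⟨ eq (fromℕ n) a ⟩
  (fromℕ n ⊕ 1ℚ) ⊗ a ≡⟨ cong (_⊗ a) (fromℕ-suc n) ⟨
  fromℕ (suc n) ⊗ a ∎
  where
  open ≡-Reasoning
  eq : ∀ k a → k ⊗ a ⊕ a ≡ (k ⊕ 1ℚ) ⊗ a
  eq = solve-∀ ℚ-ring

∑-zero : ∀ n → ∑ n (λ _ → 0ℚ) ≡ 0ℚ
∑-zero zero    = refl
∑-zero (suc n) = cong (_⊕ 0ℚ) (∑-zero n)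

∑-split : ∀ m n f → ∑ (m + n) f ≡ ∑ m f ⊕ ∑ n (λ i → f (m + i))
∑-split m zero    f = trans (cong (λ k → ∑ k f) (+-identityʳ m)) (sym (ℚₚ.+-identityʳ (∑ m f)))
∑-split m (suc n) f = begin
  ∑ (m + suc n) f ≡⟨ cong (λ k → ∑ k f) (+-suc m n) ⟩
  ∑ (m + n) f ⊕ f (m + n) ≡⟨ cong (_⊕ f (m + n)) (∑-split m n f) ⟩
  ∑ m f ⊕ ∑ n (λ i → f (m + i)) ⊕ f (m + n) ≡⟨ ℚₚ.+-assoc (∑ m f) _ _ ⟩
  ∑ m f ⊕ (∑ n (λ i → f (m + i)) ⊕ f (m + n)) ∎
  where open ≡-Reasoning

∑-front : ∀ n f → ∑ (suc n) f ≡ f 0 ⊕ ∑ n (λ i → f (suc i))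
∑-front n f = trans (∑-split 1 n f) (cong (_⊕ ∑ n (λ i → f (suc i))) (ℚₚ.+-identityˡ (f 0)))

∑-swap : ∀ m n (f : ℕ → ℕ → ℚ) → ∑ m (λ i → ∑ n (f i)) ≡ ∑ n (λ j → ∑ m (λ i → f i j))
∑-swap zero    n f = sym (∑-zero n)
∑-swap (suc m) n f = trans (cong (_⊕ ∑ n (f m)) (∑-swap m n f)) (sym (∑-distrib-⊕ n (λ j → ∑ m (λ i → f i j)) (f m)))

∑-range : ∀ {m n} f → (∀ i → 0ℚ ≼ f i) → ∀ a → a + m ≤ n → ∑ m (λ i → f (a + i)) ≼ ∑ n f
∑-range {m} {n} f 0≤f a a+m≤n = begin
  ∑ m (λ i → f (a + i)) ≤⟨ b≼a⊕b (∑-nonNeg a 0≤f) ⟩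
  ∑ a f ⊕ ∑ m (λ i → f (a + i)) ≡⟨ ∑-split a m f ⟨
  ∑ (a + m) f ≤⟨ a≼a⊕b (∑-nonNeg (n ℕ.∸ (a + m)) (λ i → 0≤f _)) ⟩
  ∑ (a + m) f ⊕ ∑ (n ℕ.∸ (a + m)) (λ i → f (a + m + i)) ≡⟨ ∑-split (a + m) _ f ⟨
  ∑ (a + m + (n ℕ.∸ (a + m))) f ≡⟨ cong (λ k → ∑ k f) (m+[n∸m]≡n a+m≤n) ⟩
  ∑ n f ∎
  where open ℚₚ.≤-Reasoning

∑-prefix : ∀ {m n} f → (∀ i → 0ℚ ≼ f i) → m ≤ n → ∑ m f ≼ ∑ n f
∑-prefix f 0≤f m≤n = ∑-range f 0≤f 0 m≤n

∑-term : ∀ {n} f → (∀ i → 0ℚ ≼ f i) → ∀ i → i < n → f i ≼ ∑ n f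
∑-term {n} f 0≤f i i<n = ≼-trans (≼-reflexive (sym (trans (ℚₚ.+-identityˡ _) (cong f (+-identityʳ i)))))
  (∑-range {1} f 0≤f i (≤-trans (≤-reflexive (+-comm i 1)) i<n))

∑-shift : ∀ n f → (∀ x → f (x + n) ≡ f x) → ∀ a → ∑ n (λ i → f (a + i)) ≡ ∑ n f
∑-shift n f per zero    = refl
∑-shift n f per (suc a) = trans step (∑-shift n f per a)
  where
  open ≡-Reasoning
  g : ℕ → ℚ
  g i = f (a + i)
  cancel : ∀ x y → y ⊕ x ⊖ y ≡ x
  cancel = solve-∀ ℚ-ring
  cancel′ : ∀ x y → x ⊕ y ⊖ y ≡ x
  cancel′ = solve-∀ ℚ-ring
  step : ∑ n (λ i → f (suc a + i)) ≡ ∑ n g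
  step = begin
    ∑ n (λ i → f (suc a + i)) ≡⟨ ∑-cong n (λ i _ → cong f (sym (+-suc a i))) ⟩
    ∑ n (λ i → g (suc i)) ≡⟨ cancel _ (g 0) ⟨
    g 0 ⊕ ∑ n (λ i → g (suc i)) ⊖ g 0 ≡⟨ cong (_⊖ g 0) (∑-front n g) ⟨
    ∑ n g ⊕ g n ⊖ g 0 ≡⟨ cong (λ t → ∑ n g ⊕ t ⊖ g 0) (trans (per a) (cong f (sym (+-identityʳ a)))) ⟩
    ∑ n g ⊕ g 0 ⊖ g 0 ≡⟨ cancel′ _ (g 0) ⟩
    ∑ n g ∎

∑-telescope : ∀ n (f : ℕ → ℚ) → ∑ n (λ i → f (suc i) ⊖ f i) ≡ f n ⊖ f 0
∑-telescope zero    f = sym (ℚₚ.+-inverseʳ (f 0))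
∑-telescope (suc n) f = trans (cong (_⊕ (f (suc n) ⊖ f n)) (∑-telescope n f)) (eq (f 0) (f n) (f (suc n)))
  where
  eq : ∀ a b c → b ⊖ a ⊕ (c ⊖ b) ≡ c ⊖ a
  eq = solve-∀ ℚ-ring

cauchy-schwarz-∑ : ∀ n (A : ℕ → ℚ) {p U : ℕ → ℚ} → (∀ i → 0ℚ ≼ p i) → (∀ i → 0ℚ ≼ U i) →
  (∀ i → i < n → sq (A i) ≼ p i ⊗ U i) → sq (∑ n A) ≼ ∑ n p ⊗ ∑ n U
cauchy-schwarz-∑ zero    A 0≤p 0≤U h = ≼-refl
cauchy-schwarz-∑ (suc n) A 0≤p 0≤U h =
  cauchy-schwarz-⊕ (∑ n A) (A n) (∑-nonNeg n 0≤p) (0≤p n) (∑-nonNeg n 0≤U) (0≤U n)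
    (cauchy-schwarz-∑ n A 0≤p 0≤U (λ i i<n → h i (m<n⇒m<1+n i<n))) (h n ≤-refl)

sq-∑ : ∀ n A → sq (∑ n A) ≼ fromℕ n ⊗ ∑ n (λ i → sq (A i))
sq-∑ n A = subst (λ t → sq (∑ n A) ≼ t ⊗ ∑ n (λ i → sq (A i))) (trans (∑-const n 1ℚ) (ℚₚ.*-identityʳ (fromℕ n)))
  (cauchy-schwarz-∑ n A (λ _ → fromℕ-nonNeg 1) (λ i → sq-nonNeg (A i)) (λ i _ → ≼-reflexive (sym (ℚₚ.*-identityˡ _))))

∑-distrib-⊖ : ∀ n f g → ∑ n (λ i → f i ⊖ g i) ≡ ∑ n f ⊖ ∑ n g
∑-distrib-⊖ zero    f g = refl
∑-distrib-⊖ (suc n) f g = trans (cong (_⊕ (f n ⊖ g n)) (∑-distrib-⊖ n f g)) (eq (∑ n f) (∑ n g) (f n) (g n))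
  where
  eq : ∀ a b c d → a ⊖ b ⊕ (c ⊖ d) ≡ a ⊕ c ⊖ (b ⊕ d)
  eq = solve-∀ ℚ-ring

-- Blocks of width `w ≤ M` starting at multiples of `M` are disjoint. The last of them ends at (r -
-- 1)M + w; the hypothesis places this below `T` without a truncated subtraction at `r = 0`.
∑-blocks : ∀ r w M T F → (∀ i → 0ℚ ≼ F i) → w ≤ M → r * M + w ≤ T + M →
  ∑ r (λ s → ∑ w (λ y → F (s * M + y))) ≼ ∑ T F
∑-blocks zero    w M T F 0≤F w≤M h = ∑-nonNeg T 0≤F
∑-blocks (suc r) w M T F 0≤F w≤M h = begin
  ∑ r (λ s → ∑ w (λ y → F (s * M + y))) ⊕ ∑ w (λ y → F (r * M + y))
    ≤⟨ ⊕-monoˡ _ (∑-blocks r w M (r * M) F 0≤F w≤M (+-monoʳ-≤ (r * M) w≤M)) ⟩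
  ∑ (r * M) F ⊕ ∑ w (λ y → F (r * M + y)) ≡⟨ ∑-split (r * M) w F ⟨
  ∑ (r * M + w) F ≤⟨ ∑-prefix F 0≤F rM+w≤T ⟩
  ∑ T F ∎
  where
  open ℚₚ.≤-Reasoning
  rM+w≤T : r * M + w ≤ T
  rM+w≤T = ℕₚ.+-cancelˡ-≤ M _ _ (≤-trans (≤-reflexive (sym (+-assoc M (r * M) w))) (≤-trans h (≤-reflexive (+-comm T M))))

-- Apply the unscaled version to `c A` and `c B` and cancel one `c`. The factor `c` stays on the
-- left so that bounds of the form energy / c need no division.
scaled-cauchy-schwarz-⊕ : ∀ c A B {p q U V} → 0ℚ ≺ c → 0ℚ ≼ p → 0ℚ ≼ q → 0ℚ ≼ U → 0ℚ ≼ V →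
  c ⊗ sq A ≼ p ⊗ U → c ⊗ sq B ≼ q ⊗ V → c ⊗ sq (A ⊕ B) ≼ (p ⊕ q) ⊗ (U ⊕ V)
scaled-cauchy-schwarz-⊕ c A B {p} {q} {U} {V} 0<c 0≤p 0≤q 0≤U 0≤V hA hB = ⊗-cancelˡ 0<c (begin
  c ⊗ (c ⊗ sq (A ⊕ B)) ≡⟨ eq₁ c A B ⟩
  sq (c ⊗ A ⊕ c ⊗ B) ≤⟨ cauchy-schwarz-⊕ (c ⊗ A) (c ⊗ B) (⊗-nonNeg 0≤c 0≤p) (⊗-nonNeg 0≤c 0≤q) 0≤U 0≤V (scale A hA) (scale B hB) ⟩
  (c ⊗ p ⊕ c ⊗ q) ⊗ (U ⊕ V) ≡⟨ eq₂ c p q (U ⊕ V) ⟩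
  c ⊗ ((p ⊕ q) ⊗ (U ⊕ V))          ∎)
  where
  open ℚₚ.≤-Reasoning
  0≤c = ℚₚ.<⇒≤ 0<c
  eq₁ : ∀ c A B → c ⊗ (c ⊗ ((A ⊕ B) ⊗ (A ⊕ B))) ≡ (c ⊗ A ⊕ c ⊗ B) ⊗ (c ⊗ A ⊕ c ⊗ B)
  eq₁ = solve-∀ ℚ-ring
  eq₂ : ∀ c p q X → (c ⊗ p ⊕ c ⊗ q) ⊗ X ≡ c ⊗ ((p ⊕ q) ⊗ X)
  eq₂ = solve-∀ ℚ-ring
  eq₃ : ∀ c A → (c ⊗ A) ⊗ (c ⊗ A) ≡ c ⊗ (c ⊗ (A ⊗ A))
  eq₃ = solve-∀ ℚ-ring
  scale : ∀ A {p U} → c ⊗ sq A ≼ p ⊗ U → sq (c ⊗ A) ≼ c ⊗ p ⊗ U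
  scale A {p} {U} h = ≼-trans (≼-reflexive (eq₃ c A)) (≼-trans (⊗-monoʳ 0≤c h) (≼-reflexive (sym (ℚₚ.*-assoc c p U))))

sq-neg : ∀ a → sq (⊖ a) ≡ sq a
sq-neg = eq
  where
  eq : ∀ a → ⊖ a ⊗ ⊖ a ≡ a ⊗ a
  eq = solve-∀ ℚ-ring

fromℕ-0< : ∀ {n} → 1 ≤ n → 0ℚ ≺ fromℕ n
fromℕ-0< {n} 1≤n = ℚₚ.<-≤-trans (ℚₚ.positive⁻¹ 1ℚ) (fromℕ-mono 1≤n)

-- Oscillation of periodic functions

-- Functions on the residues modulo `n` are treated as periodic functions on ℕ, so that windows and
-- stretches may run past `n` without reduction.
module Periodic (n : ℕ) (f : ℕ → ℚ) (periodic : ∀ x → f (x + n) ≡ f x) where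

  Δ : ℕ → ℕ → ℚ
  Δ g x = f (x + g) ⊖ f x

  energyAt : ℕ → ℕ → ℚ
  energyAt g x = sq (Δ g x)

  energy : ℕ → ℚ
  energy g = ∑ n (energyAt g)

  window : ℕ → ℕ → ℚ
  window w a = ∑ w (λ y → f (a + y))

  energyAt-nonNeg : ∀ g x → 0ℚ ≼ energyAt g x
  energyAt-nonNeg g x = sq-nonNeg (Δ g x)

  energy-nonNeg : ∀ g → 0ℚ ≼ energy g
  energy-nonNeg g = ∑-nonNeg n (energyAt-nonNeg g)

  swap-right : ∀ x y z → x + y + z ≡ x + z + y
  swap-right = ℕ-Solver.solve-∀

  energyAt-periodic : ∀ g x → energyAt g (x + n) ≡ energyAt g x
  energyAt-periodic g x = cong sq (cong₂ _⊖_ (trans (cong f (swap-right x n g)) (periodic (x + g))) (periodic x))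

  energy-shift : ∀ g a → ∑ n (λ x → energyAt g (a + x)) ≡ energy g
  energy-shift g = ∑-shift n (energyAt g) (energyAt-periodic g)

  energy-interval : ∀ g a {T} → T ≤ n → ∑ T (λ x → energyAt g (a + x)) ≼ energy g
  energy-interval g a T≤n = ≼-trans (∑-prefix _ (λ x → energyAt-nonNeg g (a + x)) T≤n) (≼-reflexive (energy-shift g a))

  window-split : ∀ u v a → window (u + v) a ≡ window u a ⊕ window v (a + u)
  window-split u v a = trans (∑-split u v (λ y → f (a + y))) (cong (window u a ⊕_) (∑-cong v (λ y _ → cong f (sym (+-assoc a u y)))))

  window-step : ∀ w a g → window w (a + g) ⊖ window w a ≡ ∑ w (λ y → Δ g (a + y))
  window-step w a g = sym (trans (∑-distrib-⊖ w (λ y → f (a + y + g)) (λ y → f (a + y)))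
    (cong (_⊖ window w a) (∑-cong w (λ y _ → cong f (swap-right a y g)))))

  -- Since `w ≤ g`, the successive positions of the window are disjoint. The displacement is thus a
  -- sum of `r w` differences at distinct points of a stretch of length `T`, and Cauchy-Schwarz
  -- costs only the number of terms.
  window-move : ∀ g r w a T → w ≤ g → r * g + w ≤ T + g →
    sq (window w (a + r * g) ⊖ window w a) ≼ fromℕ (r * w) ⊗ ∑ T (λ x → energyAt g (a + x))
  window-move g r w a T w≤g fits = begin
    sq (window w (a + r * g) ⊖ window w a)
      ≡⟨ cong (λ t → sq (window w (a + r * g) ⊖ window w t)) (sym (+-identityʳ a)) ⟩
    sq (window w (a + r * g) ⊖ window w (a + 0 * g))
      ≡⟨ cong sq (sym (∑-telescope r (λ s → window w (a + s * g)))) ⟩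
    sq (∑ r (λ s → window w (a + suc s * g) ⊖ window w (a + s * g)))
      ≡⟨ cong sq (∑-cong r (λ s _ → step s)) ⟩
    sq (∑ r (λ s → ∑ w (λ y → Δ g (a + s * g + y))))
      ≤⟨ cauchy-schwarz-∑ r (λ s → ∑ w (λ y → Δ g (a + s * g + y))) (λ _ → fromℕ-nonNeg w) (λ s → ∑-nonNeg w (λ y → energyAt-nonNeg g _)) (λ s _ → sq-∑ w (λ y → Δ g (a + s * g + y))) ⟩
    ∑ r (λ _ → fromℕ w) ⊗ ∑ r (λ s → ∑ w (λ y → energyAt g (a + s * g + y)))
      ≡⟨ cong₂ _⊗_ (trans (∑-const r (fromℕ w)) (sym (fromℕ-homo-* r w))) (∑-cong r (λ s _ → ∑-cong w (λ y _ → cong (energyAt g) (+-assoc a (s * g) y)))) ⟩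
    fromℕ (r * w) ⊗ ∑ r (λ s → ∑ w (λ y → energyAt g (a + (s * g + y))))
      ≤⟨ ⊗-monoʳ (fromℕ-nonNeg (r * w)) (∑-blocks r w g T (λ x → energyAt g (a + x)) (λ x → energyAt-nonNeg g (a + x)) w≤g fits) ⟩
    fromℕ (r * w) ⊗ ∑ T (λ x → energyAt g (a + x)) ∎
    where
    open ℚₚ.≤-Reasoning
    step : ∀ s → window w (a + suc s * g) ⊖ window w (a + s * g) ≡ ∑ w (λ y → Δ g (a + s * g + y))
    step s = trans (cong (λ t → window w t ⊖ window w (a + s * g)) (trans (cong (a +_) (+-comm g (s * g))) (sym (+-assoc a (s * g) g)))) (window-step w (a + s * g) g)

  -- Sliding a window by ρ moves only its two ends, so it costs ρ steps of length w and not w steps of length ρ.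
  window-exchange : ∀ w a ρ → window w (a + ρ) ⊖ window w a ≡ window ρ (a + w) ⊖ window ρ a
  window-exchange w a ρ = begin
    window w (a + ρ) ⊖ window w a
      ≡⟨ cancel (window ρ a) (window w (a + ρ)) (window w a) ⟩
    (window ρ a ⊕ window w (a + ρ)) ⊖ (window w a ⊕ window ρ a)
      ≡⟨ cong (_⊖ (window w a ⊕ window ρ a)) both ⟩
    (window w a ⊕ window ρ (a + w)) ⊖ (window w a ⊕ window ρ a)
      ≡⟨ cancel′ (window w a) (window ρ (a + w)) (window ρ a) ⟩
    window ρ (a + w) ⊖ window ρ a ∎
    where
    open ≡-Reasoning
    cancel : ∀ s x y → x ⊖ y ≡ (s ⊕ x) ⊖ (y ⊕ s)
    cancel = solve-∀ ℚ-ring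
    cancel′ : ∀ s x y → (s ⊕ x) ⊖ (s ⊕ y) ≡ x ⊖ y
    cancel′ = solve-∀ ℚ-ring
    both : window ρ a ⊕ window w (a + ρ) ≡ window w a ⊕ window ρ (a + w)
    both = trans (sym (window-split ρ w a)) (trans (cong (λ t → window t a) (+-comm ρ w)) (window-split w ρ a))

  window-slide : ∀ w a ρ → ρ ≤ n → sq (window w (a + ρ) ⊖ window w a) ≼ fromℕ ρ ⊗ energy w
  window-slide w a ρ ρ≤n = begin
    sq (window w (a + ρ) ⊖ window w a)
      ≡⟨ cong sq (trans (window-exchange w a ρ) (window-step ρ a w)) ⟩
    sq (∑ ρ (λ y → Δ w (a + y)))
      ≤⟨ sq-∑ ρ (λ y → Δ w (a + y)) ⟩
    fromℕ ρ ⊗ ∑ ρ (λ y → energyAt w (a + y))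
      ≤⟨ ⊗-monoʳ (fromℕ-nonNeg ρ) (energy-interval w a ρ≤n) ⟩
    fromℕ ρ ⊗ energy w ∎
    where open ℚₚ.≤-Reasoning

  module Spread (c m : ℕ) (1≤c : 1 ≤ c) (c≤m : c ≤ m) where

    density : ℕ → ℚ
    density x = ∑ (suc c) (λ j → energyAt (m + j) x)

    totalEnergy : ℚ
    totalEnergy = ∑ (suc c) (λ j → energy (m + j))

    density-nonNeg : ∀ x → 0ℚ ≼ density x
    density-nonNeg x = ∑-nonNeg (suc c) (λ j → energyAt-nonNeg (m + j) x)

    totalEnergy-nonNeg : 0ℚ ≼ totalEnergy
    totalEnergy-nonNeg = ∑-nonNeg (suc c) (λ j → energy-nonNeg (m + j))

    0<c : 0ℚ ≺ fromℕ c
    0<c = fromℕ-0< 1≤c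

    0≤c : 0ℚ ≼ fromℕ c
    0≤c = fromℕ-nonNeg c

    1≤m : 1 ≤ m
    1≤m = ≤-trans 1≤c c≤m

    density-interval : ∀ a {T} → T ≤ n → ∑ T (λ x → density (a + x)) ≼ totalEnergy
    density-interval a {T} T≤n = ≼-trans (≼-reflexive (∑-swap T (suc c) (λ x j → energyAt (m + j) (a + x))))
      (∑-mono (suc c) (λ j _ → energy-interval (m + j) a T≤n))

    ends≼density : ∀ x → energyAt m x ⊕ energyAt (m + c) x ≼ density x
    ends≼density x = ⊕-monoˡ _ (≼-trans (≼-reflexive (cong (λ t → energyAt t x) (sym (+-identityʳ m))))
      (∑-term (λ j → energyAt (m + j) x) (λ j → energyAt-nonNeg (m + j) x) 0 1≤c))

    energy-m≼ : energy m ≼ totalEnergy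
    energy-m≼ = ≼-trans (≼-reflexive (cong energy (sym (+-identityʳ m))))
      (∑-term {suc c} (λ j → energy (m + j)) (λ j → energy-nonNeg (m + j)) 0 (s≤s z≤n))

    -- The steps m, ..., m + c - 1 from `x` reach exactly the points of the window, so only the
    -- density at `x` itself is spent.
    spread-base : ∀ x → fromℕ c ⊗ sq (fromℕ c ⊗ f x ⊖ window c (x + m)) ≼ sq (fromℕ c) ⊗ density x
    spread-base x = begin
      C ⊗ sq (C ⊗ f x ⊖ window c (x + m)) ≡⟨ cong (λ t → C ⊗ sq (t ⊖ window c (x + m))) (sym (∑-const c (f x))) ⟩
      C ⊗ sq (∑ c (λ _ → f x) ⊖ window c (x + m)) ≡⟨ cong (λ t → C ⊗ t) (trans (flip (∑ c (λ _ → f x)) (window c (x + m))) (cong sq (trans (sym (∑-distrib-⊖ c (λ y → f (x + m + y)) (λ _ → f x))) (∑-cong c (λ j _ → cong (λ t → f t ⊖ f x) (+-assoc x m j)))))) ⟩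
      C ⊗ sq (∑ c (λ j → Δ (m + j) x)) ≤⟨ ⊗-monoʳ 0≤c (sq-∑ c (λ j → Δ (m + j) x)) ⟩
      C ⊗ (C ⊗ ∑ c (λ j → energyAt (m + j) x)) ≤⟨ ⊗-monoʳ 0≤c (⊗-monoʳ 0≤c (a≼a⊕b (energyAt-nonNeg (m + c) x))) ⟩
      C ⊗ (C ⊗ density x) ≡⟨ ℚₚ.*-assoc C C (density x) ⟨
      sq C ⊗ density x ∎
      where
      open ℚₚ.≤-Reasoning
      C = fromℕ c
      flip : ∀ a b → (a ⊖ b) ⊗ (a ⊖ b) ≡ (b ⊖ a) ⊗ (b ⊖ a)
      flip = solve-∀ ℚ-ring

    -- One doubling: half of the window travels r steps of length m, the other half r steps of length m + c, where r c is the width.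
    window-double : ∀ r a → r * c + r * c ≤ m → let w = r * c in
      fromℕ c ⊗ sq ((window w a ⊕ window w a) ⊖ window (w + w) (a + r * m))
        ≼ ((1ℚ ⊕ 1ℚ) ⊗ sq (fromℕ w)) ⊗ ∑ (r * m) (λ x → density (a + x))
    window-double r a 2w≤m = begin
      C ⊗ sq ((window w a ⊕ window w a) ⊖ window (w + w) (a + r * m))
        -- After `r` steps of lengths `m` and `m + c` the two copies are `r c` apart. This is their
        -- width, so they lie side by side and form a window of twice the width.
        ≡⟨ cong (λ t → C ⊗ sq ((window w a ⊕ window w a) ⊖ t)) (trans (window-split w w (a + r * m)) (cong (λ t → window w (a + r * m) ⊕ window w t) (endpoint a r m c))) ⟩
      C ⊗ sq ((window w a ⊕ window w a) ⊖ (window w (a + r * m) ⊕ window w (a + r * (m + c))))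
        ≡⟨ cong (C ⊗_) (regroup (window w a) (window w (a + r * m)) (window w (a + r * (m + c)))) ⟩
      C ⊗ sq ((window w (a + r * m) ⊖ window w a) ⊕ (window w (a + r * (m + c)) ⊖ window w a))
        ≤⟨ ⊗-monoʳ 0≤c (cauchy-schwarz-⊕ (window w (a + r * m) ⊖ window w a) (window w (a + r * (m + c)) ⊖ window w a) (fromℕ-nonNeg (r * w)) (fromℕ-nonNeg (r * w))
             (∑-nonNeg (r * m) (λ x → energyAt-nonNeg m (a + x))) (∑-nonNeg (r * m) (λ x → energyAt-nonNeg (m + c) (a + x)))
             (window-move m r w a (r * m) w≤m (+-monoʳ-≤ (r * m) w≤m))
             (window-move (m + c) r w a (r * m) (≤-trans w≤m (m≤m+n m c)) fits)) ⟩
      C ⊗ ((fromℕ (r * w) ⊕ fromℕ (r * w)) ⊗ (∑ (r * m) (λ x → energyAt m (a + x)) ⊕ ∑ (r * m) (λ x → energyAt (m + c) (a + x))))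
        ≡⟨ cong₂ (λ s t → C ⊗ ((s ⊕ s) ⊗ t)) (trans (fromℕ-homo-* r w) (cong (fromℕ r ⊗_) (fromℕ-homo-* r c))) (sym (∑-distrib-⊕ (r * m) _ _)) ⟩
      C ⊗ ((R ⊗ (R ⊗ C) ⊕ R ⊗ (R ⊗ C)) ⊗ ∑ (r * m) (λ x → energyAt m (a + x) ⊕ energyAt (m + c) (a + x)))
        ≡⟨ arrange C R (∑ (r * m) (λ x → energyAt m (a + x) ⊕ energyAt (m + c) (a + x))) ⟩
      ((1ℚ ⊕ 1ℚ) ⊗ ((R ⊗ C) ⊗ (R ⊗ C))) ⊗ ∑ (r * m) (λ x → energyAt m (a + x) ⊕ energyAt (m + c) (a + x))
        ≡⟨ cong (λ t → ((1ℚ ⊕ 1ℚ) ⊗ sq t) ⊗ ∑ (r * m) (λ x → energyAt m (a + x) ⊕ energyAt (m + c) (a + x))) (sym (fromℕ-homo-* r c)) ⟩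
      ((1ℚ ⊕ 1ℚ) ⊗ sq (fromℕ w)) ⊗ ∑ (r * m) (λ x → energyAt m (a + x) ⊕ energyAt (m + c) (a + x))
        ≤⟨ ⊗-monoʳ (⊗-nonNeg (fromℕ-nonNeg 2) (sq-nonNeg (fromℕ w))) (∑-mono (r * m) (λ x _ → ends≼density (a + x))) ⟩
      ((1ℚ ⊕ 1ℚ) ⊗ sq (fromℕ w)) ⊗ ∑ (r * m) (λ x → density (a + x)) ∎
      where
      open ℚₚ.≤-Reasoning
      w = r * c
      C = fromℕ c
      R = fromℕ r
      w≤m : w ≤ m
      w≤m = ≤-trans (m≤m+n w w) 2w≤m
      endpoint : ∀ a r m c → a + r * m + r * c ≡ a + r * (m + c)
      endpoint = ℕ-Solver.solve-∀
      regroup : ∀ x y z → ((x ⊕ x) ⊖ (y ⊕ z)) ⊗ ((x ⊕ x) ⊖ (y ⊕ z)) ≡ ((y ⊖ x) ⊕ (z ⊖ x)) ⊗ ((y ⊖ x) ⊕ (z ⊖ x))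
      regroup = solve-∀ ℚ-ring
      arrange : ∀ C R X → C ⊗ ((R ⊗ (R ⊗ C) ⊕ R ⊗ (R ⊗ C)) ⊗ X) ≡ ((1ℚ ⊕ 1ℚ) ⊗ ((R ⊗ C) ⊗ (R ⊗ C))) ⊗ X
      arrange = solve-∀ ℚ-ring
      -- The copy moving by `m + c` has its last block end at (r - 1)(m + c) + r c, which is at most
      -- `r m` because 2 r c ≤ m. Both copies therefore spend energy in the same stretch of length
      -- `r m`.
      fits : r * (m + c) + w ≤ r * m + (m + c)
      fits = ≤-trans (≤-reflexive (shuffle r m c)) (+-monoʳ-≤ (r * m) (≤-trans 2w≤m (m≤m+n m c)))
        where
        shuffle : ∀ r m c → r * (m + c) + r * c ≡ r * m + (r * c + r * c)
        shuffle = ℕ-Solver.solve-∀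

    -- Induction on the number of doublings. Each doubling spends energy in a stretch as long as all
    -- earlier ones together and starting where they end, so the energies add up to one stretch.
    -- Each of the i + 1 stages enters with the weight of the final squared width, whence the factor
    -- `suc i`.
    spread : ∀ i x → 2 ^ i * c ≤ m →
      fromℕ c ⊗ sq (fromℕ (2 ^ i * c) ⊗ f x ⊖ window (2 ^ i * c) (x + 2 ^ i * m))
        ≼ (fromℕ (suc i) ⊗ sq (fromℕ (2 ^ i * c))) ⊗ ∑ (2 ^ i * m) (λ y → density (x + y))
    spread zero x _ = begin
      C ⊗ sq (fromℕ (1 * c) ⊗ f x ⊖ window (1 * c) (x + 1 * m)) ≡⟨ cong₂ (λ s t → C ⊗ sq (fromℕ s ⊗ f x ⊖ window s (x + t))) (*-identityˡ c) (*-identityˡ m) ⟩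
      C ⊗ sq (C ⊗ f x ⊖ window c (x + m)) ≤⟨ spread-base x ⟩
      sq C ⊗ density x ≤⟨ ⊗-monoʳ (sq-nonNeg C) one-term ⟩
      sq C ⊗ ∑ (1 * m) (λ y → density (x + y)) ≡⟨ cong (_⊗ ∑ (1 * m) (λ y → density (x + y))) (trans (sym (ℚₚ.*-identityˡ (sq C))) (cong (λ t → fromℕ 1 ⊗ sq (fromℕ t)) (sym (*-identityˡ c)))) ⟩
      (fromℕ 1 ⊗ sq (fromℕ (1 * c))) ⊗ ∑ (1 * m) (λ y → density (x + y)) ∎
      where
      open ℚₚ.≤-Reasoning
      C = fromℕ c
      one-term : density x ≼ ∑ (1 * m) (λ y → density (x + y))
      one-term = ≼-trans (≼-reflexive (cong density (sym (+-identityʳ x))))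
        (∑-term (λ y → density (x + y)) (λ y → density-nonNeg (x + y)) 0 (≤-trans 1≤m (≤-reflexive (sym (*-identityˡ m)))))
    spread (suc i) x fits = begin
      C ⊗ sq (fromℕ (2 ^ suc i * c) ⊗ f x ⊖ window (2 ^ suc i * c) (x + 2 ^ suc i * m))
        ≡⟨ cong₂ (λ s t → C ⊗ sq (fromℕ s ⊗ f x ⊖ window s t)) (double r c) (trans (cong (x +_) (double r m)) (sym (+-assoc x (r * m) (r * m)))) ⟩
      C ⊗ sq (fromℕ (w + w) ⊗ f x ⊖ window (w + w) (a + r * m))
        ≡⟨ cong (C ⊗_) (trans (cong (λ t → sq (t ⊗ f x ⊖ window (w + w) (a + r * m))) (fromℕ-homo-+ w w)) (regroup (fromℕ w) (f x) (window w a) (window (w + w) (a + r * m)))) ⟩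
      C ⊗ sq ((1ℚ ⊕ 1ℚ) ⊗ A ⊕ B)
        ≤⟨ scaled-cauchy-schwarz-⊕ C ((1ℚ ⊕ 1ℚ) ⊗ A) B 0<c (⊗-nonNeg (fromℕ-nonNeg (suc i)) (sq-nonNeg (2w))) (sq-nonNeg 2w) (∑-nonNeg (r * m) (λ y → density-nonNeg (x + y))) (∑-nonNeg (r * m) (λ y → density-nonNeg (a + y))) hA hB ⟩
      (fromℕ (suc i) ⊗ sq 2w ⊕ sq 2w) ⊗ (∑ (r * m) (λ y → density (x + y)) ⊕ ∑ (r * m) (λ y → density (a + y)))
        ≡⟨ cong₂ _⊗_ weights intervals ⟩
      (fromℕ (suc (suc i)) ⊗ sq (fromℕ (2 ^ suc i * c))) ⊗ ∑ (2 ^ suc i * m) (λ y → density (x + y)) ∎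
      where
      open ℚₚ.≤-Reasoning
      r = 2 ^ i
      w = r * c
      C = fromℕ c
      2w = (1ℚ ⊕ 1ℚ) ⊗ fromℕ w
      a = x + r * m
      A = fromℕ w ⊗ f x ⊖ window w a
      B = (window w a ⊕ window w a) ⊖ window (w + w) (a + r * m)
      double : ∀ r c → (r + (r + 0)) * c ≡ r * c + r * c
      double = ℕ-Solver.solve-∀
      2w≤m : w + w ≤ m
      2w≤m = ≤-trans (≤-reflexive (sym (double r c))) fits
      regroup : ∀ w x u v → ((w ⊕ w) ⊗ x ⊖ v) ⊗ ((w ⊕ w) ⊗ x ⊖ v) ≡ ((1ℚ ⊕ 1ℚ) ⊗ (w ⊗ x ⊖ u) ⊕ ((u ⊕ u) ⊖ v)) ⊗ ((1ℚ ⊕ 1ℚ) ⊗ (w ⊗ x ⊖ u) ⊕ ((u ⊕ u) ⊖ v))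
      regroup = solve-∀ ℚ-ring
      pull : ∀ t c a → c ⊗ ((t ⊗ a) ⊗ (t ⊗ a)) ≡ t ⊗ t ⊗ (c ⊗ (a ⊗ a))
      pull = solve-∀ ℚ-ring
      push : ∀ t k w X → t ⊗ t ⊗ ((k ⊗ (w ⊗ w)) ⊗ X) ≡ (k ⊗ ((t ⊗ w) ⊗ (t ⊗ w))) ⊗ X
      push = solve-∀ ℚ-ring
      hA : C ⊗ sq ((1ℚ ⊕ 1ℚ) ⊗ A) ≼ (fromℕ (suc i) ⊗ sq 2w) ⊗ ∑ (r * m) (λ y → density (x + y))
      hA = begin
        C ⊗ sq ((1ℚ ⊕ 1ℚ) ⊗ A) ≡⟨ pull (1ℚ ⊕ 1ℚ) C A ⟩
        (1ℚ ⊕ 1ℚ) ⊗ (1ℚ ⊕ 1ℚ) ⊗ (C ⊗ sq A) ≤⟨ ⊗-monoʳ (fromℕ-nonNeg 4) (spread i x (≤-trans (m≤m+n w w) 2w≤m)) ⟩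
        (1ℚ ⊕ 1ℚ) ⊗ (1ℚ ⊕ 1ℚ) ⊗ ((fromℕ (suc i) ⊗ sq (fromℕ w)) ⊗ ∑ (r * m) (λ y → density (x + y))) ≡⟨ push (1ℚ ⊕ 1ℚ) (fromℕ (suc i)) (fromℕ w) _ ⟩
        (fromℕ (suc i) ⊗ sq 2w) ⊗ ∑ (r * m) (λ y → density (x + y)) ∎
      split-two : ∀ w → ((1ℚ ⊕ 1ℚ) ⊗ w) ⊗ ((1ℚ ⊕ 1ℚ) ⊗ w) ≡ (1ℚ ⊕ 1ℚ) ⊗ (w ⊗ w) ⊕ (1ℚ ⊕ 1ℚ) ⊗ (w ⊗ w)
      split-two = solve-∀ ℚ-ring
      -- A doubling costs 2w²; raising this to (2w)² gives all stages equal weight.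
      hB : C ⊗ sq B ≼ sq 2w ⊗ ∑ (r * m) (λ y → density (a + y))
      hB = ≼-trans (window-double r a 2w≤m) (⊗-monoˡ {a = (1ℚ ⊕ 1ℚ) ⊗ sq (fromℕ w)} {b = sq 2w} (∑-nonNeg (r * m) (λ y → density-nonNeg (a + y)))
        (≼-by-difference (⊗-nonNeg (fromℕ-nonNeg 2) (sq-nonNeg (fromℕ w))) (split-two (fromℕ w))))
      collect : ∀ k x → k ⊗ x ⊕ x ≡ (k ⊕ 1ℚ) ⊗ x
      collect = solve-∀ ℚ-ring
      twice : ∀ w → (1ℚ ⊕ 1ℚ) ⊗ w ≡ w ⊕ w
      twice = solve-∀ ℚ-ring
      weights : fromℕ (suc i) ⊗ sq 2w ⊕ sq 2w ≡ fromℕ (suc (suc i)) ⊗ sq (fromℕ (2 ^ suc i * c))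
      weights = trans (collect (fromℕ (suc i)) (sq 2w)) (cong₂ (λ s t → s ⊗ sq t) (sym (fromℕ-suc (suc i)))
        (trans (twice (fromℕ w)) (trans (sym (fromℕ-homo-+ w w)) (cong fromℕ (sym (double r c))))))
      intervals : ∑ (r * m) (λ y → density (x + y)) ⊕ ∑ (r * m) (λ y → density (a + y)) ≡ ∑ (2 ^ suc i * m) (λ y → density (x + y))
      intervals = sym (trans (cong (λ t → ∑ t (λ y → density (x + y))) (double r m)) (trans (∑-split (r * m) (r * m) (λ y → density (x + y)))
        (cong (∑ (r * m) (λ y → density (x + y)) ⊕_) (∑-cong (r * m) (λ y _ → cong density (sym (+-assoc x (r * m) y)))))))

    -- The distance δ is covered by about δ / (m + j) steps of length m + j, averaged over all j ≤ c; the remainder is a slide.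
    transport : ∀ a δ → δ ≤ n →
      fromℕ (suc c) ⊗ sq (window m (a + δ) ⊖ window m a) ≼ ((1ℚ ⊕ 1ℚ) ⊗ (fromℕ n ⊕ fromℕ (suc c) ⊗ fromℕ (m + m))) ⊗ totalEnergy
    transport a δ δ≤n = ⊗-cancelˡ (fromℕ-0< {suc c} (s≤s z≤n)) (begin
      K ⊗ (K ⊗ sq D) ≡⟨ scale K D ⟩
      sq (K ⊗ D) ≡⟨ cong sq (sym (∑-const (suc c) D)) ⟩
      sq (∑ (suc c) (λ _ → D)) ≡⟨ cong sq (trans (∑-cong (suc c) (λ j _ → via j)) (∑-distrib-⊕ (suc c) X Y)) ⟩
      sq (∑ (suc c) X ⊕ ∑ (suc c) Y) ≤⟨ cauchy-schwarz-⊕ (∑ (suc c) X) (∑ (suc c) Y) (⊗-nonNeg 0≤K (fromℕ-nonNeg n)) (⊗-nonNeg (⊗-nonNeg 0≤K (fromℕ-nonNeg (m + m))) 0≤K) totalEnergy-nonNeg totalEnergy-nonNeg sumX sumY ⟩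
      (K ⊗ fromℕ n ⊕ K ⊗ fromℕ (m + m) ⊗ K) ⊗ (totalEnergy ⊕ totalEnergy)
                                           ≡⟨ collect K (fromℕ n) (fromℕ (m + m)) totalEnergy ⟩
      K ⊗ (((1ℚ ⊕ 1ℚ) ⊗ (fromℕ n ⊕ K ⊗ fromℕ (m + m))) ⊗ totalEnergy) ∎)
      where
      open ℚₚ.≤-Reasoning
      K = fromℕ (suc c)
      0≤K = fromℕ-nonNeg (suc c)
      D = window m (a + δ) ⊖ window m a
      instance
        step-nonZero : ∀ {j} → ℕ.NonZero (m + j)
        step-nonZero {j} = ℕ.>-nonZero (≤-trans 1≤m (m≤m+n m j))
      q ρ halt : ℕ → ℕ
      q j = δ ℕ/./ (m + j)
      ρ j = δ ℕ/.% (m + j)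
      halt j = a + q j * (m + j)
      X Y : ℕ → ℚ
      X j = window m (halt j) ⊖ window m a
      Y j = window m (halt j + ρ j) ⊖ window m (halt j)
      chain : ∀ x y z → z ⊖ x ≡ (y ⊖ x) ⊕ (z ⊖ y)
      chain = solve-∀ ℚ-ring
      decompose : ∀ j → q j * (m + j) + ρ j ≡ δ
      decompose j = trans (+-comm (q j * (m + j)) (ρ j)) (sym (ℕ/.m≡m%n+[m/n]*n δ (m + j)))
      via : ∀ j → D ≡ X j ⊕ Y j
      via j = trans (chain (window m a) (window m (halt j)) (window m (a + δ)))
        (cong (λ t → X j ⊕ (window m t ⊖ window m (halt j))) (trans (cong (a +_) (sym (decompose j))) (sym (+-assoc a _ (ρ j)))))
      qstep≤δ : ∀ j → q j * (m + j) ≤ δ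
      qstep≤δ j = ≤-trans (m≤m+n _ (ρ j)) (≤-reflexive (decompose j))
      X-bound : ∀ j → sq (X j) ≼ fromℕ n ⊗ energy (m + j)
      X-bound j = begin
        sq (X j) ≤⟨ window-move (m + j) (q j) m a n (m≤m+n m j) (+-mono-≤ (≤-trans (qstep≤δ j) δ≤n) (m≤m+n m j)) ⟩
        fromℕ (q j * m) ⊗ ∑ n (λ x → energyAt (m + j) (a + x)) ≡⟨ cong (fromℕ (q j * m) ⊗_) (energy-shift (m + j) a) ⟩
        fromℕ (q j * m) ⊗ energy (m + j) ≤⟨ ⊗-monoˡ (energy-nonNeg (m + j)) (fromℕ-mono (≤-trans (*-monoʳ-≤ (q j) (m≤m+n m j)) (≤-trans (qstep≤δ j) δ≤n))) ⟩
        fromℕ n ⊗ energy (m + j) ∎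
      Y-bound : ∀ j → j < suc c → sq (Y j) ≼ fromℕ (m + m) ⊗ totalEnergy
      Y-bound j (s≤s j≤c) = ≼-trans (window-slide m (halt j) (ρ j) (≤-trans (ℕ/.m%n≤m δ (m + j)) δ≤n))
        (⊗-mono (fromℕ-nonNeg (ρ j)) totalEnergy-nonNeg (fromℕ-mono (≤-trans (<⇒≤ (ℕ/.m%n<n δ (m + j))) (+-monoʳ-≤ m (≤-trans j≤c c≤m)))) energy-m≼)
      sumX : sq (∑ (suc c) X) ≼ (K ⊗ fromℕ n) ⊗ totalEnergy
      sumX = ≼-trans (cauchy-schwarz-∑ (suc c) X (λ _ → fromℕ-nonNeg n) (λ j → energy-nonNeg (m + j)) (λ j _ → X-bound j))
        (≼-reflexive (cong (_⊗ totalEnergy) (∑-const (suc c) (fromℕ n))))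
      -- All slides use the same generator `m`, so averaging over `j` gains nothing here and the
      -- total energy is counted c + 1 times. This is affordable because the slides are shorter than
      -- 2m.
      sumY : sq (∑ (suc c) Y) ≼ (K ⊗ fromℕ (m + m) ⊗ K) ⊗ totalEnergy
      sumY = ≼-trans (cauchy-schwarz-∑ (suc c) Y (λ _ → fromℕ-nonNeg (m + m)) (λ _ → totalEnergy-nonNeg) Y-bound)
        (≼-reflexive (trans (cong₂ _⊗_ (∑-const (suc c) (fromℕ (m + m))) (∑-const (suc c) totalEnergy)) (sym (ℚₚ.*-assoc (K ⊗ fromℕ (m + m)) K totalEnergy))))
      scale : ∀ K D → K ⊗ (K ⊗ (D ⊗ D)) ≡ (K ⊗ D) ⊗ (K ⊗ D)
      scale = solve-∀ ℚ-ring
      collect : ∀ K N M E → (K ⊗ N ⊕ K ⊗ M ⊗ K) ⊗ (E ⊕ E) ≡ K ⊗ (((1ℚ ⊕ 1ℚ) ⊗ (N ⊕ K ⊗ M)) ⊗ E)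
      collect = solve-∀ ℚ-ring

    -- The route is from `x` to its window of width `m`, to the window of `y`, and back to the point
    -- `y`. In units of m² the weights are L + 1, 2(Q + 4) and L + 1, where `n ≤ Q m²` makes the
    -- transport comparable to the spreading. Each of the three pieces may use the whole energy:
    -- 3(2(L + 1) + 2(Q + 4)) = 6(L + Q + 5).
    oscillation : ∀ L Q x δ → m ≡ 2 ^ L * c → 2 ^ L * m ≤ n → n ≤ Q * (m * m) → δ ≤ n →
      fromℕ c ⊗ sq (f x ⊖ f (x + δ)) ≼ fromℕ (6 * (L + Q + 5)) ⊗ totalEnergy
    oscillation L Q x δ m≡ span n≤Qm² δ≤n = ⊗-cancelˡ 0<m² (begin
      sq M ⊗ (C ⊗ sq (f x ⊖ f y)) ≡⟨ regroup M C (f x) (f y) (window m a) (window m b) ⟩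
      C ⊗ sq (((M ⊗ f x ⊖ window m a) ⊕ ⊖ (window m b ⊖ window m a)) ⊕ ⊖ (M ⊗ f y ⊖ window m b))
        ≤⟨ scaled-cauchy-schwarz-⊕ C ((M ⊗ f x ⊖ window m a) ⊕ ⊖ (window m b ⊖ window m a)) (⊖ (M ⊗ f y ⊖ window m b)) 0<c
             (⊕-nonNeg 0≤p 0≤q) 0≤p (⊕-nonNeg totalEnergy-nonNeg totalEnergy-nonNeg) totalEnergy-nonNeg
             (scaled-cauchy-schwarz-⊕ C (M ⊗ f x ⊖ window m a) (⊖ (window m b ⊖ window m a)) 0<c 0≤p 0≤q totalEnergy-nonNeg totalEnergy-nonNeg
               (spread-m x) (≼-trans (≼-reflexive (cong (C ⊗_) (sq-neg (window m b ⊖ window m a)))) transported))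
             (≼-trans (≼-reflexive (cong (C ⊗_) (sq-neg (M ⊗ f y ⊖ window m b)))) (spread-m y)) ⟩
      (p ⊕ q ⊕ p) ⊗ (totalEnergy ⊕ totalEnergy ⊕ totalEnergy) ≡⟨ collect (fromℕ (suc L)) (fromℕ (2 * (Q + 4))) M totalEnergy ⟩
      sq M ⊗ ((1ℚ ⊕ 1ℚ ⊕ 1ℚ) ⊗ (fromℕ (suc L) ⊕ fromℕ (2 * (Q + 4)) ⊕ fromℕ (suc L)) ⊗ totalEnergy) ≡⟨ cong (λ t → sq M ⊗ (t ⊗ totalEnergy)) constants ⟩
      sq M ⊗ (fromℕ (6 * (L + Q + 5)) ⊗ totalEnergy) ∎)
      where
      open ℚₚ.≤-Reasoning
      M = fromℕ m
      C = fromℕ c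
      y = x + δ
      a = x + 2 ^ L * m
      b = y + 2 ^ L * m
      p = fromℕ (suc L) ⊗ sq M
      q = fromℕ (2 * (Q + 4)) ⊗ sq M
      0≤p = ⊗-nonNeg (fromℕ-nonNeg (suc L)) (sq-nonNeg M)
      0≤q = ⊗-nonNeg (fromℕ-nonNeg (2 * (Q + 4))) (sq-nonNeg M)
      0<m² : 0ℚ ≺ sq M
      0<m² = ℚₚ.<-≤-trans (fromℕ-0< (*-mono-≤ 1≤m 1≤m)) (≼-reflexive (fromℕ-homo-* m m))
      regroup : ∀ M C x y u v → M ⊗ M ⊗ (C ⊗ ((x ⊖ y) ⊗ (x ⊖ y))) ≡
        C ⊗ ((((M ⊗ x ⊖ u) ⊕ ⊖ (v ⊖ u)) ⊕ ⊖ (M ⊗ y ⊖ v)) ⊗ (((M ⊗ x ⊖ u) ⊕ ⊖ (v ⊖ u)) ⊕ ⊖ (M ⊗ y ⊖ v)))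
      regroup = solve-∀ ℚ-ring
      collect : ∀ l k M E → (l ⊗ (M ⊗ M) ⊕ k ⊗ (M ⊗ M) ⊕ l ⊗ (M ⊗ M)) ⊗ (E ⊕ E ⊕ E) ≡ M ⊗ M ⊗ ((1ℚ ⊕ 1ℚ ⊕ 1ℚ) ⊗ (l ⊕ k ⊕ l) ⊗ E)
      collect = solve-∀ ℚ-ring
      constants : (1ℚ ⊕ 1ℚ ⊕ 1ℚ) ⊗ (fromℕ (suc L) ⊕ fromℕ (2 * (Q + 4)) ⊕ fromℕ (suc L)) ≡ fromℕ (6 * (L + Q + 5))
      constants = sym (trans (cong fromℕ (count L Q)) (trans (fromℕ-homo-* 3 (suc L + 2 * (Q + 4) + suc L))
        (cong (fromℕ 3 ⊗_) (trans (fromℕ-homo-+ (suc L + 2 * (Q + 4)) (suc L)) (cong (_⊕ fromℕ (suc L)) (fromℕ-homo-+ (suc L) (2 * (Q + 4))))))))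
        where
        count : ∀ L Q → 6 * (L + Q + 5) ≡ 3 * (suc L + 2 * (Q + 4) + suc L)
        count = ℕ-Solver.solve-∀
      spread-m : ∀ z → C ⊗ sq (M ⊗ f z ⊖ window m (z + 2 ^ L * m)) ≼ p ⊗ totalEnergy
      spread-m z = ≼-trans (subst (λ w → C ⊗ sq (fromℕ w ⊗ f z ⊖ window w (z + 2 ^ L * m)) ≼ (fromℕ (suc L) ⊗ sq (fromℕ w)) ⊗ ∑ (2 ^ L * m) (λ y → density (z + y))) (sym m≡)
          (spread L z (≤-reflexive (sym m≡)))) (⊗-monoʳ 0≤p (density-interval z span))
      transported : C ⊗ sq (window m b ⊖ window m a) ≼ q ⊗ totalEnergy
      transported = begin
        C ⊗ sq (window m b ⊖ window m a) ≤⟨ ⊗-monoˡ (sq-nonNeg (window m b ⊖ window m a)) (fromℕ-mono (n≤1+n c)) ⟩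
        fromℕ (suc c) ⊗ sq (window m b ⊖ window m a) ≡⟨ cong (λ t → fromℕ (suc c) ⊗ sq (window m t ⊖ window m a)) (swap-right x δ (2 ^ L * m)) ⟩
        fromℕ (suc c) ⊗ sq (window m (a + δ) ⊖ window m a) ≤⟨ transport a δ δ≤n ⟩
        ((1ℚ ⊕ 1ℚ) ⊗ (fromℕ n ⊕ fromℕ (suc c) ⊗ fromℕ (m + m))) ⊗ totalEnergy ≡⟨ cong (_⊗ totalEnergy) (sym cost) ⟩
        fromℕ (2 * (n + suc c * (m + m))) ⊗ totalEnergy ≤⟨ ⊗-monoˡ totalEnergy-nonNeg (fromℕ-mono (≤-trans (*-monoʳ-≤ 2 (+-mono-≤ n≤Qm² (*-monoˡ-≤ (m + m) (+-mono-≤ 1≤m c≤m)))) (≤-reflexive (shape Q m)))) ⟩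
        fromℕ (2 * (Q + 4) * (m * m)) ⊗ totalEnergy ≡⟨ cong (_⊗ totalEnergy) (trans (fromℕ-homo-* (2 * (Q + 4)) (m * m)) (cong (fromℕ (2 * (Q + 4)) ⊗_) (fromℕ-homo-* m m))) ⟩
        q ⊗ totalEnergy ∎
        where
        shape : ∀ Q m → 2 * (Q * (m * m) + (m + m) * (m + m)) ≡ 2 * (Q + 4) * (m * m)
        shape = ℕ-Solver.solve-∀
        cost : fromℕ (2 * (n + suc c * (m + m))) ≡ (1ℚ ⊕ 1ℚ) ⊗ (fromℕ n ⊕ fromℕ (suc c) ⊗ fromℕ (m + m))
        cost = trans (fromℕ-homo-* 2 (n + suc c * (m + m))) (cong (fromℕ 2 ⊗_) (trans (fromℕ-homo-+ n (suc c * (m + m))) (cong (fromℕ n ⊕_) (fromℕ-homo-* (suc c) (m + m)))))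

-- Finite distributions

private variable
  A B : Set

sumOver : List A → (A → ℚ) → ℚ
sumOver []       F = 0ℚ
sumOver (x ∷ xs) F = F x ⊕ sumOver xs F

sumOver-cong : ∀ (xs : List A) {F G} → (∀ x → F x ≡ G x) → sumOver xs F ≡ sumOver xs G
sumOver-cong []       h = refl
sumOver-cong (x ∷ xs) h = cong₂ _⊕_ (h x) (sumOver-cong xs h)

sumOver-mono : ∀ (xs : List A) {F G} → (∀ x → F x ≼ G x) → sumOver xs F ≼ sumOver xs G
sumOver-mono []       h = ≼-refl
sumOver-mono (x ∷ xs) h = ⊕-mono (h x) (sumOver-mono xs h)

sumOver-nonNeg : ∀ (xs : List A) {F} → (∀ x → 0ℚ ≼ F x) → 0ℚ ≼ sumOver xs F
sumOver-nonNeg []       h = ≼-refl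
sumOver-nonNeg (x ∷ xs) h = ⊕-nonNeg (h x) (sumOver-nonNeg xs h)

sumOver-distrib-⊕ : ∀ (xs : List A) F G → sumOver xs (λ x → F x ⊕ G x) ≡ sumOver xs F ⊕ sumOver xs G
sumOver-distrib-⊕ []       F G = refl
sumOver-distrib-⊕ (x ∷ xs) F G = trans (cong (F x ⊕ G x ⊕_) (sumOver-distrib-⊕ xs F G)) (eq (F x) (G x) (sumOver xs F) (sumOver xs G))
  where
  eq : ∀ a b c d → a ⊕ b ⊕ (c ⊕ d) ≡ a ⊕ c ⊕ (b ⊕ d)
  eq = solve-∀ ℚ-ring

sumOver-distribˡ-⊗ : ∀ (xs : List A) a F → sumOver xs (λ x → a ⊗ F x) ≡ a ⊗ sumOver xs F
sumOver-distribˡ-⊗ []       a F = sym (ℚₚ.*-zeroʳ a)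
sumOver-distribˡ-⊗ (x ∷ xs) a F = trans (cong (a ⊗ F x ⊕_) (sumOver-distribˡ-⊗ xs a F)) (sym (ℚₚ.*-distribˡ-+ a (F x) (sumOver xs F)))

sumOver-const : ∀ (xs : List A) a → sumOver xs (λ _ → a) ≡ fromℕ (length xs) ⊗ a
sumOver-const []       a = sym (ℚₚ.*-zeroˡ a)
sumOver-const (x ∷ xs) a = trans (cong (a ⊕_) (sumOver-const xs a)) (trans (eq a (fromℕ (length xs))) (cong (_⊗ a) (sym (fromℕ-suc (length xs)))))
  where
  eq : ∀ a k → a ⊕ k ⊗ a ≡ (k ⊕ 1ℚ) ⊗ a
  eq = solve-∀ ℚ-ring

sumOver-swap : ∀ (xs : List A) (ys : List B) (F : A → B → ℚ) →
  sumOver xs (λ x → sumOver ys (F x)) ≡ sumOver ys (λ y → sumOver xs (λ x → F x y))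
sumOver-swap []       ys F = sym (trans (sumOver-const ys 0ℚ) (ℚₚ.*-zeroʳ (fromℕ (length ys))))
sumOver-swap (x ∷ xs) ys F = trans (cong (sumOver ys (F x) ⊕_) (sumOver-swap xs ys F)) (sym (sumOver-distrib-⊕ ys (F x) (λ y → sumOver xs (λ x → F x y))))

sumOver-term : ∀ {xs : List A} {x} F → (∀ x → 0ℚ ≼ F x) → x ∈ˡ xs → F x ≼ sumOver xs F
sumOver-term {xs = _ ∷ xs} F 0≤F (here refl) = a≼a⊕b (sumOver-nonNeg xs 0≤F)
sumOver-term F 0≤F (there x∈xs) = ≼-trans (sumOver-term F 0≤F x∈xs) (b≼a⊕b (0≤F _))

sumOver-filter : ∀ {P : A → Set} (P? : ∀ x → Dec (P x)) (xs : List A) F →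
  sumOver (filter P? xs) F ≡ sumOver xs (λ x → if does (P? x) then F x else 0ℚ)
sumOver-filter P? []       F = refl
sumOver-filter P? (x ∷ xs) F with does (P? x)
... | true  = cong (F x ⊕_) (sumOver-filter P? xs F)
... | false = trans (sumOver-filter P? xs F) (sym (ℚₚ.+-identityˡ _))

expect-++ : ∀ (D E : Dist A) F → expect (D ++ E) F ≡ expect D F ⊕ expect E F
expect-++ []            E F = sym (ℚₚ.+-identityˡ _)
expect-++ ((p , x) ∷ D) E F = trans (cong (p ⊗ F x ⊕_) (expect-++ D E F)) (sym (ℚₚ.+-assoc (p ⊗ F x) (expect D F) (expect E F)))

expect-return : ∀ (x : A) F → expect (return x) F ≡ F x
expect-return x F = trans (ℚₚ.+-identityʳ _) (ℚₚ.*-identityˡ (F x))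

expect->>= : ∀ (D : Dist A) (g : A → Dist B) F → expect (D >>= g) F ≡ expect D (λ x → expect (g x) F)
expect->>= []            g F = refl
expect->>= ((p , x) ∷ D) g F = trans (expect-++ (map _ (g x)) (D >>= g) F) (cong₂ _⊕_ (scale (g x)) (expect->>= D g F))
  where
  scale : ∀ E → expect (map (λ { (q , y) → p ⊗ q , y }) E) F ≡ p ⊗ expect E F
  scale []            = sym (ℚₚ.*-zeroʳ p)
  scale ((q , y) ∷ E) = trans (cong₂ _⊕_ (ℚₚ.*-assoc p q (F y)) (scale E)) (sym (ℚₚ.*-distribˡ-+ p (q ⊗ F y) (expect E F)))

expect-cong : ∀ (D : Dist A) {F G} → (∀ x → F x ≡ G x) → expect D F ≡ expect D G
expect-cong []            h = refl
expect-cong ((p , x) ∷ D) h = cong₂ (λ s t → p ⊗ s ⊕ t) (h x) (expect-cong D h)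

expect-distrib-⊕ : ∀ (D : Dist A) F G → expect D (λ x → F x ⊕ G x) ≡ expect D F ⊕ expect D G
expect-distrib-⊕ []            F G = refl
expect-distrib-⊕ ((p , x) ∷ D) F G = trans (cong (p ⊗ (F x ⊕ G x) ⊕_) (expect-distrib-⊕ D F G)) (eq p (F x) (G x) (expect D F) (expect D G))
  where
  eq : ∀ p a b c d → p ⊗ (a ⊕ b) ⊕ (c ⊕ d) ≡ p ⊗ a ⊕ c ⊕ (p ⊗ b ⊕ d)
  eq = solve-∀ ℚ-ring

expect-distribˡ-⊗ : ∀ (D : Dist A) a F → expect D (λ x → a ⊗ F x) ≡ a ⊗ expect D F
expect-distribˡ-⊗ []            a F = sym (ℚₚ.*-zeroʳ a)
expect-distribˡ-⊗ ((p , x) ∷ D) a F = trans (cong (p ⊗ (a ⊗ F x) ⊕_) (expect-distribˡ-⊗ D a F)) (eq p a (F x) (expect D F))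
  where
  eq : ∀ p a b c → p ⊗ (a ⊗ b) ⊕ a ⊗ c ≡ a ⊗ (p ⊗ b ⊕ c)
  eq = solve-∀ ℚ-ring

expect-sumOver : ∀ (D : Dist A) (xs : List B) (F : B → A → ℚ) →
  expect D (λ x → sumOver xs (λ v → F v x)) ≡ sumOver xs (λ v → expect D (F v))
expect-sumOver D []       F = trans (expect-cong D (λ _ → sym (ℚₚ.*-zeroˡ 0ℚ))) (trans (expect-distribˡ-⊗ D 0ℚ (λ _ → 0ℚ)) (ℚₚ.*-zeroˡ (expect D (λ _ → 0ℚ))))
expect-sumOver D (v ∷ xs) F = trans (expect-distrib-⊕ D (F v) (λ x → sumOver xs (λ v → F v x))) (cong (expect D (F v) ⊕_) (expect-sumOver D xs F))

-- `P` is a property of every listed outcome, so monotonicity of expectations has to be checked only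
-- where `P` holds: at neighbours for the walk, at sets within reach for the broadcast.
record IsProbability (P : A → Set) (D : Dist A) : Set where
  constructor isProbability
  field
    support : All (λ { (p , x) → 0ℚ ≼ p × P x }) D
    mass    : expect D (λ _ → 1ℚ) ≡ 1ℚ

open IsProbability

expect-mono-support : ∀ {P : A → Set} {D : Dist A} → All (λ { (p , x) → 0ℚ ≼ p × P x }) D →
  ∀ {F G} → (∀ x → P x → F x ≼ G x) → expect D F ≼ expect D G
expect-mono-support []                h = ≼-refl
expect-mono-support ((0≤p , Px) ∷ ps) h = ⊕-mono (⊗-monoʳ 0≤p (h _ Px)) (expect-mono-support ps h)

expect-const : ∀ {P : A → Set} {D : Dist A} → IsProbability P D → ∀ a → expect D (λ _ → a) ≡ a
expect-const {D = D} pr a = begin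
  expect D (λ _ → a) ≡⟨ expect-cong D (λ _ → sym (ℚₚ.*-identityʳ a)) ⟩
  expect D (λ _ → a ⊗ 1ℚ) ≡⟨ expect-distribˡ-⊗ D a (λ _ → 1ℚ) ⟩
  a ⊗ expect D (λ _ → 1ℚ) ≡⟨ cong (a ⊗_) (mass pr) ⟩
  a ⊗ 1ℚ ≡⟨ ℚₚ.*-identityʳ a ⟩
  a ∎
  where open ≡-Reasoning

expect-mono : ∀ {P : A → Set} {D : Dist A} → IsProbability P D → ∀ {F G} → (∀ x → P x → F x ≼ G x) → expect D F ≼ expect D G
expect-mono pr = expect-mono-support (support pr)

expect-≽ : ∀ {P : A → Set} {D : Dist A} → IsProbability P D → ∀ a {F} → (∀ x → P x → a ≼ F x) → a ≼ expect D F
expect-≽ pr a h = ≼-trans (≼-reflexive (sym (expect-const pr a))) (expect-mono pr h)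

expect-≼ : ∀ {P : A → Set} {D : Dist A} → IsProbability P D → ∀ a {F} → (∀ x → P x → F x ≼ a) → expect D F ≼ a
expect-≼ pr a h = ≼-trans (expect-mono pr h) (≼-reflexive (expect-const pr a))

return-isProbability : ∀ {P : A → Set} {x} → P x → IsProbability P (return x)
return-isProbability Px = isProbability ((fromℕ-nonNeg 1 , Px) ∷ []) refl

>>=-isProbability : ∀ {P : A → Set} {Q : B → Set} {D : Dist A} {g : A → Dist B} →
  IsProbability P D → (∀ x → P x → IsProbability Q (g x)) → IsProbability Q (D >>= g)
>>=-isProbability {P = P} {Q} {D} {g} pr h = isProbability (supp D (support pr))
  (trans (expect->>= D g (λ _ → 1ℚ)) (ℚₚ.≤-antisym
    (expect-≼ pr 1ℚ (λ x Px → ≼-reflexive (mass (h x Px)))) (expect-≽ pr 1ℚ (λ x Px → ≼-reflexive (sym (mass (h x Px)))))))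
  where
  supp₁ : ∀ {p} → 0ℚ ≼ p → ∀ E → All (λ { (q , y) → 0ℚ ≼ q × Q y }) E → All (λ { (q , y) → 0ℚ ≼ q × Q y }) (map (λ { (q , y) → p ⊗ q , y }) E)
  supp₁ 0≤p []       []                = []
  supp₁ 0≤p (_ ∷ E) ((0≤q , Qy) ∷ qs) = (⊗-nonNeg 0≤p 0≤q , Qy) ∷ supp₁ 0≤p E qs
  supp : ∀ D → All (λ { (p , x) → 0ℚ ≼ p × P x }) D → All (λ { (q , y) → 0ℚ ≼ q × Q y }) (D >>= g)
  supp []            []                = []
  supp ((p , x) ∷ D) ((0≤p , Px) ∷ ps) = Allₚ.++⁺ (supp₁ 0≤p (g x) (support (h x Px))) (supp D ps)

unit-fraction : ∀ k → fromℕ (suc k) ⊗ (ℤ.+ 1 / suc k) ≡ 1ℚ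
unit-fraction k = toℚᵘ-injective (begin
  toℚᵘ (fromℕ (suc k) ⊗ (ℤ.+ 1 / suc k)) ≈⟨ toℚᵘ-homo-* (fromℕ (suc k)) (ℤ.+ 1 / suc k) ⟩
  toℚᵘ (fromℕ (suc k)) ℚᵘ.* toℚᵘ (ℤ.+ 1 / suc k) ≈⟨ ℚᵘₚ.*-cong (toℚᵘ-fromℚᵘ (ℚᵘ.mkℚᵘ (ℤ.+ suc k) 0)) (toℚᵘ-fromℚᵘ (ℚᵘ.mkℚᵘ (ℤ.+ 1) k)) ⟩
  ℚᵘ.mkℚᵘ (ℤ.+ suc k) 0 ℚᵘ.* ℚᵘ.mkℚᵘ (ℤ.+ 1) k ≈⟨ ℚᵘ.*≡* (trans (ℤₚ.*-identityʳ _) (trans (ℤₚ.*-identityʳ (ℤ.+ suc k)) (sym (trans (ℤₚ.*-identityˡ _) (cong (λ t → ℤ.+ suc t) (+-identityʳ k)))))) ⟩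
  ℚᵘ.mkℚᵘ (ℤ.+ 1) 0 ∎)
  where open ℚᵘₚ.≃-Reasoning

unit-fraction-nonNeg : ∀ k → 0ℚ ≼ ℤ.+ 1 / suc k
unit-fraction-nonNeg k = ⊗-cancelˡ (fromℕ-0< {suc k} (s≤s z≤n)) (≼-trans (≼-reflexive (ℚₚ.*-zeroʳ (fromℕ (suc k)))) (≼-trans (fromℕ-nonNeg 1) (≼-reflexive (sym (unit-fraction k)))))

expect-weighted : ∀ w (xs : List A) F → expect (map (λ x → w , x) xs) F ≡ w ⊗ sumOver xs F
expect-weighted w []       F = sym (ℚₚ.*-zeroʳ w)
expect-weighted w (x ∷ xs) F = trans (cong (w ⊗ F x ⊕_) (expect-weighted w xs F)) (sym (ℚₚ.*-distribˡ-+ w (F x) (sumOver xs F)))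

-- The multiplied form avoids division and covers the empty list.
expect-uniform : ∀ (xs : List A) F → fromℕ (length xs) ⊗ expect (uniform xs) F ≡ sumOver xs F
expect-uniform []            F = refl
expect-uniform xs@(_ ∷ xs′) F = begin
  fromℕ (suc k) ⊗ expect (uniform xs) F ≡⟨ cong (fromℕ (suc k) ⊗_) (expect-weighted (ℤ.+ 1 / suc k) xs F) ⟩
  fromℕ (suc k) ⊗ ((ℤ.+ 1 / suc k) ⊗ sumOver xs F) ≡⟨ ℚₚ.*-assoc (fromℕ (suc k)) (ℤ.+ 1 / suc k) _ ⟨
  fromℕ (suc k) ⊗ (ℤ.+ 1 / suc k) ⊗ sumOver xs F ≡⟨ cong (_⊗ sumOver xs F) (unit-fraction k) ⟩
  1ℚ ⊗ sumOver xs F ≡⟨ ℚₚ.*-identityˡ _ ⟩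
  sumOver xs F ∎
  where
  open ≡-Reasoning
  k = length xs′

uniform-isProbability : ∀ {P : A → Set} (xs : List A) → 1 ≤ length xs → All P xs → IsProbability P (uniform xs)
uniform-isProbability {P = P} xs@(_ ∷ xs′) _ Pxs = isProbability (supp xs Pxs)
  (trans (expect-weighted (ℤ.+ 1 / suc k) xs (λ _ → 1ℚ)) (trans (cong ((ℤ.+ 1 / suc k) ⊗_) (trans (sumOver-const xs 1ℚ) (ℚₚ.*-identityʳ (fromℕ (suc k))))) (trans (ℚₚ.*-comm (ℤ.+ 1 / suc k) (fromℕ (suc k))) (unit-fraction k))))
  where
  k = length xs′
  supp : ∀ ys → All P ys → All (λ { (p , x) → 0ℚ ≼ p × P x }) (map (λ x → (ℤ.+ 1 / suc k) , x) ys)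
  supp []       []         = []
  supp (_ ∷ ys) (Py ∷ Pys) = (unit-fraction-nonNeg k , Py) ∷ supp ys Pys

-- Hitting times

argmax : ∀ {n} (h : Fin n → ℚ) → Fin n → ∃[ u ] ∀ x → h x ≼ h u
argmax {suc zero}    h _ = zero , λ { zero → ≼-refl }
argmax {suc (suc n)} h _ with argmax (λ x → h (suc x)) zero
... | u , max with ≼-total (h zero) (h (suc u))
...   | inj₁ h0≤ = suc u , λ { zero → h0≤ ; (suc x) → max x }
...   | inj₂ ≤h0 = zero  , λ { zero → ≼-refl ; (suc x) → ≼-trans (max x) ≤h0 }

module Walk {n : ℕ} (G : Graph n) (degree-pos : ∀ v → 1 ≤ Graph.degree G v) where
  open Graph G

  V : List (Fin n)
  V = allFin n

  average : Fin n → (Fin n → ℚ) → ℚ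
  average x F = expect (walkStep G x) F

  step-isProbability : ∀ x → IsProbability (Adj x) (walkStep G x)
  step-isProbability x = uniform-isProbability (neighbours x) (degree-pos x) (Allₚ.all-filter (adj? x) V)

  average-mono : ∀ x {F G} → (∀ y → F y ≼ G y) → average x F ≼ average x G
  average-mono x h = expect-mono (step-isProbability x) (λ y _ → h y)

  average-const : ∀ x a → average x (λ _ → a) ≡ a
  average-const x = expect-const (step-isProbability x)

  dirichlet : (Fin n → ℚ) → ℚ
  dirichlet h = sumOver V (λ x → sumOver (neighbours x) (λ y → sq (h x ⊖ h y)))

  edgeSum-transpose : ∀ (F : Fin n → Fin n → ℚ) →
    sumOver V (λ x → sumOver (neighbours x) (F x)) ≡ sumOver V (λ x → sumOver (neighbours x) (λ y → F y x))
  edgeSum-transpose F = begin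
    sumOver V (λ x → sumOver (neighbours x) (F x))
      ≡⟨ sumOver-cong V (λ x → sumOver-filter (adj? x) V (F x)) ⟩
    sumOver V (λ x → sumOver V (λ y → if does (adj? x y) then F x y else 0ℚ))
      ≡⟨ sumOver-swap V V (λ x y → if does (adj? x y) then F x y else 0ℚ) ⟩
    sumOver V (λ y → sumOver V (λ x → if does (adj? x y) then F x y else 0ℚ))
      ≡⟨ sumOver-cong V (λ y → sumOver-cong V (λ x → cong (if_then F x y else 0ℚ) (does-sym x y))) ⟩
    sumOver V (λ y → sumOver V (λ x → if does (adj? y x) then F x y else 0ℚ))
      ≡⟨ sumOver-cong V (λ y → sumOver-filter (adj? y) V (λ x → F x y)) ⟨
    sumOver V (λ y → sumOver (neighbours y) (λ x → F x y)) ∎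
    where
    open ≡-Reasoning
    does-sym : ∀ x y → does (adj? x y) ≡ does (adj? y x)
    does-sym x y with adj? y x
    ... | yes a = dec-true (adj? x y) (symmetric a)
    ... | no ¬a = dec-false (adj? x y) (λ a → ¬a (symmetric a))

  -- The discrete Green formula: (a - b)² = a(a - b) + b(b - a), and by symmetry of adjacency both
  -- summands have the same total over ordered edges.
  dirichlet-green : ∀ h → dirichlet h ≡ (1ℚ ⊕ 1ℚ) ⊗ sumOver V (λ x → h x ⊗ (fromℕ (degree x) ⊗ (h x ⊖ average x h)))
  dirichlet-green h = begin
    dirichlet h
      ≡⟨ sumOver-cong V (λ x → trans (sumOver-cong (neighbours x) (λ y → square (h x) (h y))) (sumOver-distrib-⊕ (neighbours x) (F x) (λ y → F y x))) ⟩
    sumOver V (λ x → sumOver (neighbours x) (F x) ⊕ sumOver (neighbours x) (λ y → F y x))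
      ≡⟨ sumOver-distrib-⊕ V (λ x → sumOver (neighbours x) (F x)) (λ x → sumOver (neighbours x) (λ y → F y x)) ⟩
    sumOver V (λ x → sumOver (neighbours x) (F x)) ⊕ sumOver V (λ x → sumOver (neighbours x) (λ y → F y x))
      ≡⟨ cong (sumOver V (λ x → sumOver (neighbours x) (F x)) ⊕_) (sym (edgeSum-transpose F)) ⟩
    sumOver V (λ x → sumOver (neighbours x) (F x)) ⊕ sumOver V (λ x → sumOver (neighbours x) (F x))
      ≡⟨ twice (sumOver V (λ x → sumOver (neighbours x) (F x))) ⟩
    (1ℚ ⊕ 1ℚ) ⊗ sumOver V (λ x → sumOver (neighbours x) (F x))
      ≡⟨ cong ((1ℚ ⊕ 1ℚ) ⊗_) (sumOver-cong V local) ⟩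
    (1ℚ ⊕ 1ℚ) ⊗ sumOver V (λ x → h x ⊗ (fromℕ (degree x) ⊗ (h x ⊖ average x h))) ∎
    where
    open ≡-Reasoning
    F : Fin n → Fin n → ℚ
    F x y = h x ⊗ (h x ⊖ h y)
    square : ∀ a b → (a ⊖ b) ⊗ (a ⊖ b) ≡ a ⊗ (a ⊖ b) ⊕ b ⊗ (b ⊖ a)
    square = solve-∀ ℚ-ring
    twice : ∀ a → a ⊕ a ≡ (1ℚ ⊕ 1ℚ) ⊗ a
    twice = solve-∀ ℚ-ring
    neg-one : ∀ a → ⊖ a ≡ (⊖ 1ℚ) ⊗ a
    neg-one = solve-∀ ℚ-ring
    combine : ∀ d a b → d ⊗ a ⊕ (⊖ 1ℚ) ⊗ (d ⊗ b) ≡ d ⊗ (a ⊖ b)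
    combine = solve-∀ ℚ-ring
    local : ∀ x → sumOver (neighbours x) (F x) ≡ h x ⊗ (fromℕ (degree x) ⊗ (h x ⊖ average x h))
    local x = begin
      sumOver (neighbours x) (F x) ≡⟨ sumOver-distribˡ-⊗ (neighbours x) (h x) (λ y → h x ⊖ h y) ⟩
      h x ⊗ sumOver (neighbours x) (λ y → h x ⊖ h y) ≡⟨ cong (h x ⊗_) (sumOver-cong (neighbours x) (λ y → cong (h x ⊕_) (neg-one (h y)))) ⟩
      h x ⊗ sumOver (neighbours x) (λ y → h x ⊕ (⊖ 1ℚ) ⊗ h y) ≡⟨ cong (h x ⊗_) (trans (sumOver-distrib-⊕ (neighbours x) (λ _ → h x) (λ y → (⊖ 1ℚ) ⊗ h y)) (cong₂ _⊕_ (sumOver-const (neighbours x) (h x)) (trans (sumOver-distribˡ-⊗ (neighbours x) (⊖ 1ℚ) h) (cong ((⊖ 1ℚ) ⊗_) (sym (expect-uniform (neighbours x) h)))))) ⟩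
      h x ⊗ (fromℕ (degree x) ⊗ h x ⊕ (⊖ 1ℚ) ⊗ (fromℕ (degree x) ⊗ average x h)) ≡⟨ cong (h x ⊗_) (combine (fromℕ (degree x)) (h x) (average x h)) ⟩
      h x ⊗ (fromℕ (degree x) ⊗ (h x ⊖ average x h)) ∎

  -- E_x[min(τ_v, t)] for the hitting time τ_v of v.
  hit : Fin n → ℕ → Fin n → ℚ
  hit v zero    x = 0ℚ
  hit v (suc t) x = if does (x Finₚ.≟ v) then 0ℚ else 1ℚ ⊕ average x (hit v t)

  hit-target : ∀ v t → hit v t v ≡ 0ℚ
  hit-target v zero    = refl
  hit-target v (suc t) = cong (if_then 0ℚ else (1ℚ ⊕ average v (hit v t))) (dec-true (v Finₚ.≟ v) refl)

  hit-step : ∀ v t {x} → x ≢ v → hit v (suc t) x ≡ 1ℚ ⊕ average x (hit v t)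
  hit-step v t {x} x≢v = cong (if_then 0ℚ else (1ℚ ⊕ average x (hit v t))) (dec-false (x Finₚ.≟ v) x≢v)

  hit-nonNeg : ∀ v t x → 0ℚ ≼ hit v t x
  hit-nonNeg v zero    x = ≼-refl
  hit-nonNeg v (suc t) x with x Finₚ.≟ v
  ... | yes _ = ≼-refl
  ... | no  _ = ⊕-nonNeg (fromℕ-nonNeg 1) (expect-≽ (step-isProbability x) 0ℚ (λ y _ → hit-nonNeg v t y))

  hit-mono : ∀ v t x → hit v t x ≼ hit v (suc t) x
  hit-mono v zero    x = hit-nonNeg v 1 x
  hit-mono v (suc t) x with x Finₚ.≟ v
  ... | yes _ = ≼-refl
  ... | no  _ = ⊕-monoʳ 1ℚ (average-mono x (hit-mono v t))

  -- The increment from `t` to `t + 1` is the probability that `v` has not been hit by time `t`,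
  -- which decreases in `t`. The recursion is an average, so it passes this on by induction.
  hit-concave : ∀ v t x → hit v (suc (suc t)) x ⊕ hit v t x ≼ hit v (suc t) x ⊕ hit v (suc t) x
  hit-concave v t x with x Finₚ.≟ v
  hit-concave v zero    x | yes _ = ≼-refl
  hit-concave v (suc t) x | yes refl = ≼-reflexive (cong₂ _⊕_ refl (hit-target x (suc t)))
  hit-concave v zero x | no _ = begin
    1ℚ ⊕ average x (hit v 1) ⊕ 0ℚ ≡⟨ ℚₚ.+-identityʳ _ ⟩
    1ℚ ⊕ average x (hit v 1) ≤⟨ ⊕-monoʳ 1ℚ (expect-≼ (step-isProbability x) 1ℚ (λ y _ → hit₁≼1 y)) ⟩
    1ℚ ⊕ 1ℚ ≡⟨ cong₂ (λ s t → (1ℚ ⊕ s) ⊕ (1ℚ ⊕ t)) (sym (average-const x 0ℚ)) (sym (average-const x 0ℚ)) ⟩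
    (1ℚ ⊕ average x (λ _ → 0ℚ)) ⊕ (1ℚ ⊕ average x (λ _ → 0ℚ)) ∎
    where
    open ℚₚ.≤-Reasoning
    hit₁≼1 : ∀ y → hit v 1 y ≼ 1ℚ
    hit₁≼1 y with y Finₚ.≟ v
    ... | yes _ = fromℕ-nonNeg 1
    ... | no  _ = ≼-reflexive (cong (1ℚ ⊕_) (average-const y 0ℚ))
  hit-concave v (suc t) x | no x≢v = begin
    1ℚ ⊕ average x (hit v (suc (suc t))) ⊕ hit v (suc t) x ≡⟨ cong (1ℚ ⊕ average x (hit v (suc (suc t))) ⊕_) (hit-step v t x≢v) ⟩
    1ℚ ⊕ average x (hit v (suc (suc t))) ⊕ (1ℚ ⊕ average x (hit v t)) ≡⟨ join (hit v (suc (suc t))) (hit v t) ⟩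
    (1ℚ ⊕ 1ℚ) ⊕ average x (λ y → hit v (suc (suc t)) y ⊕ hit v t y) ≤⟨ ⊕-monoʳ (1ℚ ⊕ 1ℚ) (average-mono x (hit-concave v t)) ⟩
    (1ℚ ⊕ 1ℚ) ⊕ average x (λ y → hit v (suc t) y ⊕ hit v (suc t) y) ≡⟨ join (hit v (suc t)) (hit v (suc t)) ⟨
    1ℚ ⊕ average x (hit v (suc t)) ⊕ (1ℚ ⊕ average x (hit v (suc t))) ∎
    where
    open ℚₚ.≤-Reasoning
    shuffle : ∀ a b → 1ℚ ⊕ a ⊕ (1ℚ ⊕ b) ≡ (1ℚ ⊕ 1ℚ) ⊕ (a ⊕ b)
    shuffle = solve-∀ ℚ-ring
    join : ∀ F F′ → 1ℚ ⊕ average x F ⊕ (1ℚ ⊕ average x F′) ≡ (1ℚ ⊕ 1ℚ) ⊕ average x (λ y → F y ⊕ F′ y)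
    join F F′ = trans (shuffle (average x F) (average x F′)) (cong ((1ℚ ⊕ 1ℚ) ⊕_) (sym (expect-distrib-⊕ (walkStep G x) F F′)))


  -- By concavity the current increment is at most each of the `t` earlier ones, and these add up to
  -- `hit v t x`.
  hit-increment : ∀ v t x → fromℕ t ⊗ (hit v (suc t) x ⊖ hit v t x) ≼ hit v t x
  hit-increment v zero    x = ≼-reflexive (ℚₚ.*-zeroˡ (hit v 1 x ⊖ 0ℚ))
  hit-increment v (suc t) x = begin
    fromℕ (suc t) ⊗ (hit v (suc (suc t)) x ⊖ hit v (suc t) x) ≤⟨ ⊗-monoʳ (fromℕ-nonNeg (suc t)) (⊕-cancelʳ (hit v (suc t) x ⊕ hit v t x) (subst₂ _≼_ (sym (left (hit v (suc (suc t)) x) (hit v (suc t) x) (hit v t x))) (sym (right (hit v (suc t) x) (hit v t x))) (hit-concave v t x))) ⟩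
    fromℕ (suc t) ⊗ (hit v (suc t) x ⊖ hit v t x) ≡⟨ cong (_⊗ (hit v (suc t) x ⊖ hit v t x)) (fromℕ-suc t) ⟩
    (fromℕ t ⊕ 1ℚ) ⊗ (hit v (suc t) x ⊖ hit v t x) ≡⟨ expand (fromℕ t) (hit v (suc t) x) (hit v t x) ⟩
    fromℕ t ⊗ (hit v (suc t) x ⊖ hit v t x) ⊕ (hit v (suc t) x ⊖ hit v t x) ≤⟨ ⊕-monoˡ _ (hit-increment v t x) ⟩
    hit v t x ⊕ (hit v (suc t) x ⊖ hit v t x) ≡⟨ cancel (hit v (suc t) x) (hit v t x) ⟩
    hit v (suc t) x ∎
    where
    open ℚₚ.≤-Reasoning
    left : ∀ a b c → a ⊖ b ⊕ (b ⊕ c) ≡ a ⊕ c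
    left = solve-∀ ℚ-ring
    right : ∀ b c → b ⊖ c ⊕ (b ⊕ c) ≡ b ⊕ b
    right = solve-∀ ℚ-ring
    expand : ∀ t b c → (t ⊕ 1ℚ) ⊗ (b ⊖ c) ≡ t ⊗ (b ⊖ c) ⊕ (b ⊖ c)
    expand = solve-∀ ℚ-ring
    cancel : ∀ b c → c ⊕ (b ⊖ c) ≡ b
    cancel = solve-∀ ℚ-ring

  module HittingBound (Δ c R A : ℕ) (1≤c : 1 ≤ c) (degree≤Δ : ∀ x → degree x ≤ Δ) (Δ≤ : Δ ≤ A * c)
    (oscillation : ∀ h u v → fromℕ c ⊗ sq (h u ⊖ h v) ≼ fromℕ R ⊗ dirichlet h) where

    -- The quantity 2 R n Δ / c with Δ replaced by its bound `A c`, so that `c` cancels.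
    H₀ : ℕ
    H₀ = 2 * (R * (n * A))

    -- In Green's formula the target contributes 0. Elsewhere the defect of the truncated time `h`
    -- has the right sign: raising the truncation time by one does not decrease it, so h ≤ 1 + Ph.
    energy-bound : ∀ v t μ → (∀ x → hit v t x ≼ μ) → dirichlet (hit v t) ≼ (1ℚ ⊕ 1ℚ) ⊗ (fromℕ n ⊗ (fromℕ Δ ⊗ μ))
    energy-bound v t μ h≤μ = begin
      dirichlet h ≡⟨ dirichlet-green h ⟩
      (1ℚ ⊕ 1ℚ) ⊗ sumOver V (λ x → h x ⊗ (fromℕ (degree x) ⊗ (h x ⊖ average x h))) ≤⟨ ⊗-monoʳ (fromℕ-nonNeg 2) (sumOver-mono V local) ⟩
      (1ℚ ⊕ 1ℚ) ⊗ sumOver V (λ _ → fromℕ Δ ⊗ μ) ≡⟨ cong ((1ℚ ⊕ 1ℚ) ⊗_) (trans (sumOver-const V (fromℕ Δ ⊗ μ)) (cong (λ k → fromℕ k ⊗ (fromℕ Δ ⊗ μ)) (Listₚ.length-tabulate {n = n} (λ z → z)))) ⟩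
      (1ℚ ⊕ 1ℚ) ⊗ (fromℕ n ⊗ (fromℕ Δ ⊗ μ)) ∎
      where
      open ℚₚ.≤-Reasoning
      h = hit v t
      0≤μ : 0ℚ ≼ μ
      0≤μ = ≼-trans (hit-nonNeg v t v) (h≤μ v)
      drift : ∀ {x} → x ≢ v → h x ⊖ average x h ≼ 1ℚ
      drift {x} x≢v = ≼-trans (⊕-monoˡ (⊖ average x h) (≼-trans (hit-mono v t x) (≼-reflexive (hit-step v t x≢v)))) (≼-reflexive (cancel (average x h)))
        where
        cancel : ∀ a → 1ℚ ⊕ a ⊖ a ≡ 1ℚ
        cancel = solve-∀ ℚ-ring
      local : ∀ x → h x ⊗ (fromℕ (degree x) ⊗ (h x ⊖ average x h)) ≼ fromℕ Δ ⊗ μ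
      local x with x Finₚ.≟ v
      ... | yes refl = ≼-trans (≼-reflexive (trans (cong (_⊗ (fromℕ (degree x) ⊗ (h x ⊖ average x h))) (hit-target x t)) (ℚₚ.*-zeroˡ (fromℕ (degree x) ⊗ (h x ⊖ average x h))))) (⊗-nonNeg (fromℕ-nonNeg Δ) 0≤μ)
      ... | no x≢v = begin
        h x ⊗ (fromℕ (degree x) ⊗ (h x ⊖ average x h)) ≤⟨ ⊗-monoʳ (hit-nonNeg v t x) (⊗-monoʳ (fromℕ-nonNeg (degree x)) (drift x≢v)) ⟩
        h x ⊗ (fromℕ (degree x) ⊗ 1ℚ) ≤⟨ ⊗-mono (hit-nonNeg v t x) (fromℕ-nonNeg Δ) (h≤μ x) (≼-trans (≼-reflexive (ℚₚ.*-identityʳ (fromℕ (degree x)))) (fromℕ-mono (degree≤Δ x))) ⟩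
        μ ⊗ fromℕ Δ ≡⟨ ℚₚ.*-comm μ (fromℕ Δ) ⟩
        fromℕ Δ ⊗ μ ∎

    -- At the maximum point the oscillation inequality reads c μ² ≤ R · 2 n Δ μ.
    hit-bounded : ∀ v t x → hit v t x ≼ fromℕ H₀
    hit-bounded v t x with argmax (hit v t) v
    ... | u , max with ℚₚ._<?_ 0ℚ (hit v t u)
    ...   | no  0≮μ = ≼-trans (max x) (≼-trans (ℚₚ.≮⇒≥ 0≮μ) (fromℕ-nonNeg H₀))
    ...   | yes 0<μ = ≼-trans (max x) (⊗-cancelˡ 0<cμ (begin
      C ⊗ μ ⊗ μ ≡⟨ ℚₚ.*-assoc C μ μ ⟩
      C ⊗ sq μ ≡⟨ cong (λ s → C ⊗ sq s) (trans (subtract-zero μ) (cong (λ s → μ ⊖ s) (sym (hit-target v t)))) ⟩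
      C ⊗ sq (μ ⊖ hit v t v) ≤⟨ oscillation (hit v t) u v ⟩
      fromℕ R ⊗ dirichlet (hit v t) ≤⟨ ⊗-monoʳ (fromℕ-nonNeg R) (energy-bound v t μ max) ⟩
      fromℕ R ⊗ ((1ℚ ⊕ 1ℚ) ⊗ (fromℕ n ⊗ (fromℕ Δ ⊗ μ)))
                                                 ≤⟨ ⊗-monoʳ (fromℕ-nonNeg R) (⊗-monoʳ (fromℕ-nonNeg 2) (⊗-monoʳ (fromℕ-nonNeg n) (⊗-monoˡ (ℚₚ.<⇒≤ 0<μ) (≼-trans (fromℕ-mono Δ≤) (≼-reflexive (fromℕ-homo-* A c)))))) ⟩
      fromℕ R ⊗ ((1ℚ ⊕ 1ℚ) ⊗ (fromℕ n ⊗ (fromℕ A ⊗ C ⊗ μ)))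
                                                 ≡⟨ shuffle (fromℕ R) (fromℕ n) (fromℕ A) C μ ⟩
      C ⊗ μ ⊗ ((1ℚ ⊕ 1ℚ) ⊗ (fromℕ R ⊗ (fromℕ n ⊗ fromℕ A)))
                                                 ≡⟨ cong (C ⊗ μ ⊗_) (sym H₀≡) ⟩
      C ⊗ μ ⊗ fromℕ H₀                           ∎))
      where
      open ℚₚ.≤-Reasoning
      C = fromℕ c
      μ = hit v t u
      0<cμ : 0ℚ ≺ C ⊗ μ
      0<cμ = ℚₚ.<-respˡ-≡ (ℚₚ.*-zeroʳ C) (ℚₚ.*-monoʳ-<-pos C {{positive (fromℕ-0< 1≤c)}} 0<μ)
      subtract-zero : ∀ a → a ≡ a ⊖ 0ℚ
      subtract-zero = solve-∀ ℚ-ring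
      shuffle : ∀ R n A C μ → R ⊗ ((1ℚ ⊕ 1ℚ) ⊗ (n ⊗ (A ⊗ C ⊗ μ))) ≡ C ⊗ μ ⊗ ((1ℚ ⊕ 1ℚ) ⊗ (R ⊗ (n ⊗ A)))
      shuffle = solve-∀ ℚ-ring
      H₀≡ : fromℕ H₀ ≡ (1ℚ ⊕ 1ℚ) ⊗ (fromℕ R ⊗ (fromℕ n ⊗ fromℕ A))
      H₀≡ = trans (fromℕ-homo-* 2 (R * (n * A))) (cong (fromℕ 2 ⊗_) (trans (fromℕ-homo-* R (n * A)) (cong (fromℕ R ⊗_) (fromℕ-homo-* n A))))

    -- At truncation time 2H₀ the increment is at most H₀ / (2H₀) = 1/2, since the hitting times
    -- never exceed H₀. The truncated time thus drops by at least 1/2 per step off the target, and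
    -- doubling it gives the drift 1.
    potential : Fin n → Fin n → ℚ
    potential v x = (1ℚ ⊕ 1ℚ) ⊗ hit v (2 * H₀) x

    potential-nonNeg : ∀ v x → 0ℚ ≼ potential v x
    potential-nonNeg v x = ⊗-nonNeg (fromℕ-nonNeg 2) (hit-nonNeg v (2 * H₀) x)

    potential-bounded : ∀ v x → potential v x ≼ fromℕ (2 * H₀)
    potential-bounded v x = ≼-trans (⊗-monoʳ (fromℕ-nonNeg 2) (hit-bounded v (2 * H₀) x)) (≼-reflexive (sym (fromℕ-homo-* 2 H₀)))

    potential-drift : 1 ≤ H₀ → ∀ v {x} → x ≢ v → 1ℚ ⊕ average x (potential v) ≼ potential v x
    potential-drift 1≤H₀ v {x} x≢v = begin
      1ℚ ⊕ average x (potential v) ≡⟨ cong (1ℚ ⊕_) (expect-distribˡ-⊗ (walkStep G x) (1ℚ ⊕ 1ℚ) (hit v M)) ⟩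
      1ℚ ⊕ (1ℚ ⊕ 1ℚ) ⊗ average x (hit v M) ≡⟨ regroup (average x (hit v M)) ⟩
      (1ℚ ⊕ 1ℚ) ⊗ (1ℚ ⊕ average x (hit v M)) ⊖ 1ℚ ≡⟨ cong (λ s → (1ℚ ⊕ 1ℚ) ⊗ s ⊖ 1ℚ) (sym (hit-step v M x≢v)) ⟩
      (1ℚ ⊕ 1ℚ) ⊗ hit v (suc M) x ⊖ 1ℚ ≤⟨ ⊕-monoʳ ((1ℚ ⊕ 1ℚ) ⊗ hit v (suc M) x) (ℚₚ.neg-antimono-≤ small) ⟩
      (1ℚ ⊕ 1ℚ) ⊗ hit v (suc M) x ⊖ (1ℚ ⊕ 1ℚ) ⊗ (hit v (suc M) x ⊖ hit v M x) ≡⟨ cancel (hit v (suc M) x) (hit v M x) ⟩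
      potential v x ∎
      where
      open ℚₚ.≤-Reasoning
      M = 2 * H₀
      regroup : ∀ a → 1ℚ ⊕ (1ℚ ⊕ 1ℚ) ⊗ a ≡ (1ℚ ⊕ 1ℚ) ⊗ (1ℚ ⊕ a) ⊖ 1ℚ
      regroup = solve-∀ ℚ-ring
      cancel : ∀ a b → (1ℚ ⊕ 1ℚ) ⊗ a ⊖ (1ℚ ⊕ 1ℚ) ⊗ (a ⊖ b) ≡ (1ℚ ⊕ 1ℚ) ⊗ b
      cancel = solve-∀ ℚ-ring
      swap : ∀ t h p → h ⊗ (t ⊗ p) ≡ t ⊗ h ⊗ p
      swap = solve-∀ ℚ-ring
      small : (1ℚ ⊕ 1ℚ) ⊗ (hit v (suc M) x ⊖ hit v M x) ≼ 1ℚ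
      small = ⊗-cancelˡ (fromℕ-0< 1≤H₀) (begin
        fromℕ H₀ ⊗ ((1ℚ ⊕ 1ℚ) ⊗ (hit v (suc M) x ⊖ hit v M x)) ≡⟨ swap (1ℚ ⊕ 1ℚ) (fromℕ H₀) (hit v (suc M) x ⊖ hit v M x) ⟩
        (1ℚ ⊕ 1ℚ) ⊗ fromℕ H₀ ⊗ (hit v (suc M) x ⊖ hit v M x) ≡⟨ cong (_⊗ (hit v (suc M) x ⊖ hit v M x)) (sym (fromℕ-homo-* 2 H₀)) ⟩
        fromℕ M ⊗ (hit v (suc M) x ⊖ hit v M x) ≤⟨ hit-increment v M x ⟩
        hit v M x ≤⟨ hit-bounded v M x ⟩
        fromℕ H₀ ≡⟨ ℚₚ.*-identityʳ (fromℕ H₀) ⟨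
        fromℕ H₀ ⊗ 1ℚ                        ∎)

-- Cover times

pow : ℚ → ℕ → ℚ
pow a zero    = 1ℚ
pow a (suc k) = a ⊗ pow a k

pow-nonNeg : ∀ {a} → 0ℚ ≼ a → ∀ k → 0ℚ ≼ pow a k
pow-nonNeg 0≤a zero    = fromℕ-nonNeg 1
pow-nonNeg 0≤a (suc k) = ⊗-nonNeg 0≤a (pow-nonNeg 0≤a k)

pow-≼1 : ∀ {a} → 0ℚ ≼ a → a ≼ 1ℚ → ∀ k → pow a k ≼ 1ℚ
pow-≼1 0≤a a≤1 zero    = ≼-refl
pow-≼1 {a} 0≤a a≤1 (suc k) = ⊗-mono {a} {1ℚ} {pow a k} {1ℚ} 0≤a (fromℕ-nonNeg 1) a≤1 (pow-≼1 0≤a a≤1 k)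

pow-+ : ∀ a j k → pow a (j + k) ≡ pow a j ⊗ pow a k
pow-+ a zero    k = sym (ℚₚ.*-identityˡ (pow a k))
pow-+ a (suc j) k = trans (cong (a ⊗_) (pow-+ a j k)) (sym (ℚₚ.*-assoc a (pow a j) (pow a k)))

pow-distrib-⊗ : ∀ a b k → pow (a ⊗ b) k ≡ pow a k ⊗ pow b k
pow-distrib-⊗ a b zero    = refl
pow-distrib-⊗ a b (suc k) = trans (cong (a ⊗ b ⊗_) (pow-distrib-⊗ a b k)) (eq a b (pow a k) (pow b k))
  where
  eq : ∀ a b c d → a ⊗ b ⊗ (c ⊗ d) ≡ a ⊗ c ⊗ (b ⊗ d)
  eq = solve-∀ ℚ-ring

bernoulli : ∀ {u} → 0ℚ ≼ u → ∀ k → 1ℚ ⊕ fromℕ k ⊗ u ≼ pow (1ℚ ⊕ u) k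
bernoulli {u} 0≤u zero    = ≼-reflexive (cong (1ℚ ⊕_) (ℚₚ.*-zeroˡ u))
bernoulli {u} 0≤u (suc k) = begin
  1ℚ ⊕ fromℕ (suc k) ⊗ u ≡⟨ cong (λ t → 1ℚ ⊕ t ⊗ u) (fromℕ-suc k) ⟩
  1ℚ ⊕ (fromℕ k ⊕ 1ℚ) ⊗ u ≤⟨ ≼-by-difference (⊗-nonNeg (fromℕ-nonNeg k) (sq-nonNeg u)) (eq (fromℕ k) u) ⟩
  (1ℚ ⊕ u) ⊗ (1ℚ ⊕ fromℕ k ⊗ u) ≤⟨ ⊗-monoʳ (⊕-nonNeg (fromℕ-nonNeg 1) 0≤u) (bernoulli 0≤u k) ⟩
  (1ℚ ⊕ u) ⊗ pow (1ℚ ⊕ u) k ∎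
  where
  open ℚₚ.≤-Reasoning
  eq : ∀ k u → (1ℚ ⊕ u) ⊗ (1ℚ ⊕ k ⊗ u) ≡ 1ℚ ⊕ (k ⊕ 1ℚ) ⊗ u ⊕ k ⊗ (u ⊗ u)
  eq = solve-∀ ℚ-ring

module Decay (q : ℕ) (u : ℚ) (1≤q : 1 ≤ q) (0≤u : 0ℚ ≼ u) (qu≡1 : fromℕ q ⊗ u ≡ 1ℚ) where

  rate : ℚ
  rate = 1ℚ ⊖ u

  u≼1 : u ≼ 1ℚ
  u≼1 = begin
    u ≡⟨ ℚₚ.*-identityˡ u ⟨
    fromℕ 1 ⊗ u ≤⟨ ⊗-monoˡ 0≤u (fromℕ-mono 1≤q) ⟩
    fromℕ q ⊗ u ≡⟨ qu≡1 ⟩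
    1ℚ ∎
    where open ℚₚ.≤-Reasoning

  rate-nonNeg : 0ℚ ≼ rate
  rate-nonNeg = difference-nonNeg u≼1

  -- (1 - u)(1 + u) ≤ 1, and (1 + u)^q ≥ 1 + q u = 2.
  rate-halves : pow rate q ⊗ (1ℚ ⊕ 1ℚ) ≼ 1ℚ
  rate-halves = begin
    pow rate q ⊗ (1ℚ ⊕ 1ℚ) ≡⟨ cong (λ t → pow rate q ⊗ (1ℚ ⊕ t)) (sym qu≡1) ⟩
    pow rate q ⊗ (1ℚ ⊕ fromℕ q ⊗ u) ≤⟨ ⊗-monoʳ (pow-nonNeg rate-nonNeg q) (bernoulli 0≤u q) ⟩
    pow rate q ⊗ pow (1ℚ ⊕ u) q ≡⟨ pow-distrib-⊗ rate (1ℚ ⊕ u) q ⟨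
    pow (rate ⊗ (1ℚ ⊕ u)) q ≤⟨ pow-≼1 (⊗-nonNeg rate-nonNeg (⊕-nonNeg (fromℕ-nonNeg 1) 0≤u)) (≼-by-difference (sq-nonNeg u) (eq u)) q ⟩
    1ℚ ∎
    where
    open ℚₚ.≤-Reasoning
    eq : ∀ u → 1ℚ ≡ (1ℚ ⊖ u) ⊗ (1ℚ ⊕ u) ⊕ u ⊗ u
    eq = solve-∀ ℚ-ring

  decay : ∀ ℓ → pow rate (ℓ * q) ⊗ fromℕ (2 ^ ℓ) ≼ 1ℚ
  decay zero    = ≼-refl
  decay (suc ℓ) = begin
    pow rate (q + ℓ * q) ⊗ fromℕ (2 * 2 ^ ℓ) ≡⟨ cong₂ _⊗_ (pow-+ rate q (ℓ * q)) (fromℕ-homo-* 2 (2 ^ ℓ)) ⟩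
    pow rate q ⊗ pow rate (ℓ * q) ⊗ (fromℕ 2 ⊗ fromℕ (2 ^ ℓ)) ≡⟨ eq (pow rate q) (pow rate (ℓ * q)) (fromℕ 2) (fromℕ (2 ^ ℓ)) ⟩
    pow rate q ⊗ fromℕ 2 ⊗ (pow rate (ℓ * q) ⊗ fromℕ (2 ^ ℓ)) ≤⟨ ⊗-mono {pow rate q ⊗ fromℕ 2} {1ℚ} {pow rate (ℓ * q) ⊗ fromℕ (2 ^ ℓ)} {1ℚ} (⊗-nonNeg (pow-nonNeg rate-nonNeg q) (fromℕ-nonNeg 2)) (fromℕ-nonNeg 1) rate-halves (decay ℓ) ⟩
    1ℚ ⊗ 1ℚ ∎
    where
    open ℚₚ.≤-Reasoning
    eq : ∀ a b c d → a ⊗ b ⊗ (c ⊗ d) ≡ a ⊗ c ⊗ (b ⊗ d)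
    eq = solve-∀ ℚ-ring

reciprocal : ∀ q → 1 ≤ q → ∃[ u ] 0ℚ ≼ u × fromℕ q ⊗ u ≡ 1ℚ
reciprocal (suc k) _ = ℤ.+ 1 / suc k , unit-fraction-nonNeg k , unit-fraction k

module _ {S : Set} (step : S → Dist S) where

  expect-trajectory : ∀ x N F → expect (trajectory step x (suc N)) F ≡ expect (step x) (λ y → expect (trajectory step y N) (λ ys → F (x ∷ ys)))
  expect-trajectory x N F = trans (expect->>= (step x) _ F) (expect-cong (step x) (λ y →
    trans (expect->>= (trajectory step y N) _ F) (expect-cong (trajectory step y N) (λ ys → expect-return (x ∷ ys) F))))

  trajectory-isProbability : (∀ x → IsProbability (λ _ → Unit) (step x)) → ∀ N x → IsProbability (λ _ → Unit) (trajectory step x N)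
  trajectory-isProbability pr zero    x = return-isProbability tt
  trajectory-isProbability pr (suc N) x = >>=-isProbability (pr x) (λ y _ → >>=-isProbability (trajectory-isProbability pr N y) (λ _ _ → return-isProbability tt))

weaken-support : ∀ {A : Set} {P : A → Set} {D : Dist A} → IsProbability P D → IsProbability (λ _ → Unit) D
weaken-support pr = isProbability (All.map (λ (0≤p , _) → 0≤p , tt) (support pr)) (mass pr)

missing-vertex : ∀ {n} {A : Subset n} → A ≢ ⊤ → ∃[ v ] ¬ (v ∈ A)
missing-vertex {n} {A} A≢⊤ = Finₚ.¬∀⟶∃¬ n (_∈ A) (_∈? A) (λ all → A≢⊤ (⊆-antisym ⊆⊤ (λ {x} _ → all x)))

module Cover {n : ℕ} (G : Graph n) (degree-pos : ∀ v → 1 ≤ Graph.degree G v)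
  (H : ℕ) (1≤H : 1 ≤ H) (φ : Fin n → Fin n → ℚ) (φ-nonNeg : ∀ v x → 0ℚ ≼ φ v x) (φ-bounded : ∀ v x → φ v x ≼ fromℕ H)
  (φ-drift : ∀ v {x} → x ≢ v → 1ℚ ⊕ expect (walkStep G x) (φ v) ≼ φ v x) where
  open Graph G
  open Walk G degree-pos

  q : ℕ
  q = 2 * H

  1≤q : 1 ≤ q
  1≤q = ≤-trans 1≤H (m≤m+n H _)

  u : ℚ
  u = proj₁ (reciprocal q 1≤q)

  0≤u : 0ℚ ≼ u
  0≤u = proj₁ (proj₂ (reciprocal q 1≤q))

  qu≡1 : fromℕ q ⊗ u ≡ 1ℚ
  qu≡1 = proj₂ (proj₂ (reciprocal q 1≤q))

  open Decay q u 1≤q 0≤u qu≡1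

  q≡ : fromℕ q ≡ fromℕ H ⊕ fromℕ H
  q≡ = trans (cong fromℕ (cong (H +_) (+-identityʳ H))) (fromℕ-homo-+ H H)

  weight : Subset n → Fin n → Fin n → ℚ
  weight A v x = if does (v ∈? A) then 0ℚ else fromℕ H ⊕ φ v x

  -- Each weight of an unvisited vertex lies between H and 2H and decreases by 1 per step on average, so S loses a factor
  -- 1 - 1/(2H) per step, and S ≥ H until all vertices are visited.
  S : Subset n → Fin n → ℚ
  S A x = sumOver V (λ v → weight A v x)

  weight-nonNeg : ∀ A v x → 0ℚ ≼ weight A v x
  weight-nonNeg A v x with does (v ∈? A)
  ... | true  = ≼-refl
  ... | false = ⊕-nonNeg (fromℕ-nonNeg H) (φ-nonNeg v x)

  weight-bounded : ∀ A v x → weight A v x ≼ fromℕ q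
  weight-bounded A v x with does (v ∈? A)
  ... | true  = fromℕ-nonNeg q
  ... | false = ≼-trans (⊕-monoʳ (fromℕ H) (φ-bounded v x)) (≼-reflexive (sym q≡))

  weight-anti : ∀ {A B} → A ⊆ B → ∀ v x → weight B v x ≼ weight A v x
  weight-anti {A} {B} A⊆B v x with v ∈? A | v ∈? B
  ... | yes _   | yes _ = ≼-refl
  ... | yes v∈A | no v∉B = contradiction (A⊆B v∈A) v∉B
  ... | no _    | yes _ = ⊕-nonNeg (fromℕ-nonNeg H) (φ-nonNeg v x)
  ... | no _    | no _  = ≼-refl

  weight-step : ∀ A {x} → x ∈ A → ∀ v → average x (weight A v) ≼ rate ⊗ weight A v x
  weight-step A {x} x∈A v with v ∈? A
  ... | yes _   = ≼-reflexive (trans (average-const x 0ℚ) (sym (ℚₚ.*-zeroʳ rate)))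
  ... | no v∉A = begin
    average x (λ y → fromℕ H ⊕ φ v y) ≡⟨ trans (expect-distrib-⊕ (walkStep G x) (λ _ → fromℕ H) (φ v)) (cong (_⊕ average x (φ v)) (average-const x (fromℕ H))) ⟩
    fromℕ H ⊕ average x (φ v) ≤⟨ ⊕-monoʳ (fromℕ H) (⊕-cancelʳ 1ℚ (≼-trans (≼-reflexive (ℚₚ.+-comm (average x (φ v)) 1ℚ)) (≼-trans (φ-drift v x≢v) (≼-reflexive (add-one (φ v x)))))) ⟩
    fromℕ H ⊕ (φ v x ⊖ 1ℚ) ≡⟨ regroup (fromℕ H) (φ v x) 1ℚ ⟩
    fromℕ H ⊕ φ v x ⊖ 1ℚ ≤⟨ ⊕-monoʳ (fromℕ H ⊕ φ v x) (ℚₚ.neg-antimono-≤ small) ⟩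
    fromℕ H ⊕ φ v x ⊖ (fromℕ H ⊕ φ v x) ⊗ u ≡⟨ factor (fromℕ H ⊕ φ v x) u ⟩
    rate ⊗ (fromℕ H ⊕ φ v x) ∎
    where
    open ℚₚ.≤-Reasoning
    x≢v : x ≢ v
    x≢v refl = v∉A x∈A
    add-one : ∀ a → a ≡ a ⊖ 1ℚ ⊕ 1ℚ
    add-one = solve-∀ ℚ-ring
    regroup : ∀ a b c → a ⊕ (b ⊖ c) ≡ a ⊕ b ⊖ c
    regroup = solve-∀ ℚ-ring
    factor : ∀ a u → a ⊖ a ⊗ u ≡ (1ℚ ⊖ u) ⊗ a
    factor = solve-∀ ℚ-ring
    small : (fromℕ H ⊕ φ v x) ⊗ u ≼ 1ℚ
    small = ≼-trans (⊗-monoˡ {b = fromℕ q} 0≤u (≼-trans (⊕-monoʳ (fromℕ H) (φ-bounded v x)) (≼-reflexive (sym q≡)))) (≼-reflexive qu≡1)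

  S-nonNeg : ∀ A x → 0ℚ ≼ S A x
  S-nonNeg A x = sumOver-nonNeg V (λ v → weight-nonNeg A v x)

  S-bounded : ∀ A x → S A x ≼ fromℕ n ⊗ fromℕ q
  S-bounded A x = ≼-trans (sumOver-mono V (λ v → weight-bounded A v x)) (≼-reflexive (trans (sumOver-const V (fromℕ q)) (cong (λ k → fromℕ k ⊗ fromℕ q) (Listₚ.length-tabulate {n = n} (λ z → z)))))

  S-lower : ∀ {A} x → A ≢ ⊤ → fromℕ H ≼ S A x
  S-lower {A} x A≢⊤ with missing-vertex A≢⊤
  ... | v , v∉A = ≼-trans (≼-trans (a≼a⊕b (φ-nonNeg v x)) (≼-reflexive (sym (cong (if_then 0ℚ else (fromℕ H ⊕ φ v x)) (dec-false (v ∈? A) v∉A)))))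
    (sumOver-term (λ v → weight A v x) (λ v → weight-nonNeg A v x) (∈-allFin v))

  S-step : ∀ A {x} → x ∈ A → average x (λ y → S (A ∪ ⁅ y ⁆) y) ≼ rate ⊗ S A x
  S-step A {x} x∈A = begin
    average x (λ y → S (A ∪ ⁅ y ⁆) y) ≤⟨ average-mono x (λ y → sumOver-mono V (λ v → weight-anti (p⊆p∪q ⁅ y ⁆) v y)) ⟩
    average x (λ y → S A y) ≡⟨ expect-sumOver (walkStep G x) V (weight A) ⟩
    sumOver V (λ v → average x (weight A v)) ≤⟨ sumOver-mono V (weight-step A x∈A) ⟩
    sumOver V (λ v → rate ⊗ weight A v x) ≡⟨ sumOver-distribˡ-⊗ V rate (λ v → weight A v x) ⟩
    rate ⊗ S A x ∎
    where open ℚₚ.≤-Reasoning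

  cover : Subset n → Fin n → ℕ → ℚ
  cover A x N = expect (trajectory (walkStep G) x N) (λ vs → fromℕ (timeToFull G (visited G A vs)))

  trajectory-const : ∀ N y a → expect (trajectory (walkStep G) y N) (λ _ → a) ≡ a
  trajectory-const N y = expect-const (trajectory-isProbability (walkStep G) (λ x → weaken-support (step-isProbability x)) N y)

  cover-full : ∀ A x N → A ∪ ⁅ x ⁆ ≡ ⊤ → cover A x (suc N) ≡ 0ℚ
  cover-full A x N A′≡⊤ = trans (expect-trajectory (walkStep G) x N _) (trans (expect-cong (walkStep G x) (λ y →
    trans (expect-cong (trajectory (walkStep G) y N) (λ ys → cong fromℕ (cong (if_then 0 else suc (timeToFull G (visited G (A ∪ ⁅ x ⁆) ys))) (dec-true (≡-dec _≟ᵇ_ (A ∪ ⁅ x ⁆) ⊤) A′≡⊤)))) (trajectory-const N y 0ℚ))) (average-const x 0ℚ))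

  cover-step : ∀ A x N → let A′ = A ∪ ⁅ x ⁆ in A′ ≢ ⊤ → cover A x (suc N) ≡ 1ℚ ⊕ average x (λ y → cover A′ y N)
  cover-step A x N A′≢⊤ = begin
    cover A x (suc N)
      ≡⟨ expect-trajectory (walkStep G) x N _ ⟩
    average x (λ y → expect (trajectory (walkStep G) y N) (λ ys → fromℕ (timeToFull G (visited G A (x ∷ ys)))))
      ≡⟨ expect-cong (walkStep G x) (λ y → trans (expect-cong (trajectory (walkStep G) y N) (λ ys → trans (cong fromℕ (cong (if_then 0 else suc (T ys)) (dec-false (≡-dec _≟ᵇ_ A′ ⊤) A′≢⊤))) (trans (fromℕ-suc (T ys)) (ℚₚ.+-comm (fromℕ (T ys)) 1ℚ))))
           (trans (expect-distrib-⊕ (trajectory (walkStep G) y N) (λ _ → 1ℚ) (λ ys → fromℕ (T ys))) (cong (_⊕ cover A′ y N) (trajectory-const N y 1ℚ)))) ⟩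
    average x (λ y → 1ℚ ⊕ cover A′ y N)
      ≡⟨ trans (expect-distrib-⊕ (walkStep G x) (λ _ → 1ℚ) (λ y → cover A′ y N)) (cong (_⊕ average x (λ y → cover A′ y N)) (average-const x 1ℚ)) ⟩
    1ℚ ⊕ average x (λ y → cover A′ y N) ∎
    where
    open ≡-Reasoning
    A′ = A ∪ ⁅ x ⁆
    T : List (Fin n) → ℕ
    T ys = timeToFull G (visited G A′ ys)

  -- A supersolution for the remaining cover time. While the clock `k` runs, the first summand pays
  -- for each step and the factor `pow rate k` anticipates the decay of `S`. When it has run out, 2S
  -- alone drops by at least 2uS ≥ 2uH = 1 per step as long as a vertex is missing.
  Φ : ℕ → Subset n → Fin n → ℚ
  Φ k A x = fromℕ k ⊕ (1ℚ ⊕ 1ℚ) ⊗ pow rate k ⊗ S A x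

  coefficient-nonNeg : ∀ k → 0ℚ ≼ (1ℚ ⊕ 1ℚ) ⊗ pow rate k
  coefficient-nonNeg k = ⊗-nonNeg (fromℕ-nonNeg 2) (pow-nonNeg rate-nonNeg k)

  Φ-nonNeg : ∀ k A x → 0ℚ ≼ Φ k A x
  Φ-nonNeg k A x = ⊕-nonNeg (fromℕ-nonNeg k) (⊗-nonNeg (coefficient-nonNeg k) (S-nonNeg A x))

  average-Φ : ∀ k A {x} → x ∈ A → average x (λ y → Φ k (A ∪ ⁅ y ⁆) y) ≼ fromℕ k ⊕ (1ℚ ⊕ 1ℚ) ⊗ pow rate k ⊗ (rate ⊗ S A x)
  average-Φ k A {x} x∈A = ≼-trans
    (≼-reflexive (trans (expect-distrib-⊕ (walkStep G x) (λ _ → fromℕ k) (λ y → (1ℚ ⊕ 1ℚ) ⊗ pow rate k ⊗ S (A ∪ ⁅ y ⁆) y)) (cong₂ _⊕_ (average-const x (fromℕ k)) (expect-distribˡ-⊗ (walkStep G x) ((1ℚ ⊕ 1ℚ) ⊗ pow rate k) (λ y → S (A ∪ ⁅ y ⁆) y)))))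
    (⊕-monoʳ (fromℕ k) (⊗-monoʳ (coefficient-nonNeg k) (S-step A x∈A)))

  Φ-step : ∀ k {A x} → x ∈ A → 1ℚ ⊕ average x (λ y → Φ k (A ∪ ⁅ y ⁆) y) ≼ Φ (suc k) A x
  Φ-step k {A} {x} x∈A = begin
    1ℚ ⊕ average x (λ y → Φ k (A ∪ ⁅ y ⁆) y) ≤⟨ ⊕-monoʳ 1ℚ (average-Φ k A x∈A) ⟩
    1ℚ ⊕ (fromℕ k ⊕ (1ℚ ⊕ 1ℚ) ⊗ pow rate k ⊗ (rate ⊗ S A x)) ≡⟨ collect (fromℕ k) (pow rate k) rate (S A x) ⟩
    (fromℕ k ⊕ 1ℚ) ⊕ (1ℚ ⊕ 1ℚ) ⊗ (rate ⊗ pow rate k) ⊗ S A x ≡⟨ cong (_⊕ (1ℚ ⊕ 1ℚ) ⊗ (rate ⊗ pow rate k) ⊗ S A x) (sym (fromℕ-suc k)) ⟩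
    Φ (suc k) A x ∎
    where
    open ℚₚ.≤-Reasoning
    collect : ∀ k p r s → 1ℚ ⊕ (k ⊕ (1ℚ ⊕ 1ℚ) ⊗ p ⊗ (r ⊗ s)) ≡ (k ⊕ 1ℚ) ⊕ (1ℚ ⊕ 1ℚ) ⊗ (r ⊗ p) ⊗ s
    collect = solve-∀ ℚ-ring

  Φ-step₀ : ∀ {A x} → x ∈ A → A ≢ ⊤ → 1ℚ ⊕ average x (λ y → Φ 0 (A ∪ ⁅ y ⁆) y) ≼ Φ 0 A x
  Φ-step₀ {A} {x} x∈A A≢⊤ = begin
    1ℚ ⊕ average x (λ y → Φ 0 (A ∪ ⁅ y ⁆) y) ≤⟨ ⊕-mono enough (average-Φ 0 A x∈A) ⟩
    (1ℚ ⊕ 1ℚ) ⊗ u ⊗ S A x ⊕ (0ℚ ⊕ (1ℚ ⊕ 1ℚ) ⊗ 1ℚ ⊗ (rate ⊗ S A x)) ≡⟨ collect u (S A x) ⟩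
    Φ 0 A x ∎
    where
    open ℚₚ.≤-Reasoning
    collect : ∀ u s → (1ℚ ⊕ 1ℚ) ⊗ u ⊗ s ⊕ (0ℚ ⊕ (1ℚ ⊕ 1ℚ) ⊗ 1ℚ ⊗ ((1ℚ ⊖ u) ⊗ s)) ≡ 0ℚ ⊕ (1ℚ ⊕ 1ℚ) ⊗ 1ℚ ⊗ s
    collect = solve-∀ ℚ-ring
    rearrange : ∀ h u → (h ⊕ h) ⊗ u ≡ (1ℚ ⊕ 1ℚ) ⊗ u ⊗ h
    rearrange = solve-∀ ℚ-ring
    enough : 1ℚ ≼ (1ℚ ⊕ 1ℚ) ⊗ u ⊗ S A x
    enough = ≼-trans (≼-reflexive (trans (sym qu≡1) (trans (cong (_⊗ u) q≡) (rearrange (fromℕ H) u)))) (⊗-monoʳ (⊗-nonNeg (fromℕ-nonNeg 2) 0≤u) (S-lower x A≢⊤))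

  cover≼Φ : ∀ N k A x → cover A x N ≼ Φ k (A ∪ ⁅ x ⁆) x
  cover≼Φ zero    k A x = ≼-trans (≼-reflexive (expect-return {A = List (Fin n)} [] (λ _ → 0ℚ))) (Φ-nonNeg k (A ∪ ⁅ x ⁆) x)
  cover≼Φ (suc N) k A x = cases (≡-dec _≟ᵇ_ A′ ⊤)
    where
    A′ = A ∪ ⁅ x ⁆
    x∈A′ : x ∈ A′
    x∈A′ = q⊆p∪q A ⁅ x ⁆ (x∈⁅x⁆ x)
    unfold : ∀ k → A′ ≢ ⊤ → cover A x (suc N) ≼ 1ℚ ⊕ average x (λ y → Φ k (A′ ∪ ⁅ y ⁆) y)
    unfold k A′≢⊤ = ≼-trans (≼-reflexive (cover-step A x N A′≢⊤)) (⊕-monoʳ 1ℚ (average-mono x (λ y → cover≼Φ N k A′ y)))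
    advance : ∀ k → A′ ≢ ⊤ → cover A x (suc N) ≼ Φ k A′ x
    advance zero    A′≢⊤ = ≼-trans (unfold 0 A′≢⊤) (Φ-step₀ x∈A′ A′≢⊤)
    advance (suc k) A′≢⊤ = ≼-trans (unfold k A′≢⊤) (Φ-step k x∈A′)
    cases : Dec (A′ ≡ ⊤) → cover A x (suc N) ≼ Φ k A′ x
    cases (yes A′≡⊤) = ≼-trans (≼-reflexive (cover-full A x N A′≡⊤)) (Φ-nonNeg k A′ x)
    cases (no  A′≢⊤) = advance k A′≢⊤

  COVfrom≼ : ∀ ℓ → n ≤ 2 ^ ℓ → ∀ s N → COVfrom G s N ≼ fromℕ (2 * H * (ℓ + 2))
  COVfrom≼ ℓ n≤2^ℓ s N = begin
    -- With the clock `ℓ * q` the power of `rate` is at most 2^(-ℓ) ≤ 1/n, which cancels the `n`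
    -- summands of `S` and leaves 2q.
    COVfrom G s N ≤⟨ cover≼Φ N (ℓ * q) ⊥ s ⟩
    fromℕ (ℓ * q) ⊕ (1ℚ ⊕ 1ℚ) ⊗ p ⊗ S (⊥ ∪ ⁅ s ⁆) s ≤⟨ ⊕-monoʳ (fromℕ (ℓ * q)) (⊗-monoʳ (coefficient-nonNeg (ℓ * q)) (≼-trans (S-bounded (⊥ ∪ ⁅ s ⁆) s) (⊗-monoˡ (fromℕ-nonNeg q) (fromℕ-mono n≤2^ℓ)))) ⟩
    fromℕ (ℓ * q) ⊕ (1ℚ ⊕ 1ℚ) ⊗ p ⊗ (fromℕ (2 ^ ℓ) ⊗ fromℕ q) ≡⟨ cong (fromℕ (ℓ * q) ⊕_) (regroup p (fromℕ (2 ^ ℓ)) (fromℕ q)) ⟩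
    fromℕ (ℓ * q) ⊕ (p ⊗ fromℕ (2 ^ ℓ)) ⊗ ((1ℚ ⊕ 1ℚ) ⊗ fromℕ q) ≤⟨ ⊕-monoʳ (fromℕ (ℓ * q)) (⊗-monoˡ {b = 1ℚ} (⊗-nonNeg (fromℕ-nonNeg 2) (fromℕ-nonNeg q)) (decay ℓ)) ⟩
    fromℕ (ℓ * q) ⊕ 1ℚ ⊗ ((1ℚ ⊕ 1ℚ) ⊗ fromℕ q) ≡⟨ cong (fromℕ (ℓ * q) ⊕_) (trans (ℚₚ.*-identityˡ ((1ℚ ⊕ 1ℚ) ⊗ fromℕ q)) (sym (fromℕ-homo-* 2 q))) ⟩
    fromℕ (ℓ * q) ⊕ fromℕ (2 * q) ≡⟨ fromℕ-homo-+ (ℓ * q) (2 * q) ⟨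
    fromℕ (ℓ * q + 2 * q) ≡⟨ cong fromℕ (shape ℓ q) ⟩
    fromℕ (q * (ℓ + 2)) ∎
    where
    open ℚₚ.≤-Reasoning
    p = pow rate (ℓ * q)
    regroup : ∀ p m q → (1ℚ ⊕ 1ℚ) ⊗ p ⊗ (m ⊗ q) ≡ p ⊗ m ⊗ ((1ℚ ⊕ 1ℚ) ⊗ q)
    regroup = solve-∀ ℚ-ring
    shape : ∀ ℓ q → ℓ * q + 2 * q ≡ q * (ℓ + 2)
    shape = ℕ-Solver.solve-∀

-- Broadcast times and the limits in the statement

module Broadcast {n : ℕ} (G : Graph n) (degree-pos : ∀ v → 1 ≤ Graph.degree G v)
  (ρ : Fin n → ℕ) (K : ℕ) (lipschitz : ∀ {x y} → Graph.Adj G x y → ρ y ≤ ρ x + K) where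
  open Graph G

  Within : ℕ → Subset n → Set
  Within a I = ∀ {x} → x ∈ I → ρ x ≤ a

  push-within : ∀ a I → Within a I → IsProbability (Within (a + K)) (pushStep G I)
  push-within a I I⊆ = informed (filter (_∈? I) (allFin n)) (Allₚ.all-filter (_∈? I) (allFin n))
    where
    informed : ∀ us → All (_∈ I) us → IsProbability (Within (a + K))
      (foldr (λ u D → D >>= λ J → uniform (neighbours u) >>= λ v → return (J ∪ ⁅ v ⁆)) (return I) us)
    informed []       []           = return-isProbability (λ x∈I → ≤-trans (I⊆ x∈I) (m≤m+n a K))
    informed (u ∷ us) (u∈I ∷ us∈I) = >>=-isProbability (informed us us∈I) (λ J J⊆ →
      >>=-isProbability (uniform-isProbability (neighbours u) (degree-pos u) (Allₚ.all-filter (adj? u) (allFin n))) (λ v u~v →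
        return-isProbability (λ {x} x∈ → extend J⊆ u~v (x∈p∪q⁻ J ⁅ v ⁆ x∈))))
      where
      extend : ∀ {J v x} → Within (a + K) J → Adj u v → x ∈ J ⊎ x ∈ ⁅ v ⁆ → ρ x ≤ a + K
      extend J⊆ u~v (inj₁ x∈J) = J⊆ x∈J
      extend {v = v} J⊆ u~v (inj₂ x∈v) with refl ← x∈⁅y⁆⇒x≡y v x∈v = ≤-trans (lipschitz u~v) (+-monoˡ-≤ K (I⊆ u∈I))

  -- Supplies a level for an arbitrary set, so that `push-within` also shows that a push step from
  -- it is a probability distribution.
  everywhere : ∀ I → ∃[ a ] Within a I
  everywhere I = proj₁ bound , λ {x} _ → proj₂ bound x
    where
    max : ∀ k (r : Fin k → ℕ) → ∃[ a ] ∀ x → r x ≤ a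
    max zero    r = 0 , λ ()
    max (suc k) r with max k (λ x → r (suc x))
    ... | a , ≤a = r zero + a , λ { zero → m≤m+n (r zero) a ; (suc x) → ≤-trans (≤a x) (m≤n+m a (r zero)) }
    bound = max n ρ

  push-isProbability : ∀ I → IsProbability (λ _ → Unit) (pushStep G I)
  push-isProbability I = weaken-support (push-within (proj₁ (everywhere I)) I (proj₂ (everywhere I)))

  broadcast : Subset n → ℕ → ℚ
  broadcast I N = expect (trajectory (pushStep G) I N) (λ Is → fromℕ (timeToFull G Is))

  broadcast-step : ∀ {I} N → I ≢ ⊤ → broadcast I (suc N) ≡ 1ℚ ⊕ expect (pushStep G I) (λ J → broadcast J N)
  broadcast-step {I} N I≢⊤ = begin
    broadcast I (suc N)
      ≡⟨ expect-trajectory (pushStep G) I N _ ⟩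
    expect (pushStep G I) (λ J → expect (trajectory (pushStep G) J N) (λ Is → fromℕ (timeToFull G (I ∷ Is))))
      ≡⟨ expect-cong (pushStep G I) (λ J → trans (expect-cong (trajectory (pushStep G) J N) (λ Is → trans (cong fromℕ (cong (if_then 0 else suc (timeToFull G Is)) (dec-false (≡-dec _≟ᵇ_ I ⊤) I≢⊤))) (trans (fromℕ-suc (timeToFull G Is)) (ℚₚ.+-comm (fromℕ (timeToFull G Is)) 1ℚ))))
           (trans (expect-distrib-⊕ (trajectory (pushStep G) J N) (λ _ → 1ℚ) (λ Is → fromℕ (timeToFull G Is))) (cong (_⊕ broadcast J N) (expect-const (trajectory-isProbability (pushStep G) push-isProbability N J) 1ℚ)))) ⟩
    expect (pushStep G I) (λ J → 1ℚ ⊕ broadcast J N)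
      ≡⟨ trans (expect-distrib-⊕ (pushStep G I) (λ _ → 1ℚ) (λ J → broadcast J N)) (cong (_⊕ expect (pushStep G I) (λ J → broadcast J N)) (expect-const (push-isProbability I) 1ℚ)) ⟩
    1ℚ ⊕ expect (pushStep G I) (λ J → broadcast J N) ∎
    where open ≡-Reasoning

  -- In one step the highest informed level rises by at most `K`, whatever the random choices. The
  -- last hypothesis says that after j - 1 further steps it is still below `ρ v`, so `v` is
  -- uninformed at each of the times 0, ..., j - 1.
  broadcast-lower : ∀ v j N a I → Within a I → j ≤ N → a + j * K < ρ v + K → fromℕ j ≼ broadcast I N
  broadcast-lower v zero    N a I _ _ _ = expect-≽ (trajectory-isProbability (pushStep G) push-isProbability N I) 0ℚ (λ Is _ → fromℕ-nonNeg (timeToFull G Is))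
  broadcast-lower v (suc j) (suc N) a I I⊆ (s≤s j≤N) far = begin
    fromℕ (suc j) ≡⟨ trans (fromℕ-suc j) (ℚₚ.+-comm (fromℕ j) 1ℚ) ⟩
    1ℚ ⊕ fromℕ j ≤⟨ ⊕-monoʳ 1ℚ (expect-≽ (push-within a I I⊆) (fromℕ j) (λ J J⊆ → broadcast-lower v j N (a + K) J J⊆ j≤N far′)) ⟩
    1ℚ ⊕ expect (pushStep G I) (λ J → broadcast J N) ≡⟨ broadcast-step N I≢⊤ ⟨
    broadcast I (suc N) ∎
    where
    open ℚₚ.≤-Reasoning
    far′ : a + K + j * K < ρ v + K
    far′ = ≤-<-trans (≤-reflexive (+-assoc a K (j * K))) far
    near : a < ρ v
    near = ≤-<-trans (m≤m+n a (j * K)) (+-cancelʳ-< K (a + j * K) (ρ v) (≤-<-trans (≤-reflexive (shuffle a K (j * K))) far))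
      where
      shuffle : ∀ a k t → a + t + k ≡ a + (k + t)
      shuffle = ℕ-Solver.solve-∀
    I≢⊤ : I ≢ ⊤
    I≢⊤ refl = <-irrefl refl (<-≤-trans near (I⊆ ∈⊤))

  RBAfrom≽ : ∀ s v j N → ρ s ≡ 0 → j ≤ N → j * K < ρ v + K → fromℕ j ≼ RBAfrom G s N
  RBAfrom≽ s v j N ρs≡0 = broadcast-lower v j N 0 ⁅ s ⁆ (λ x∈ → ≤-reflexive (trans (cong ρ (x∈⁅y⁆⇒x≡y s x∈)) ρs≡0))

maxᴿ-≼ : ∀ {n} (x : Fin n → Real) N a → 0ℚ ≼ a → (∀ s → x s N ≼ a) → maxᴿ x N ≼ a
maxᴿ-≼ {n} x N a 0≤a h = go (allFin n)
  where
  go : ∀ ss → foldr (λ s m → x s N ⊔ m) 0ℚ ss ≼ a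
  go []       = 0≤a
  go (s ∷ ss) = ℚₚ.⊔-lub (h s) (go ss)

≼-maxᴿ : ∀ {n} (x : Fin n → Real) N s → x s N ≼ maxᴿ x N
≼-maxᴿ {n} x N s = go (∈-allFin s)
  where
  go : ∀ {ss} → s ∈ˡ ss → x s N ≼ foldr (λ s m → x s N ⊔ m) 0ℚ ss
  go (here refl)      = ℚₚ.p≤p⊔q _ _
  go {s′ ∷ ss} (there s∈) = ≼-trans (go s∈) (ℚₚ.p≤q⊔p (x s′ N) _)

÷₀-≼ : ∀ {p q y} → 0ℚ ≺ q → p ≼ y ⊗ q → p ÷₀ q ≼ y
÷₀-≼ {p} {q} {y} 0<q p≤yq with q ℚₚ.≟ 0ℚ
... | yes q≡0 = contradiction (sym q≡0) (ℚₚ.<⇒≢ 0<q)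
... | no q≢0 = ℚₚ.*-cancelʳ-≤-pos q {{positive 0<q}} (≼-trans (≼-reflexive cancel) p≤yq)
  where
  instance
    _ = ≢-nonZero q≢0
  cancel : p ⊗ (1/ q) ⊗ q ≡ p
  cancel = trans (ℚₚ.*-assoc p (1/ q) q) (trans (cong (p ⊗_) (ℚₚ.*-inverseˡ q)) (ℚₚ.*-identityʳ p))

ℛ-≼ : ∀ {n} (G : Graph n) B j Y N → (∀ s → COVfrom G s N ≼ fromℕ B) → ∀ s → fromℕ j ≼ RBAfrom G s N → 1 ≤ j → B ≤ Y * j → ℛ G N ≼ fromℕ Y
ℛ-≼ G B j Y N cov s rba 1≤j B≤Yj = ÷₀-≼ (ℚₚ.<-≤-trans (fromℕ-0< 1≤j) j≤RBA) (begin
  COV G N ≤⟨ maxᴿ-≼ (COVfrom G) N (fromℕ B) (fromℕ-nonNeg B) cov ⟩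
  fromℕ B ≤⟨ fromℕ-mono B≤Yj ⟩
  fromℕ (Y * j) ≡⟨ fromℕ-homo-* Y j ⟩
  fromℕ Y ⊗ fromℕ j ≤⟨ ⊗-monoʳ (fromℕ-nonNeg Y) j≤RBA ⟩
  fromℕ Y ⊗ RBA G N  ∎)
  where
  open ℚₚ.≤-Reasoning
  j≤RBA : fromℕ j ≼ RBA G N
  j≤RBA = ≼-trans rba (≼-maxᴿ (RBAfrom G) N s)

fraction-≽ : ∀ a b k → a * suc k ≤ b → fromℕ a ≼ ℤ.+ b / suc k
fraction-≽ a b k h = toℚᵘ-cancel-≤ (ℚᵘₚ.≤-respˡ-≃ (ℚᵘₚ.≃-sym (toℚᵘ-fromℚᵘ (ℚᵘ.mkℚᵘ (ℤ.+ a) 0)))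
  (ℚᵘₚ.≤-respʳ-≃ (ℚᵘₚ.≃-sym (toℚᵘ-fromℚᵘ (ℚᵘ.mkℚᵘ (ℤ.+ b) k)))
  (ℚᵘ.*≤* (subst₂ ℤ._≤_ (ℤₚ.pos-* a (suc k)) (sym (ℤₚ.*-identityʳ (ℤ.+ b))) (ℤ.+≤+ h)))))

-- Powers of two have exact logarithms, so the bound holds for every term of the sequence and not
-- only in the limit.
logᴿ-≽ : ∀ ℓ n → 2 ^ ℓ ≤ n → ∀ N → fromℕ ℓ ≼ logᴿ n N
logᴿ-≽ ℓ n 2^ℓ≤n N = fraction-≽ ℓ ⌊log₂ (n ^ suc N) ⌋ N (begin
  ℓ * suc N ≡⟨ ⌊log₂[2^n]⌋≡n (ℓ * suc N) ⟨
  ⌊log₂ (2 ^ (ℓ * suc N)) ⌋ ≡⟨ cong ⌊log₂_⌋ (sym (ℕₚ.^-*-assoc 2 ℓ (suc N))) ⟩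
  ⌊log₂ ((2 ^ ℓ) ^ suc N) ⌋ ≤⟨ ⌊log₂⌋-mono-≤ (ℕₚ.^-monoˡ-≤ (suc N) 2^ℓ≤n) ⟩
  ⌊log₂ (n ^ suc N) ⌋              ∎)
  where open ℕₚ.≤-Reasoning

⌊√⌋-upper : ∀ m → m < suc ⌊√ m ⌋ * suc ⌊√ m ⌋
⌊√⌋-upper zero    = s≤s z≤n
⌊√⌋-upper (suc m) with suc ⌊√ m ⌋ * suc ⌊√ m ⌋ ℕ.≤? suc m
... | yes p = subst (λ r → suc m < suc r * suc r) (sym (cong (if_then suc ⌊√ m ⌋ else ⌊√ m ⌋) (dec-true (suc ⌊√ m ⌋ * suc ⌊√ m ⌋ ℕ.≤? suc m) p)))
  (≤-<-trans (⌊√⌋-upper m) (ℕₚ.*-mono-< (n<1+n (suc ⌊√ m ⌋)) (n<1+n (suc ⌊√ m ⌋))))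
... | no ¬p = subst (λ r → suc m < suc r * suc r) (sym (cong (if_then suc ⌊√ m ⌋ else ⌊√ m ⌋) (dec-false (suc ⌊√ m ⌋ * suc ⌊√ m ⌋ ℕ.≤? suc m) ¬p)))
  (≰⇒> ¬p)

⌊√⌋-≥ : ∀ m r → r * r ≤ m → r ≤ ⌊√ m ⌋
⌊√⌋-≥ m r r²≤m with r ℕ.≤? ⌊√ m ⌋
... | yes r≤ = r≤
... | no  r≰ = contradiction (<-≤-trans (⌊√⌋-upper m) (≤-trans (*-mono-≤ (≰⇒> r≰) (≰⇒> r≰)) r²≤m)) (<-irrefl refl)

√ᴿ-≽ : ∀ r n → r * r ≤ n → ∀ N → fromℕ r ≼ √ᴿ n N
√ᴿ-≽ r n r²≤n N = fraction-≽ r _ N (⌊√⌋-≥ (n * (suc N * suc N)) (r * suc N)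
  (≤-trans (≤-reflexive (shuffle r (suc N))) (*-monoˡ-≤ (suc N * suc N) r²≤n)))
  where
  shuffle : ∀ r k → r * k * (r * k) ≡ r * r * (k * k)
  shuffle = ℕ-Solver.solve-∀

scale-exists : ∀ B b n → 2 ≤ B → 1 ≤ b → b ≤ n → ∃[ L ] b * B ^ L ≤ n × n < b * B ^ suc L
scale-exists B b n 2≤B 1≤b b≤n = search n n<bBⁿ
  where
  n<Bⁿ : ∀ k → k < B ^ k
  n<Bⁿ zero    = s≤s z≤n
  n<Bⁿ (suc k) = ≤-trans (+-mono-≤ {1} (≤-trans (s≤s z≤n) (n<Bⁿ k)) (n<Bⁿ k))
    (≤-trans (≤-reflexive (cong (B ^ k +_) (sym (+-identityʳ (B ^ k))))) (*-monoˡ-≤ (B ^ k) 2≤B))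
  n<bBⁿ : n < b * B ^ n
  n<bBⁿ = <-≤-trans (n<Bⁿ n) (≤-trans (≤-reflexive (sym (*-identityˡ (B ^ n)))) (*-monoˡ-≤ (B ^ n) 1≤b))
  search : ∀ k → n < b * B ^ k → ∃[ L ] b * B ^ L ≤ n × n < b * B ^ suc L
  search zero    n<b = contradiction (<-≤-trans n<b (≤-trans (≤-reflexive (*-identityʳ b)) b≤n)) (<-irrefl refl)
  search (suc k) n<  with b * B ^ k ℕ.≤? n
  ... | yes ≤n = k , ≤n , n<
  ... | no  ≰n = search k (≰⇒> ≰n)

-- Circulant graphs with one extra generator

∑-only : ∀ n e (t : ℕ → ℚ) → (∀ g → g ≢ e → t g ≡ 0ℚ) → e < n → ∑ n t ≡ t e
∑-only (suc n) e t zero-off e<1+n with n ≟ e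
... | yes refl = trans (cong (_⊕ t n) (trans (∑-cong n (λ g g<n → zero-off g (<⇒≢ g<n))) (∑-zero n))) (ℚₚ.+-identityˡ (t n))
... | no  n≢e  = trans (cong₂ _⊕_ (∑-only n e t zero-off (ℕₚ.≤∧≢⇒< (ℕ.s≤s⁻¹ e<1+n) (λ e≡n → n≢e (sym e≡n)))) (zero-off n n≢e)) (ℚₚ.+-identityʳ (t e))

∑-reverse : ∀ n f → ∑ n (λ i → f (n ∸ suc i)) ≡ ∑ n f
∑-reverse zero    f = refl
∑-reverse (suc n) f = trans (∑-front n (λ i → f (suc n ∸ suc i))) (trans (cong (f n ⊕_) (∑-reverse n f)) (ℚₚ.+-comm (f n) (∑ n f)))

sumOver-tabulate : ∀ {A : Set} n (g : Fin n → A) F (Φ : ℕ → ℚ) → (∀ i → F (g i) ≡ Φ (toℕ i)) → sumOver (tabulate g) F ≡ ∑ n Φ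
sumOver-tabulate zero    g F Φ h = refl
sumOver-tabulate (suc n) g F Φ h = trans (cong₂ _⊕_ (h zero) (sumOver-tabulate n (λ i → g (suc i)) F (λ i → Φ (suc i)) (λ i → h (suc i)))) (sym (∑-front n Φ))

does-elim : ∀ {P : Set} (P? : Dec P) → does P? ≡ true → P
does-elim (yes p) _ = p

∧-elim : ∀ a {b} → a ∧ b ≡ true → a ≡ true × b ≡ true
∧-elim true b≡ = refl , b≡

∨-elim : ∀ a {b} → a ∨ b ≡ true → a ≡ true ⊎ b ≡ true
∨-elim true  _  = inj₁ refl
∨-elim false b≡ = inj₂ b≡

bit : Bool → ℕ
bit b = if b then 1 else 0

if-∨ : ∀ a b (t : ℚ) → ¬ (a ≡ true × b ≡ true) → (if a ∨ b then t else 0ℚ) ≡ (if a then t else 0ℚ) ⊕ (if b then t else 0ℚ)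
if-∨ true  true  t h = contradiction (refl , refl) h
if-∨ true  false t h = sym (ℚₚ.+-identityʳ t)
if-∨ false b     t h = sym (ℚₚ.+-identityˡ (if b then t else 0ℚ))

if-∨-≽ : ∀ a b {t : ℚ} → 0ℚ ≼ t → (if a then t else 0ℚ) ≼ (if a ∨ b then t else 0ℚ)
if-∨-≽ true  b     0≤t = ≼-refl
if-∨-≽ false true  0≤t = 0≤t
if-∨-≽ false false 0≤t = ≼-refl

[m%n+o]%n≡[m+o]%n : ∀ n {{_ : NonZero n}} a b → (a % n + b) % n ≡ (a + b) % n
[m%n+o]%n≡[m+o]%n n a b = trans (%-distribˡ-+ (a % n) b n) (trans (cong (λ t → (t + b % n) % n) (m%n%n≡m%n a n)) (sym (%-distribˡ-+ a b n)))

-- The generators lo, ..., lo + len - 1 act at every vertex, the extra generator `e` only at the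
-- vertices selected by `q`. This one format covers an antipodal matching, one added edge, one
-- missing edge, and chords at selected vertices.
module Circulant (n : ℕ) {{_ : NonZero n}} (lo len e : ℕ) (q : ℕ → Bool) where

  inRange : ℕ → Bool
  inRange g = does (lo ≤? g) ∧ does (g <? lo + len)

  isEdge : ℕ → ℕ → Bool
  isEdge g x = inRange g ∨ (does (g ≟ e) ∧ q x)

  difference : ℕ → ℕ → ℕ
  difference x y = (y + (n ∸ x)) % n

  adjacent : ℕ → ℕ → Bool
  adjacent x y = isEdge (difference x y) x ∨ isEdge (difference y x) y

  Adj : Fin n → Fin n → Set
  Adj x y = adjacent (toℕ x) (toℕ y) ≡ true

  inRange-true : ∀ g → lo ≤ g → g < lo + len → inRange g ≡ true
  inRange-true g a b = cong₂ _∧_ (dec-true (lo ≤? g) a) (dec-true (g <? lo + len) b)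

  inRange-elim : ∀ g → inRange g ≡ true → lo ≤ g × g < lo + len
  inRange-elim g h = let (a , b) = ∧-elim (does (lo ≤? g)) h in does-elim (lo ≤? g) a , does-elim (g <? lo + len) b

  isEdge-elim : ∀ g x → isEdge g x ≡ true → (lo ≤ g × g < lo + len) ⊎ (g ≡ e × q x ≡ true)
  isEdge-elim g x h with ∨-elim (inRange g) h
  ... | inj₁ r = inj₁ (inRange-elim g r)
  ... | inj₂ r = let (a , b) = ∧-elim (does (g ≟ e)) r in inj₂ (does-elim (g ≟ e) a , b)

  isEdge-range : ∀ {g} x → lo ≤ g → g < lo + len → isEdge g x ≡ true
  isEdge-range {g} x a b = cong (_∨ (does (g ≟ e) ∧ q x)) (inRange-true g a b)

  isEdge-extra : ∀ x → q x ≡ true → isEdge e x ≡ true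
  isEdge-extra x qx with inRange e
  ... | true  = refl
  ... | false = cong₂ _∧_ (dec-true (e ≟ e) refl) qx

  difference-+ : ∀ x g → x < n → g < n → difference x ((x + g) % n) ≡ g
  difference-+ x g x<n g<n = begin
    ((x + g) % n + (n ∸ x)) % n ≡⟨ [m%n+o]%n≡[m+o]%n n (x + g) (n ∸ x) ⟩
    (x + g + (n ∸ x)) % n ≡⟨ cong (_% n) (trans (shuffle x g (n ∸ x)) (cong (g +_) (m+[n∸m]≡n (<⇒≤ x<n)))) ⟩
    (g + n) % n ≡⟨ [m+n]%n≡m%n g n ⟩
    g % n ≡⟨ m<n⇒m%n≡m g<n ⟩
    g ∎
    where
    open ≡-Reasoning
    shuffle : ∀ x g k → x + g + k ≡ g + (x + k)
    shuffle = ℕ-Solver.solve-∀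

  +-difference : ∀ x y → x < n → y < n → (x + difference x y) % n ≡ y
  +-difference x y x<n y<n = begin
    (x + (y + (n ∸ x)) % n) % n ≡⟨ cong (_% n) (+-comm x ((y + (n ∸ x)) % n)) ⟩
    ((y + (n ∸ x)) % n + x) % n ≡⟨ [m%n+o]%n≡[m+o]%n n (y + (n ∸ x)) x ⟩
    (y + (n ∸ x) + x) % n ≡⟨ cong (_% n) (trans (+-assoc y (n ∸ x) x) (cong (y +_) (m∸n+n≡m (<⇒≤ x<n)))) ⟩
    (y + n) % n ≡⟨ [m+n]%n≡m%n y n ⟩
    y % n ≡⟨ m<n⇒m%n≡m y<n ⟩
    y ∎
    where open ≡-Reasoning

  difference-reverse : ∀ x g → x < n → g < n → difference ((x + g) % n) x ≡ (n ∸ g) % n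
  difference-reverse x g x<n g<n with x + g <? n
  ... | yes x+g<n = cong (_% n) (begin
    x + (n ∸ (x + g) % n) ≡⟨ cong (λ t → x + (n ∸ t)) (m<n⇒m%n≡m x+g<n) ⟩
    x + (n ∸ (x + g)) ≡⟨ cong (x +_) (sym (trans (ℕₚ.∸-+-assoc n g x) (cong (n ∸_) (+-comm g x)))) ⟩
    x + (n ∸ g ∸ x) ≡⟨ m+[n∸m]≡n (ℕₚ.m+n≤o⇒m≤o∸n x (<⇒≤ x+g<n)) ⟩
    n ∸ g                    ∎)
    where open ≡-Reasoning
  ... | no x+g≮n = begin
    (x + (n ∸ (x + g) % n)) % n ≡⟨ cong (λ t → (x + (n ∸ t)) % n) wrapped ⟩
    (x + (n ∸ w)) % n ≡⟨ cong (_% n) balance ⟩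
    (n ∸ g + n) % n ≡⟨ [m+n]%n≡m%n (n ∸ g) n ⟩
    (n ∸ g) % n ∎
    where
    open ≡-Reasoning
    n≤x+g = ≮⇒≥ x+g≮n
    w = x + g ∸ n
    w+n : w + n ≡ x + g
    w+n = m∸n+n≡m n≤x+g
    w<n : w < n
    w<n = +-cancelʳ-< n w n (≤-<-trans (≤-reflexive w+n) (ℕₚ.+-mono-< x<n g<n))
    wrapped : (x + g) % n ≡ w
    wrapped = trans (cong (_% n) (sym w+n)) (trans ([m+n]%n≡m%n w n) (m<n⇒m%n≡m w<n))
    balance : x + (n ∸ w) ≡ n ∸ g + n
    balance = ℕₚ.+-cancelʳ-≡ (w + g) _ _ (begin
      x + (n ∸ w) + (w + g) ≡⟨ left x (n ∸ w) w g ⟩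
      x + g + (n ∸ w + w) ≡⟨ cong₂ _+_ (sym w+n) (m∸n+n≡m (<⇒≤ w<n)) ⟩
      w + n + n ≡⟨ cong (λ t → w + t + n) (sym (m∸n+n≡m (<⇒≤ g<n))) ⟩
      w + (n ∸ g + g) + n ≡⟨ right w (n ∸ g) g n ⟩
      n ∸ g + n + (w + g)     ∎)
      where
      left : ∀ x k w g → x + k + (w + g) ≡ x + g + (k + w)
      left = ℕ-Solver.solve-∀
      right : ∀ w k g n → w + (k + g) + n ≡ k + n + (w + g)
      right = ℕ-Solver.solve-∀

  Adj-symmetric : ∀ {x y} → Adj x y → Adj y x
  Adj-symmetric {x} {y} x~y = trans (∨-comm (isEdge (difference (toℕ y) (toℕ x)) (toℕ y)) _) x~y

  Adj-forward : ∀ {x y} g → g < n → isEdge g (toℕ x) ≡ true → toℕ y ≡ (toℕ x + g) % n → Adj x y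
  Adj-forward {x} {y} g g<n edge y≡ = cong (_∨ isEdge (difference (toℕ y) (toℕ x)) (toℕ y))
    (trans (cong (λ t → isEdge t (toℕ x)) (trans (cong (difference (toℕ x)) y≡) (difference-+ (toℕ x) g (Finₚ.toℕ<n x) g<n))) edge)

  Adj-elim : ∀ {x y} → Adj x y →
    (∃[ g ] isEdge g (toℕ x) ≡ true × toℕ y ≡ (toℕ x + g) % n) ⊎ (∃[ g ] isEdge g (toℕ y) ≡ true × toℕ x ≡ (toℕ y + g) % n)
  Adj-elim {x} {y} x~y with isEdge (difference (toℕ x) (toℕ y)) (toℕ x) in eq
  ... | true  = inj₁ (_ , eq , sym (+-difference (toℕ x) (toℕ y) (Finₚ.toℕ<n x) (Finₚ.toℕ<n y)))
  ... | false = inj₂ (_ , x~y , sym (+-difference (toℕ y) (toℕ x) (Finₚ.toℕ<n y) (Finₚ.toℕ<n x)))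

  -- The conditions make every edge arise from exactly one start and generator. Generators of the
  -- range satisfy 2g < n strictly, by `range-short`. The extra one may be n/2, in which case
  -- `extra-once` forbids selecting both ends of the same edge.
  module Valid (1≤lo : 1 ≤ lo) (range-short : 2 * (lo + len) ≤ suc n)
    (extra-short : ∀ x → q x ≡ true → 1 ≤ e × 2 * e ≤ n × inRange e ≡ false)
    (extra-once : ∀ x → x < n → q x ≡ true → q ((x + e) % n) ≡ true → 2 * e ≢ n)
    (linked : ∀ x y → toℕ y ≡ suc (toℕ x) → Star Adj x y) where

    range-half : ∀ {g} → g < lo + len → 2 * g < n
    range-half {g} g< = ℕ.s≤s⁻¹ (≤-trans (≤-reflexive (shape g)) (≤-trans (*-monoʳ-≤ 2 g<) range-short))
      where
      shape : ∀ g → suc (suc (2 * g)) ≡ 2 * suc g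
      shape = ℕ-Solver.solve-∀

    lo+len≤n : lo + len ≤ n
    lo+len≤n = ℕ.s≤s⁻¹ (≤-trans (+-mono-≤ (≤-trans 1≤lo (m≤m+n lo len)) (≤-reflexive (sym (+-identityʳ (lo + len))))) range-short)

    isEdge-half : ∀ g x → isEdge g x ≡ true → 1 ≤ g × 2 * g ≤ n
    isEdge-half g x h with isEdge-elim g x h
    ... | inj₁ (lo≤g , g<)  = ≤-trans 1≤lo lo≤g , <⇒≤ (range-half g<)
    ... | inj₂ (refl , qx) = proj₁ (extra-short x qx) , proj₁ (proj₂ (extra-short x qx))

    isEdge-< : ∀ g x → isEdge g x ≡ true → g < n
    isEdge-< g x h = let (1≤g , 2g≤n) = isEdge-half g x h in <-≤-trans (m<m+n g (≤-trans 1≤g (m≤m+n g 0))) 2g≤n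

    fixpoint-free : ∀ (v : Fin n) g → isEdge g (toℕ v) ≡ true → toℕ v ≢ (toℕ v + g) % n
    fixpoint-free v g edge v≡ = <-irrefl refl (<-≤-trans (proj₁ (isEdge-half g (toℕ v) edge)) (≤-reflexive g≡0))
      where
      open ≡-Reasoning
      g≡0 : g ≡ 0
      g≡0 = begin
        g ≡⟨ difference-+ (toℕ v) g (Finₚ.toℕ<n v) (isEdge-< g (toℕ v) edge) ⟨
        difference (toℕ v) ((toℕ v + g) % n) ≡⟨ cong (difference (toℕ v)) (sym v≡) ⟩
        (toℕ v + (n ∸ toℕ v)) % n ≡⟨ cong (_% n) (m+[n∸m]≡n (<⇒≤ (Finₚ.toℕ<n v))) ⟩
        n % n ≡⟨ n%n≡0 n ⟩
        0 ∎

    loopless : ∀ v → ¬ Adj v v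
    loopless v v~v with Adj-elim {v} {v} v~v
    ... | inj₁ (g , edge , v≡) = fixpoint-free v g edge v≡
    ... | inj₂ (g , edge , v≡) = fixpoint-free v g edge v≡

    ascend : ∀ k x y → toℕ y ≡ k + toℕ x → Star Adj x y
    ascend zero    x y y≡x with refl ← Finₚ.toℕ-injective y≡x = ε
    ascend (suc k) x y y≡ = ascend k x z (Finₚ.toℕ-fromℕ< z<n) ◅◅ linked z y (trans y≡ (cong suc (sym (Finₚ.toℕ-fromℕ< z<n))))
      where
      z<n : k + toℕ x < n
      z<n = <-trans (≤-reflexive (sym y≡)) (Finₚ.toℕ<n y)
      z = fromℕ< z<n

    connected : ∀ x y → Star Adj x y
    connected x y with ℕₚ.≤-total (toℕ x) (toℕ y)
    ... | inj₁ x≤y = ascend (toℕ y ∸ toℕ x) x y (sym (m∸n+n≡m x≤y))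
    ... | inj₂ y≤x = reverse (λ {a} {b} → Adj-symmetric {a} {b}) (ascend (toℕ x ∸ toℕ y) y x (sym (m∸n+n≡m y≤x)))

    graph : Graph n
    graph = record
      { Adj       = Adj
      ; adj?      = λ x y → adjacent (toℕ x) (toℕ y) ≟ᵇ true
      ; symmetric = λ {x} {y} → Adj-symmetric {x} {y}
      ; loopless  = loopless
      ; connected = connected
      }

    open Graph graph using (neighbours; degree; adj?)

    does-≟true : ∀ b → does (b ≟ᵇ true) ≡ b
    does-≟true true  = refl
    does-≟true false = refl

    -- Substituting y = x + g turns the sum over vertices into a sum over differences; seen from the
    -- other end the difference is n - g.
    neighbour-sum : ∀ x (F : ℕ → ℚ) → sumOver (neighbours x) (λ y → F (toℕ y)) ≡
      ∑ n (λ g → if isEdge g (toℕ x) ∨ isEdge ((n ∸ g) % n) ((toℕ x + g) % n) then F ((toℕ x + g) % n) else 0ℚ)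
    neighbour-sum x F = begin
      sumOver (neighbours x) (λ y → F (toℕ y))
        ≡⟨ sumOver-filter (adj? x) (allFin n) (λ y → F (toℕ y)) ⟩
      sumOver (allFin n) (λ y → if does (adj? x y) then F (toℕ y) else 0ℚ)
        ≡⟨ sumOver-tabulate n (λ y → y) _ Ψ (λ y → cong (if_then F (toℕ y) else 0ℚ) (does-≟true (adjacent (toℕ x) (toℕ y)))) ⟩
      ∑ n Ψ
        ≡⟨ ∑-cong n (λ i i<n → cong Ψ (sym (m<n⇒m%n≡m i<n))) ⟩
      ∑ n (λ i → Ψ (i % n))
        ≡⟨ ∑-shift n (λ i → Ψ (i % n)) (λ i → cong Ψ ([m+n]%n≡m%n i n)) (toℕ x) ⟨
      ∑ n (λ g → Ψ ((toℕ x + g) % n))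
        ≡⟨ ∑-cong n (λ g g<n → cong (if_then F ((toℕ x + g) % n) else 0ℚ) (cong₂ (λ s t → isEdge s (toℕ x) ∨ isEdge t ((toℕ x + g) % n)) (difference-+ (toℕ x) g (Finₚ.toℕ<n x) g<n) (difference-reverse (toℕ x) g (Finₚ.toℕ<n x) g<n))) ⟩
      ∑ n (λ g → if isEdge g (toℕ x) ∨ isEdge ((n ∸ g) % n) ((toℕ x + g) % n) then F ((toℕ x + g) % n) else 0ℚ) ∎
      where
      open ≡-Reasoning
      Ψ : ℕ → ℚ
      Ψ i = if adjacent (toℕ x) i then F i else 0ℚ

    range-sum : ∀ (Φ : ℕ → ℚ) → ∑ n (λ g → if inRange g then Φ g else 0ℚ) ≡ ∑ len (λ i → Φ (lo + i))
    range-sum Φ = begin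
      ∑ n t ≡⟨ cong (λ k → ∑ k t) (sym (trans (sym (+-assoc lo len r)) (m+[n∸m]≡n lo+len≤n))) ⟩
      ∑ (lo + (len + r)) t ≡⟨ ∑-split lo (len + r) t ⟩
      ∑ lo t ⊕ ∑ (len + r) (λ i → t (lo + i)) ≡⟨ cong₂ _⊕_ (trans (∑-cong lo (λ g g<lo → cong (if_then Φ g else 0ℚ) (cong (_∧ does (g <? lo + len)) (dec-false (lo ≤? g) (<⇒≱ g<lo))))) (∑-zero lo)) (∑-split len r (λ i → t (lo + i))) ⟩
      0ℚ ⊕ (∑ len (λ i → t (lo + i)) ⊕ ∑ r (λ i → t (lo + (len + i)))) ≡⟨ cong (0ℚ ⊕_) (cong₂ _⊕_ (∑-cong len (λ i i<len → cong (if_then Φ (lo + i) else 0ℚ) (inRange-true (lo + i) (m≤m+n lo i) (ℕₚ.+-monoʳ-< lo i<len))))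
           (trans (∑-cong r (λ i _ → cong (if_then Φ (lo + (len + i)) else 0ℚ) (cong₂ _∧_ {y = true} (dec-true (lo ≤? lo + (len + i)) (m≤m+n lo (len + i))) (dec-false (lo + (len + i) <? lo + len) (≤⇒≯ (+-monoʳ-≤ lo (m≤m+n len i))))))) (∑-zero r))) ⟩
      0ℚ ⊕ (∑ len (λ i → Φ (lo + i)) ⊕ 0ℚ) ≡⟨ trans (ℚₚ.+-identityˡ (∑ len (λ i → Φ (lo + i)) ⊕ 0ℚ)) (ℚₚ.+-identityʳ (∑ len (λ i → Φ (lo + i)))) ⟩
      ∑ len (λ i → Φ (lo + i)) ∎
      where
      open ≡-Reasoning
      r = n ∸ (lo + len)
      t : ℕ → ℚ
      t g = if inRange g then Φ g else 0ℚ

    -- The vertex may depend on the generator, so that the same count serves the edges leaving a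
    -- vertex and those arriving at it.
    edge-sum : ∀ (base : ℕ → ℕ) (Φ : ℕ → ℚ) →
      ∑ n (λ g → if isEdge g (base g) then Φ g else 0ℚ) ≡ ∑ len (λ i → Φ (lo + i)) ⊕ (if q (base e) then Φ e else 0ℚ)
    edge-sum base Φ = begin
      ∑ n (λ g → if isEdge g (base g) then Φ g else 0ℚ)
        ≡⟨ ∑-cong n (λ g _ → if-∨ (inRange g) (does (g ≟ e) ∧ q (base g)) (Φ g) (exclusive g)) ⟩
      ∑ n (λ g → (if inRange g then Φ g else 0ℚ) ⊕ t g)
        ≡⟨ ∑-distrib-⊕ n (λ g → if inRange g then Φ g else 0ℚ) t ⟩
      ∑ n (λ g → if inRange g then Φ g else 0ℚ) ⊕ ∑ n t
        ≡⟨ cong₂ _⊕_ (range-sum Φ) extra ⟩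
      ∑ len (λ i → Φ (lo + i)) ⊕ (if q (base e) then Φ e else 0ℚ) ∎
      where
      open ≡-Reasoning
      t : ℕ → ℚ
      t g = if does (g ≟ e) ∧ q (base g) then Φ g else 0ℚ
      exclusive : ∀ g → ¬ (inRange g ≡ true × (does (g ≟ e) ∧ q (base g)) ≡ true)
      exclusive g (a , b) = let (g≡e , qg) = ∧-elim (does (g ≟ e)) b in
        contradiction (trans (sym a) (trans (cong inRange (does-elim (g ≟ e) g≡e)) (proj₂ (proj₂ (extra-short (base g) qg))))) (λ ())
      off : ∀ g → g ≢ e → t g ≡ 0ℚ
      off g g≢e = cong (if_then Φ g else 0ℚ) (cong (_∧ q (base g)) (dec-false (g ≟ e) g≢e))
      at : t e ≡ (if q (base e) then Φ e else 0ℚ)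
      at = cong (if_then Φ e else 0ℚ) (cong (_∧ q (base e)) (dec-true (e ≟ e) refl))
      extra : ∑ n t ≡ (if q (base e) then Φ e else 0ℚ)
      extra with q (base e) in qe
      ... | true  = trans (∑-only n e t off e<n) (trans at (cong (if_then Φ e else 0ℚ) qe))
        where
        short = extra-short (base e) qe
        e<n : e < n
        e<n = <-≤-trans (m<m+n e (≤-trans (proj₁ short) (m≤m+n e 0))) (proj₁ (proj₂ short))
      ... | false = trans (∑-cong n all-zero) (∑-zero n)
        where
        all-zero : ∀ g → g < n → t g ≡ 0ℚ
        all-zero g _ with g ≟ e
        ... | yes refl = trans at (cong (if_then Φ e else 0ℚ) qe)
        ... | no  g≢e  = off g g≢e

    -- Both `g` and `n - g` would be at most n/2.
    antipodal : ∀ x g → isEdge g x ≡ true → ∀ y → isEdge ((n ∸ g) % n) y ≡ true → 2 * g ≡ n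
    antipodal x g a y b = ≤-antisym 2g≤n (ℕₚ.+-cancelˡ-≤ n n (2 * g) (begin
      n + n ≡⟨ cong (n +_) (sym (m+[n∸m]≡n g≤n)) ⟩
      n + (g + (n ∸ g)) ≡⟨ cong (_+ (g + (n ∸ g))) (sym (m+[n∸m]≡n g≤n)) ⟩
      g + (n ∸ g) + (g + (n ∸ g)) ≡⟨ double g (n ∸ g) ⟩
      2 * (n ∸ g) + 2 * g ≤⟨ +-monoˡ-≤ (2 * g) 2[n-g]≤n ⟩
      n + 2 * g              ∎))
      where
      open ℕₚ.≤-Reasoning
      1≤g = proj₁ (isEdge-half g x a)
      2g≤n = proj₂ (isEdge-half g x a)
      g≤n = <⇒≤ (isEdge-< g x a)
      2[n-g]≤n : 2 * (n ∸ g) ≤ n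
      2[n-g]≤n = subst (λ t → 2 * t ≤ n) (m<n⇒m%n≡m (∸-monoʳ-< 1≤g g≤n)) (proj₂ (isEdge-half ((n ∸ g) % n) y b))
      double : ∀ a b → a + b + (a + b) ≡ 2 * b + 2 * a
      double = ℕ-Solver.solve-∀

    -- Only an antipodal generator could join the same two vertices in both directions. The strict
    -- bound on the range and `extra-once` rule that out, so outgoing and incoming edges can be
    -- counted separately.
    directions-exclusive : ∀ x g → x < n → ¬ (isEdge g x ≡ true × isEdge ((n ∸ g) % n) ((x + g) % n) ≡ true)
    directions-exclusive x g x<n (a , b) with isEdge-elim g x a | isEdge-elim ((n ∸ g) % n) ((x + g) % n) b
    ... | inj₁ (_ , g<)    | _               = <-irrefl (antipodal x g a _ b) (range-half g<)
    ... | inj₂ (refl , qx) | inj₂ (_ , qy)   = extra-once x x<n qx qy (antipodal x g a _ b)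
    ... | inj₂ (refl , qx) | inj₁ (_ , n-g<) = <-irrefl 2g≡n (subst (λ t → 2 * t < n) reflected (range-half n-g<))
      where
      2g≡n = antipodal x g a _ b
      reflected : (n ∸ g) % n ≡ g
      reflected = trans (m<n⇒m%n≡m (∸-monoʳ-< (proj₁ (isEdge-half g x a)) (<⇒≤ (isEdge-< g x a))))
        (trans (cong (_∸ g) (trans (sym 2g≡n) (cong (g +_) (+-identityʳ g)))) (ℕₚ.m+n∸m≡n g g))

    -- Outgoing edges plus incoming ones; the extra generator arrives from `x - e`. The count is
    -- done in ℚ, where the sum lemmas are available, and the incoming part is reindexed by g ↦ n -
    -- g.
    degree-formula : ∀ x → degree x ≡ len + bit (q (toℕ x)) + (len + bit (q ((toℕ x + (n ∸ e)) % n)))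
    degree-formula x = fromℕ-injective (begin
      fromℕ (degree x)
        ≡⟨ trans (sumOver-const (neighbours x) 1ℚ) (ℚₚ.*-identityʳ (fromℕ (degree x))) ⟨
      sumOver (neighbours x) (λ _ → 1ℚ)
        ≡⟨ neighbour-sum x (λ _ → 1ℚ) ⟩
      ∑ n (λ g → if isEdge g X ∨ isEdge ((n ∸ g) % n) ((X + g) % n) then 1ℚ else 0ℚ)
        ≡⟨ ∑-cong n (λ g _ → if-∨ (isEdge g X) (isEdge ((n ∸ g) % n) ((X + g) % n)) 1ℚ (directions-exclusive X g (Finₚ.toℕ<n x))) ⟩
      ∑ n (λ g → (if isEdge g X then 1ℚ else 0ℚ) ⊕ (if isEdge ((n ∸ g) % n) ((X + g) % n) then 1ℚ else 0ℚ))
        ≡⟨ ∑-distrib-⊕ n (λ g → if isEdge g X then 1ℚ else 0ℚ) (λ g → if isEdge ((n ∸ g) % n) ((X + g) % n) then 1ℚ else 0ℚ) ⟩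
      ∑ n (λ g → if isEdge g X then 1ℚ else 0ℚ) ⊕ ∑ n (λ g → if isEdge ((n ∸ g) % n) ((X + g) % n) then 1ℚ else 0ℚ)
        ≡⟨ cong₂ _⊕_ (count (λ _ → X)) (trans (∑-cong n (λ g g<n → cong (λ t → if isEdge ((n ∸ g) % n) t then 1ℚ else 0ℚ) (back g g<n))) (trans (reflect (λ g → if isEdge g ((X + (n ∸ g)) % n) then 1ℚ else 0ℚ)) (count (λ g → (X + (n ∸ g)) % n)))) ⟩
      fromℕ (len + bit (q X)) ⊕ fromℕ (len + bit (q ((X + (n ∸ e)) % n)))
        ≡⟨ fromℕ-homo-+ (len + bit (q X)) _ ⟨
      fromℕ (len + bit (q X) + (len + bit (q ((X + (n ∸ e)) % n)))) ∎)
      where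
      open ≡-Reasoning
      X = toℕ x
      fromBit : ∀ b → (if b then 1ℚ else 0ℚ) ≡ fromℕ (bit b)
      fromBit true  = refl
      fromBit false = refl
      count : ∀ base → ∑ n (λ g → if isEdge g (base g) then 1ℚ else 0ℚ) ≡ fromℕ (len + bit (q (base e)))
      count base = trans (edge-sum base (λ _ → 1ℚ)) (trans (cong₂ _⊕_ (trans (∑-const len 1ℚ) (ℚₚ.*-identityʳ (fromℕ len))) (fromBit (q (base e)))) (sym (fromℕ-homo-+ len (bit (q (base e))))))
      back : ∀ g → g < n → (X + g) % n ≡ (X + (n ∸ (n ∸ g) % n)) % n
      back zero    _   = trans (cong (_% n) (+-identityʳ X)) (trans (sym ([m+n]%n≡m%n X n)) (cong (λ t → (X + (n ∸ t)) % n) (sym (n%n≡0 n))))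
      back (suc g) g<n = cong (λ t → (X + t) % n) (sym (trans (cong (n ∸_) (m<n⇒m%n≡m (∸-monoʳ-< (s≤s z≤n) (<⇒≤ g<n)))) (ℕₚ.m∸[m∸n]≡n (<⇒≤ g<n))))
      reflect : ∀ (Φ : ℕ → ℚ) → ∑ n (λ g → Φ ((n ∸ g) % n)) ≡ ∑ n Φ
      reflect Φ = begin
        ∑ n (λ g → Φ ((n ∸ g) % n)) ≡⟨ cong (λ k → ∑ k (λ g → Φ ((n ∸ g) % n))) (sym (suc-pred n)) ⟩
        ∑ (suc m) (λ g → Φ ((n ∸ g) % n)) ≡⟨ ∑-front m (λ g → Φ ((n ∸ g) % n)) ⟩
        Φ (n % n) ⊕ ∑ m (λ i → Φ ((n ∸ suc i) % n)) ≡⟨ cong₂ _⊕_ (cong Φ (n%n≡0 n)) (trans (∑-cong m (λ i i<m → cong Φ (shift i i<m))) (∑-reverse m (λ i → Φ (suc i)))) ⟩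
        Φ 0 ⊕ ∑ m (λ i → Φ (suc i)) ≡⟨ ∑-front m Φ ⟨
        ∑ (suc m) Φ ≡⟨ cong (λ k → ∑ k Φ) (suc-pred n) ⟩
        ∑ n Φ ∎
        where
        m = ℕ.pred n
        shift : ∀ i → i < m → (n ∸ suc i) % n ≡ suc (m ∸ suc i)
        shift i i<m = trans (m<n⇒m%n≡m (∸-monoʳ-< (s≤s z≤n) (≤-trans i<m (ℕₚ.pred[n]≤n {n}))))
          (trans (cong (_∸ suc i) (sym (suc-pred n))) (ℕₚ.+-∸-assoc 1 i<m))

    module _ (h : Fin n → ℚ) where

      lift : ℕ → ℚ
      lift i = h (fromℕ< (m%n<n i n))

      lift-% : ∀ i → lift (i % n) ≡ lift i
      lift-% i = cong h (Finₚ.fromℕ<-cong (i % n % n) (i % n) (m%n%n≡m%n i n) _ _)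

      lift-periodic : ∀ i → lift (i + n) ≡ lift i
      lift-periodic i = cong h (Finₚ.fromℕ<-cong ((i + n) % n) (i % n) ([m+n]%n≡m%n i n) _ _)

      lift-toℕ : ∀ x → lift (toℕ x) ≡ h x
      lift-toℕ x = cong h (trans (Finₚ.fromℕ<-cong (toℕ x % n) (toℕ x) (m<n⇒m%n≡m (Finₚ.toℕ<n x)) _ (Finₚ.toℕ<n x)) (Finₚ.fromℕ<-toℕ x (Finₚ.toℕ<n x)))

      open Periodic n lift lift-periodic

      edgeEnergy : ℚ
      edgeEnergy = ∑ len (λ i → energy (lo + i)) ⊕ ∑ n (λ x → if q x then energyAt e x else 0ℚ)

      -- The Dirichlet form sees each edge from both ends; keeping only the end at which its
      -- generator starts leaves `edgeEnergy`.
      dirichlet-≽ : ∀ degree-pos → edgeEnergy ≼ Walk.dirichlet graph degree-pos h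
      dirichlet-≽ degree-pos = begin
        edgeEnergy
          ≡⟨ cong (_⊕ ∑ n (λ x → if q x then energyAt e x else 0ℚ)) (∑-swap len n (λ i → energyAt (lo + i))) ⟩
        ∑ n (λ x → ∑ len (λ i → energyAt (lo + i) x)) ⊕ ∑ n (λ x → if q x then energyAt e x else 0ℚ)
          ≡⟨ ∑-distrib-⊕ n _ _ ⟨
        ∑ n (λ x → ∑ len (λ i → energyAt (lo + i) x) ⊕ (if q x then energyAt e x else 0ℚ))
          ≡⟨ ∑-cong n (λ x _ → edge-sum (λ _ → x) (λ g → energyAt g x)) ⟨
        ∑ n (λ x → ∑ n (λ g → if isEdge g x then energyAt g x else 0ℚ))
          ≤⟨ ∑-mono n (λ x _ → ∑-mono n (λ g _ → if-∨-≽ (isEdge g x) (isEdge ((n ∸ g) % n) ((x + g) % n)) (energyAt-nonNeg g x))) ⟩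
        ∑ n (λ x → ∑ n (λ g → if isEdge g x ∨ isEdge ((n ∸ g) % n) ((x + g) % n) then energyAt g x else 0ℚ))
          ≡⟨ sumOver-tabulate n (λ x → x) _ _ local ⟨
        Walk.dirichlet graph degree-pos h ∎
        where
        open ℚₚ.≤-Reasoning
        flip : ∀ a b → (a ⊖ b) ⊗ (a ⊖ b) ≡ (b ⊖ a) ⊗ (b ⊖ a)
        flip = solve-∀ ℚ-ring
        local : ∀ x → sumOver (neighbours x) (λ y → sq (h x ⊖ h y)) ≡
          ∑ n (λ g → if isEdge g (toℕ x) ∨ isEdge ((n ∸ g) % n) ((toℕ x + g) % n) then energyAt g (toℕ x) else 0ℚ)
        local x = trans (sumOver-cong (neighbours x) (λ y → cong₂ (λ s t → sq (s ⊖ t)) (sym (lift-toℕ x)) (sym (lift-toℕ y))))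
          (trans (neighbour-sum x (λ i → sq (lift (toℕ x) ⊖ lift i)))
          (∑-cong n (λ g _ → cong (if isEdge g (toℕ x) ∨ isEdge ((n ∸ g) % n) ((toℕ x + g) % n) then_else 0ℚ)
            (trans (cong (λ t → sq (lift (toℕ x) ⊖ t)) (lift-% (toℕ x + g))) (flip (lift (toℕ x)) (lift (toℕ x + g)))))))

-- Cyclic distance

cyclicNorm : (h : ℕ) {{_ : NonZero h}} → ℕ → ℕ
cyclicNorm h z = z % h ⊓ (h ∸ z % h)

suc-% : ∀ h {{_ : NonZero h}} z → (suc (z % h) < h × suc z % h ≡ suc (z % h)) ⊎ (suc (z % h) ≡ h × suc z % h ≡ 0)
suc-% h z = cases (suc (z % h) <? h)
  where
  step : suc z % h ≡ suc (z % h) % h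
  step = trans (cong (_% h) (+-comm 1 z)) (trans (sym ([m%n+o]%n≡[m+o]%n h z 1)) (cong (_% h) (+-comm (z % h) 1)))
  cases : Dec (suc (z % h) < h) → (suc (z % h) < h × suc z % h ≡ suc (z % h)) ⊎ (suc (z % h) ≡ h × suc z % h ≡ 0)
  cases (yes r<h) = inj₁ (r<h , trans step (m<n⇒m%n≡m r<h))
  cases (no  r≮h) = inj₂ (full , trans step (trans (cong (_% h) full) (n%n≡0 h)))
    where
    full : suc (z % h) ≡ h
    full = ≤-antisym (m%n<n z h) (≮⇒≥ r≮h)

cyclicNorm-suc : ∀ h {{_ : NonZero h}} z → cyclicNorm h (suc z) ≤ suc (cyclicNorm h z) × cyclicNorm h z ≤ suc (cyclicNorm h (suc z))
cyclicNorm-suc h z with suc-% h z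
... | inj₁ (r<h , eq) rewrite eq =
    ℕₚ.⊓-mono-≤ (≤-refl {suc (z % h)}) (≤-trans (ℕₚ.∸-monoʳ-≤ h (n≤1+n (z % h))) (n≤1+n _))
  , ℕₚ.⊓-mono-≤ (≤-trans (n≤1+n (z % h)) (n≤1+n _)) (≤-reflexive (ℕₚ.+-∸-assoc 1 (<⇒≤ r<h)))
... | inj₂ (full , eq) rewrite eq =
    z≤n
  , ≤-trans (ℕₚ.m⊓n≤n (z % h) (h ∸ z % h)) (≤-trans (≤-reflexive (trans (cong (_∸ z % h) (sym full)) (ℕₚ.m+n∸n≡m 1 (z % h)))) (s≤s z≤n))

cyclicNorm-+ : ∀ h {{_ : NonZero h}} z g → cyclicNorm h (z + g) ≤ cyclicNorm h z + g × cyclicNorm h z ≤ cyclicNorm h (z + g) + g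
cyclicNorm-+ h z zero    rewrite +-identityʳ z | +-identityʳ (cyclicNorm h z) = ≤-refl , ≤-refl
cyclicNorm-+ h z (suc g) rewrite +-suc z g =
    ≤-trans (proj₁ step) (≤-trans (s≤s (proj₁ rest)) (≤-reflexive (sym (+-suc (cyclicNorm h z) g))))
  , ≤-trans (proj₂ rest) (≤-trans (+-monoˡ-≤ g (proj₂ step)) (≤-reflexive (sym (+-suc (cyclicNorm h (suc (z + g))) g))))
  where
  step = cyclicNorm-suc h (z + g)
  rest = cyclicNorm-+ h z g

cyclicNorm-% : ∀ h {{_ : NonZero h}} n {{_ : NonZero n}} z → h ∣ n → cyclicNorm h (z % n) ≡ cyclicNorm h z
cyclicNorm-% h n z h∣n = cong (λ t → t ⊓ (h ∸ t)) (m∣n⇒o%n%m≡o%m h n z h∣n)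

cyclicNorm-period : ∀ h {{_ : NonZero h}} z → cyclicNorm h (z + h) ≡ cyclicNorm h z
cyclicNorm-period h z = cong (λ t → t ⊓ (h ∸ t)) ([m+n]%n≡m%n z h)

cyclicNorm-small : ∀ h {{_ : NonZero h}} r → 1 ≤ r → r + r ≤ h → cyclicNorm h r ≡ r
cyclicNorm-small h r 1≤r 2r≤h = trans (cong (λ t → t ⊓ (h ∸ t)) (m<n⇒m%n≡m (<-≤-trans (m<m+n r 1≤r) 2r≤h))) (ℕₚ.m≤n⇒m⊓n≡m (ℕₚ.m+n≤o⇒m≤o∸n r 2r≤h))

ceiling-exists : ∀ K → 1 ≤ K → ∀ ρ → ∃[ j ] ρ ≤ j * K × j * K < ρ + K
ceiling-exists K 1≤K zero    = 0 , z≤n , 1≤K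
ceiling-exists K 1≤K (suc ρ) with ceiling-exists K 1≤K ρ
... | j , ρ≤ , <ρ+K with suc ρ ≤? j * K
...   | yes 1+ρ≤ = j , 1+ρ≤ , m<n⇒m<1+n <ρ+K
...   | no  1+ρ≰ = suc j , ≤-trans (+-mono-≤ 1≤K ρ≤) ≤-refl , ≤-trans (s≤s (≤-reflexive (trans (+-comm K (j * K)) (cong (_+ K) (sym ρ≡))))) ≤-refl
  where
  ρ≡ : ρ ≡ j * K
  ρ≡ = ≤-antisym ρ≤ (ℕ.s≤s⁻¹ (≰⇒> 1+ρ≰))

-- Opaque so that the numerical constants below are never evaluated.
opaque
  coefficient : ℕ → ℕ → ℕ → ℕ → ℕ
  coefficient κ A L Q = 48 * κ * A * (L + Q + 5)

  -- The left side is the cover time bound 2H(ℓ + 1 + 2) with H = 2H₀, H₀ = 2RnA and R = 6κ(L + Q +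
  -- 5); thus 48 = 2·2·2·6.
  coefficient-≡ : ∀ κ A L Q n ℓ → 2 * (2 * (2 * (κ * (6 * (L + Q + 5)) * (n * A)))) * (suc ℓ + 2) ≡ coefficient κ A L Q * (ℓ + 3) * n
  coefficient-≡ κ A L Q n ℓ = shape κ (L + Q + 5) n A ℓ
    where
    shape : ∀ κ t n A ℓ → 2 * (2 * (2 * (κ * (6 * t) * (n * A)))) * (suc ℓ + 2) ≡ 48 * κ * A * t * (ℓ + 3) * n
    shape = ℕ-Solver.solve-∀

  -- Trades the number `L` of doublings for one factor `ℓ`, which becomes the second logarithm of
  -- the sparse case.
  coefficient-linear : ∀ κ A L Q ℓ → L ≤ ℓ → 1 ≤ ℓ → coefficient κ A L Q ≤ coefficient κ A 1 Q * ℓ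
  coefficient-linear κ A L Q ℓ L≤ℓ 1≤ℓ = ≤-trans (*-monoʳ-≤ (48 * κ * A) bound) (≤-reflexive (sym (ℕₚ.*-assoc (48 * κ * A) (1 + Q + 5) ℓ)))
    where
    open ℕₚ.≤-Reasoning
    shape : ∀ Q ℓ → ℓ + (Q + 5) * ℓ ≡ (1 + Q + 5) * ℓ
    shape = ℕ-Solver.solve-∀
    bound : L + Q + 5 ≤ (1 + Q + 5) * ℓ
    bound = begin
      L + Q + 5 ≡⟨ +-assoc L Q 5 ⟩
      L + (Q + 5) ≡⟨ cong (L +_) (sym (*-identityʳ (Q + 5))) ⟩
      L + (Q + 5) * 1 ≤⟨ +-mono-≤ L≤ℓ (*-monoʳ-≤ (Q + 5) 1≤ℓ) ⟩
      ℓ + (Q + 5) * ℓ ≡⟨ shape Q ℓ ⟩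
      (1 + Q + 5) * ℓ ∎

-- From the oscillation inequality to the ratio

module RatioBound (n : ℕ) {{_ : NonZero n}} (lo len e : ℕ) (q : ℕ → Bool)
  (1≤lo : 1 ≤ lo) (range-short : 2 * (lo + len) ≤ suc n)
  (extra-short : ∀ x → q x ≡ true → 1 ≤ e × 2 * e ≤ n × Circulant.inRange n lo len e q e ≡ false)
  (extra-once : ∀ x → x < n → q x ≡ true → q ((x + e) % n) ≡ true → 2 * e ≢ n)
  (linked : ∀ x y → toℕ y ≡ suc (toℕ x) → Star (Circulant.Adj n lo len e q) x y)
  where
  open Circulant n lo len e q public
  open Valid 1≤lo range-short extra-short extra-once linked public
  open Graph graph using (degree)

  -- Three groups of parameters. For the oscillation: `c`, `m`, `L`, `Q`, and the loss `κ` in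
  -- passing from the family m, ..., m + c to the actual edges. For the cover time: `A`, bounding
  -- the degrees in units of `c`, and `ℓ` close to log₂ n. For the broadcast: steps have length at
  -- most `K` or exactly `h`, distances are taken modulo `h`, and some vertex is at distance
  -- `r ≥ n / S`.
  module Bound (Δ c m L Q κ A h r S K ℓ : ℕ) {{_ : NonZero h}}
    (degree-pos : ∀ v → 1 ≤ degree v) (degree≤Δ : ∀ v → degree v ≤ Δ) (Δ≤Ac : Δ ≤ A * c)
    (1≤c : 1 ≤ c) (c≤m : c ≤ m) (m≡ : m ≡ 2 ^ L * c) (span : 2 ^ L * m ≤ n) (n≤Qm² : n ≤ Q * (m * m))
    (1≤κ : 1 ≤ κ) (1≤A : 1 ≤ A)
    (compare : ∀ f → Periodic.Spread.totalEnergy n (lift f) (lift-periodic f) c m 1≤c c≤m ≼ fromℕ κ ⊗ edgeEnergy f)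
    (h∣n : h ∣ n) (h≤n : h ≤ n) (1≤K : 1 ≤ K) (short : ∀ g x → isEdge g x ≡ true → g ≤ K ⊎ g ≡ h)
    (1≤r : 1 ≤ r) (2r≤h : r + r ≤ h) (n≤Sr : n ≤ S * r) (n≤2^ : n ≤ 2 ^ suc ℓ)
    where

    R : ℕ
    R = κ * (6 * (L + Q + 5))

    oscillation-≤ : ∀ f u v → toℕ u ≤ toℕ v → fromℕ c ⊗ sq (f u ⊖ f v) ≼ fromℕ R ⊗ Walk.dirichlet graph degree-pos f
    oscillation-≤ f u v u≤v = begin
      fromℕ c ⊗ sq (f u ⊖ f v) ≡⟨ cong₂ (λ s t → fromℕ c ⊗ sq (s ⊖ t)) (sym (lift-toℕ f u)) (sym (trans (cong (lift f) (m+[n∸m]≡n u≤v)) (lift-toℕ f v))) ⟩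
      fromℕ c ⊗ sq (lift f (toℕ u) ⊖ lift f (toℕ u + (toℕ v ∸ toℕ u)))
        ≤⟨ Periodic.Spread.oscillation n (lift f) (lift-periodic f) c m 1≤c c≤m L Q (toℕ u) (toℕ v ∸ toℕ u) m≡ span n≤Qm² (≤-trans (m∸n≤m (toℕ v) (toℕ u)) (<⇒≤ (Finₚ.toℕ<n v))) ⟩
      fromℕ (6 * (L + Q + 5)) ⊗ Periodic.Spread.totalEnergy n (lift f) (lift-periodic f) c m 1≤c c≤m
        ≤⟨ ⊗-monoʳ (fromℕ-nonNeg (6 * (L + Q + 5))) (≼-trans (compare f) (⊗-monoʳ (fromℕ-nonNeg κ) (dirichlet-≽ f degree-pos))) ⟩
      fromℕ (6 * (L + Q + 5)) ⊗ (fromℕ κ ⊗ D) ≡⟨ regroup (fromℕ (6 * (L + Q + 5))) (fromℕ κ) D ⟩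
      fromℕ κ ⊗ fromℕ (6 * (L + Q + 5)) ⊗ D ≡⟨ cong (_⊗ D) (sym (fromℕ-homo-* κ (6 * (L + Q + 5)))) ⟩
      fromℕ R ⊗ D ∎
      where
      open ℚₚ.≤-Reasoning
      D = Walk.dirichlet graph degree-pos f
      regroup : ∀ a b c → a ⊗ (b ⊗ c) ≡ b ⊗ a ⊗ c
      regroup = solve-∀ ℚ-ring

    oscillation : ∀ f u v → fromℕ c ⊗ sq (f u ⊖ f v) ≼ fromℕ R ⊗ Walk.dirichlet graph degree-pos f
    oscillation f u v with ℕₚ.≤-total (toℕ u) (toℕ v)
    ... | inj₁ u≤v = oscillation-≤ f u v u≤v
    ... | inj₂ v≤u = ≼-trans (≼-reflexive (cong (fromℕ c ⊗_) (flip (f u) (f v)))) (oscillation-≤ f v u v≤u)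
      where
      flip : ∀ a b → (a ⊖ b) ⊗ (a ⊖ b) ≡ (b ⊖ a) ⊗ (b ⊖ a)
      flip = solve-∀ ℚ-ring

    open Walk.HittingBound graph degree-pos Δ c R A 1≤c degree≤Δ Δ≤Ac oscillation

    1≤n : 1 ≤ n
    1≤n = ℕ.>-nonZero⁻¹ n

    1≤H₀ : 1 ≤ H₀
    1≤H₀ = *-mono-≤ {1} {2} (s≤s z≤n) (*-mono-≤ {1} {R} (*-mono-≤ {1} {κ} 1≤κ (*-mono-≤ {1} {6} (s≤s z≤n) (≤-trans (s≤s z≤n) (m≤n+m 5 (L + Q))))) (*-mono-≤ 1≤n 1≤A))

    COVfrom-bound : ∀ s N → COVfrom graph s N ≼ fromℕ (2 * (2 * H₀) * (suc ℓ + 2))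
    COVfrom-bound = Cover.COVfrom≼ graph degree-pos (2 * H₀) (≤-trans 1≤H₀ (m≤m+n H₀ _)) potential potential-nonNeg potential-bounded (λ v → potential-drift 1≤H₀ v) (suc ℓ) n≤2^

    -- The distance to the nearest multiple of `h`. As `h` divides `n` it is well defined on
    -- residues, and a step of length `h` leaves it unchanged; this keeps antipodal edges from
    -- shortening the distances.
    ρ : Fin n → ℕ
    ρ x = cyclicNorm h (toℕ x)

    ρ-step : ∀ {x y : Fin n} g → isEdge g (toℕ x) ≡ true → toℕ y ≡ (toℕ x + g) % n → ρ y ≤ ρ x + K × ρ x ≤ ρ y + K
    ρ-step {x} {y} g edge y≡ with short g (toℕ x) edge
    ... | inj₁ g≤K rewrite trans (cong (cyclicNorm h) y≡) (cyclicNorm-% h n (toℕ x + g) h∣n) =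
        ≤-trans (proj₁ (cyclicNorm-+ h (toℕ x) g)) (+-monoʳ-≤ (ρ x) g≤K) , ≤-trans (proj₂ (cyclicNorm-+ h (toℕ x) g)) (+-monoʳ-≤ (cyclicNorm h (toℕ x + g)) g≤K)
    ... | inj₂ refl rewrite trans (cong (cyclicNorm h) y≡) (trans (cyclicNorm-% h n (toℕ x + h) h∣n) (cyclicNorm-period h (toℕ x))) = m≤m+n (ρ x) K , m≤m+n (ρ x) K

    lipschitz : ∀ {x y} → Adj x y → ρ y ≤ ρ x + K
    lipschitz {x} {y} x~y with Adj-elim {x} {y} x~y
    ... | inj₁ (g , edge , y≡) = proj₁ (ρ-step {x} {y} g edge y≡)
    ... | inj₂ (g , edge , x≡) = proj₂ (ρ-step {y} {x} g edge x≡)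

    j : ℕ
    j = proj₁ (ceiling-exists K 1≤K r)

    r≤jK : r ≤ j * K
    r≤jK = proj₁ (proj₂ (ceiling-exists K 1≤K r))

    1≤j : 1 ≤ j
    1≤j = ℕₚ.n≢0⇒n>0 (λ j≡0 → <-irrefl refl (<-≤-trans 1≤r (≤-trans r≤jK (≤-reflexive (cong (_* K) j≡0)))))

    r<n : r < n
    r<n = <-≤-trans (m<m+n r 1≤r) (≤-trans 2r≤h h≤n)

    RBAfrom-bound : ∀ N → j ≤ N → fromℕ j ≼ RBAfrom graph (fromℕ< 1≤n) N
    RBAfrom-bound N j≤N = Broadcast.RBAfrom≽ graph degree-pos ρ K (λ {x} {y} → lipschitz {x} {y}) (fromℕ< 1≤n) (fromℕ< r<n) j N
      (trans (cong (cyclicNorm h) (Finₚ.toℕ-fromℕ< 1≤n)) (cong (λ t → t ⊓ (h ∸ t)) (m<n⇒m%n≡m (ℕ.>-nonZero⁻¹ h))))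
      j≤N (subst (λ t → j * K < t + K) (sym (trans (cong (cyclicNorm h) (Finₚ.toℕ-fromℕ< r<n)) (cyclicNorm-small h r 1≤r 2r≤h))) (proj₂ (proj₂ (ceiling-exists K 1≤K r))))

    ratio : ℕ
    ratio = coefficient κ A L Q * (ℓ + 3) * (S * K)

    ℛ-bound : ∀ N → j ≤ N → ℛ graph N ≼ fromℕ ratio
    ℛ-bound N j≤N = ℛ-≼ graph _ j ratio N (λ s → COVfrom-bound s N) (fromℕ< 1≤n) (RBAfrom-bound N j≤N) 1≤j (begin
      2 * (2 * H₀) * (suc ℓ + 2) ≡⟨ coefficient-≡ κ A L Q n ℓ ⟩
      coefficient κ A L Q * (ℓ + 3) * n ≤⟨ *-monoʳ-≤ (coefficient κ A L Q * (ℓ + 3)) (≤-trans n≤Sr (*-monoʳ-≤ S r≤jK)) ⟩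
      coefficient κ A L Q * (ℓ + 3) * (S * (j * K)) ≡⟨ regroup (coefficient κ A L Q * (ℓ + 3)) S j K ⟩
      ratio * j                                                  ∎)
      where
      open ℕₚ.≤-Reasoning
      regroup : ∀ a S j K → a * (S * (j * K)) ≡ a * (S * K) * j
      regroup = ℕ-Solver.solve-∀

    ℛ-≤ᴿ : ∀ (y : Real) → (∀ N → fromℕ ratio ≼ y N) → ℛ graph ≤ᴿ y
    -- The threshold is `j` because the broadcast time truncated at N is at most N and can reach the
    -- lower bound `j` only for N ≥ j.
    ℛ-≤ᴿ y ratio≤y η 0<η = j , λ N j≤N → ≼-trans (ℛ-bound N j≤N) (≼-trans (ratio≤y N) (a≼a⊕b (ℚₚ.<⇒≤ 0<η)))

-- Comparison of Dirichlet forms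

sq-⊕ : ∀ a b → sq (a ⊕ b) ≼ (1ℚ ⊕ 1ℚ) ⊗ (sq a ⊕ sq b)
sq-⊕ a b = ≼-by-difference (sq-nonNeg (a ⊖ b)) (eq a b)
  where
  eq : ∀ a b → (1ℚ ⊕ 1ℚ) ⊗ (a ⊗ a ⊕ b ⊗ b) ≡ (a ⊕ b) ⊗ (a ⊕ b) ⊕ (a ⊖ b) ⊗ (a ⊖ b)
  eq = solve-∀ ℚ-ring

sq-⊕₃ : ∀ a b c → sq (a ⊕ b ⊕ c) ≼ (1ℚ ⊕ 1ℚ ⊕ 1ℚ) ⊗ (sq a ⊕ sq b ⊕ sq c)
sq-⊕₃ a b c = ≼-by-difference (⊕-nonNeg (⊕-nonNeg (sq-nonNeg (a ⊖ b)) (sq-nonNeg (b ⊖ c))) (sq-nonNeg (a ⊖ c))) (eq a b c)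
  where
  eq : ∀ a b c → (1ℚ ⊕ 1ℚ ⊕ 1ℚ) ⊗ (a ⊗ a ⊕ b ⊗ b ⊕ c ⊗ c) ≡ (a ⊕ b ⊕ c) ⊗ (a ⊕ b ⊕ c) ⊕ ((a ⊖ b) ⊗ (a ⊖ b) ⊕ (b ⊖ c) ⊗ (b ⊖ c) ⊕ (a ⊖ c) ⊗ (a ⊖ c))
  eq = solve-∀ ℚ-ring

module EnergyComparison (n : ℕ) (f : ℕ → ℚ) (periodic : ∀ x → f (x + n) ≡ f x) where
  open Periodic n f periodic

  sum-of-energies : ∀ a b g g′ → ∑ n (λ x → (1ℚ ⊕ 1ℚ) ⊗ (energyAt g (a + x) ⊕ energyAt g′ (b + x))) ≡ (1ℚ ⊕ 1ℚ) ⊗ (energy g ⊕ energy g′)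
  sum-of-energies a b g g′ = trans (∑-distribˡ-⊗ n (1ℚ ⊕ 1ℚ) _) (cong ((1ℚ ⊕ 1ℚ) ⊗_) (trans (∑-distrib-⊕ n _ _) (cong₂ _⊕_ (energy-shift g a) (energy-shift g′ b))))

  energy-+ : ∀ g g′ → energy (g + g′) ≼ (1ℚ ⊕ 1ℚ) ⊗ (energy g ⊕ energy g′)
  energy-+ g g′ = ≼-trans (∑-mono n local) (≼-reflexive (sum-of-energies 0 g g g′))
    where
    chain : ∀ a b c → c ⊖ a ≡ (b ⊖ a) ⊕ (c ⊖ b)
    chain = solve-∀ ℚ-ring
    local : ∀ x → x < n → energyAt (g + g′) x ≼ (1ℚ ⊕ 1ℚ) ⊗ (energyAt g x ⊕ energyAt g′ (g + x))
    local x _ = ≼-trans (≼-reflexive (cong sq (trans (chain (f x) (f (x + g)) (f (x + (g + g′))))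
        (cong (Δ g x ⊕_) (cong₂ (λ s t → f s ⊖ f t) (trans (sym (+-assoc x g g′)) (cong (_+ g′) (+-comm x g))) (+-comm x g))))))
      (sq-⊕ (Δ g x) (Δ g′ (g + x)))

  energy-cancel : ∀ g g′ → energy g ≼ (1ℚ ⊕ 1ℚ) ⊗ (energy (g + g′) ⊕ energy g′)
  energy-cancel g g′ = ≼-trans (∑-mono n local) (≼-reflexive (sum-of-energies 0 g (g + g′) g′))
    where
    chain : ∀ a b c → b ⊖ a ≡ (c ⊖ a) ⊕ (⊖ (c ⊖ b))
    chain = solve-∀ ℚ-ring
    local : ∀ x → x < n → energyAt g x ≼ (1ℚ ⊕ 1ℚ) ⊗ (energyAt (g + g′) x ⊕ energyAt g′ (g + x))
    local x _ = ≼-trans (≼-reflexive (cong sq (trans (chain (f x) (f (x + g)) (f (x + (g + g′))))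
        (cong (λ t → Δ (g + g′) x ⊕ ⊖ t) (cong₂ (λ s t → f s ⊖ f t) (trans (sym (+-assoc x g g′)) (cong (_+ g′) (+-comm x g))) (+-comm x g))))))
      (≼-trans (sq-⊕ (Δ (g + g′) x) (⊖ Δ g′ (g + x))) (≼-reflexive (cong (λ t → (1ℚ ⊕ 1ℚ) ⊗ (energyAt (g + g′) x ⊕ t)) (sq-neg (Δ g′ (g + x))))))

  unit-steps : ∀ w i x → i ≤ w → energyAt i x ≼ fromℕ w ⊗ ∑ w (λ s → energyAt 1 (x + s))
  unit-steps w i x i≤w = begin
    energyAt i x ≡⟨ cong (λ t → sq (f (x + i) ⊖ f t)) (sym (+-identityʳ x)) ⟩
    sq (f (x + i) ⊖ f (x + 0)) ≡⟨ cong sq (sym (∑-telescope i (λ s → f (x + s)))) ⟩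
    sq (∑ i (λ s → f (x + suc s) ⊖ f (x + s))) ≡⟨ cong sq (∑-cong i (λ s _ → cong (λ t → f t ⊖ f (x + s)) (trans (+-suc x s) (+-comm 1 (x + s))))) ⟩
    sq (∑ i (λ s → Δ 1 (x + s))) ≤⟨ sq-∑ i (λ s → Δ 1 (x + s)) ⟩
    fromℕ i ⊗ ∑ i (λ s → energyAt 1 (x + s)) ≤⟨ ⊗-mono (fromℕ-nonNeg i) (∑-nonNeg w (λ s → energyAt-nonNeg 1 (x + s))) (fromℕ-mono i≤w) (∑-prefix (λ s → energyAt 1 (x + s)) (λ s → energyAt-nonNeg 1 (x + s)) i≤w) ⟩
    fromℕ w ⊗ ∑ w (λ s → energyAt 1 (x + s)) ∎
    where open ℚₚ.≤-Reasoning

  unit-steps-total : ∀ w a → ∑ n (λ x → fromℕ w ⊗ ∑ w (λ s → energyAt 1 (a + x + s))) ≡ fromℕ (w * w) ⊗ energy 1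
  unit-steps-total w a = begin
    ∑ n (λ x → fromℕ w ⊗ ∑ w (λ s → energyAt 1 (a + x + s))) ≡⟨ ∑-distribˡ-⊗ n (fromℕ w) _ ⟩
    fromℕ w ⊗ ∑ n (λ x → ∑ w (λ s → energyAt 1 (a + x + s))) ≡⟨ cong (fromℕ w ⊗_) (∑-swap n w (λ x s → energyAt 1 (a + x + s))) ⟩
    fromℕ w ⊗ ∑ w (λ s → ∑ n (λ x → energyAt 1 (a + x + s))) ≡⟨ cong (fromℕ w ⊗_) (∑-cong w (λ s _ → trans (∑-cong n (λ x _ → cong (energyAt 1) (swap-right a x s))) (energy-shift 1 (a + s)))) ⟩
    fromℕ w ⊗ ∑ w (λ s → energy 1) ≡⟨ cong (fromℕ w ⊗_) (∑-const w (energy 1)) ⟩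
    fromℕ w ⊗ (fromℕ w ⊗ energy 1) ≡⟨ ℚₚ.*-assoc (fromℕ w) (fromℕ w) (energy 1) ⟨
    fromℕ w ⊗ fromℕ w ⊗ energy 1 ≡⟨ cong (_⊗ energy 1) (sym (fromℕ-homo-* w w)) ⟩
    fromℕ (w * w) ⊗ energy 1 ∎
    where open ≡-Reasoning

  energy-unit-steps : ∀ w i → i ≤ w → energy i ≼ fromℕ (w * w) ⊗ energy 1
  energy-unit-steps w i i≤w = ≼-trans (∑-mono n (λ x _ → unit-steps w i x i≤w)) (≼-reflexive (unit-steps-total w 0))

  -- The family is c, ..., 2c, and all but its last generator lie among 1, ..., k. The generator 2c
  -- may be missing and is replaced by two steps of length c: 1 + 2·2 = 5.
  compare-short-range : ∀ c′ k → c′ + suc c′ ≤ k → let c = suc c′ in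
    ∑ (suc c) (λ j → energy (c + j)) ≼ fromℕ 5 ⊗ ∑ k (λ i → energy (1 + i))
  compare-short-range c′ k fits = begin
    ∑ c (λ j → energy (c + j)) ⊕ energy (c + c) ≤⟨ ⊕-mono (∑-range (λ i → energy (1 + i)) (λ i → energy-nonNeg (1 + i)) c′ fits) (≼-trans (energy-+ c c) (⊗-monoʳ (fromℕ-nonNeg 2) (⊕-mono energy-c energy-c))) ⟩
    P ⊕ (1ℚ ⊕ 1ℚ) ⊗ (P ⊕ P) ≡⟨ collect P ⟩
    (1ℚ ⊕ 1ℚ ⊕ 1ℚ ⊕ 1ℚ ⊕ 1ℚ) ⊗ P ∎
    where
    open ℚₚ.≤-Reasoning
    c = suc c′
    P = ∑ k (λ i → energy (1 + i))
    energy-c : energy c ≼ P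
    energy-c = ∑-term (λ i → energy (1 + i)) (λ i → energy-nonNeg (1 + i)) c′ (≤-trans (m≤n+m c c′) fits)
    collect : ∀ P → P ⊕ (1ℚ ⊕ 1ℚ) ⊗ (P ⊕ P) ≡ (1ℚ ⊕ 1ℚ ⊕ 1ℚ ⊕ 1ℚ ⊕ 1ℚ) ⊗ P
    collect = solve-∀ ℚ-ring

  -- The missing edge from 0 to m is replaced by the path 0, m + 1, 2 m + 1, m.
  compare-missing-edge : ∀ c m → 1 ≤ c → suc m < n →
    ∑ (suc c) (λ j → energy (m + j)) ≼ fromℕ 7 ⊗ (∑ c (λ i → energy (suc m + i)) ⊕ ∑ n (λ x → if not (does (x ≟ 0)) then energyAt m x else 0ℚ))
  compare-missing-edge c m 1≤c 1+m<n = begin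
    ∑ (suc c) (λ j → energy (m + j)) ≡⟨ ∑-front c (λ j → energy (m + j)) ⟩
    energy (m + 0) ⊕ ∑ c (λ i → energy (m + suc i)) ≡⟨ cong₂ _⊕_ (cong energy (+-identityʳ m)) (∑-cong c (λ i _ → cong energy (+-suc m i))) ⟩
    energy m ⊕ P ≤⟨ ⊕-monoˡ P energy-m ⟩
    energyAt m 0 ⊕ X ⊕ P ≤⟨ ⊕-monoˡ P (⊕-monoˡ X detour) ⟩
    -- `P` occurs 3 + 3 + 1 = 7 times and `X` only 3 + 1 = 4 times; the latter is raised to 7.
    (1ℚ ⊕ 1ℚ ⊕ 1ℚ) ⊗ (P ⊕ X ⊕ P) ⊕ X ⊕ P ≤⟨ ≼-by-difference (⊗-nonNeg (fromℕ-nonNeg 3) X-nonNeg) (collect P X) ⟩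
    (1ℚ ⊕ 1ℚ ⊕ 1ℚ ⊕ 1ℚ ⊕ 1ℚ ⊕ 1ℚ ⊕ 1ℚ) ⊗ (P ⊕ X) ∎
    where
    open ℚₚ.≤-Reasoning
    P = ∑ c (λ i → energy (suc m + i))
    t : ℕ → ℚ
    t x = if not (does (x ≟ 0)) then energyAt m x else 0ℚ
    X = ∑ n t
    t-nonNeg : ∀ x → 0ℚ ≼ t x
    t-nonNeg zero    = ≼-refl
    t-nonNeg (suc x) = energyAt-nonNeg m (suc x)
    X-nonNeg : 0ℚ ≼ X
    X-nonNeg = ∑-nonNeg n t-nonNeg
    split-zero : ∀ k → ∑ k (energyAt m) ≼ energyAt m 0 ⊕ ∑ k t
    split-zero zero          = ≼-trans (energyAt-nonNeg m 0) (≼-reflexive (sym (ℚₚ.+-identityʳ (energyAt m 0))))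
    split-zero (suc zero)    = ≼-reflexive (ℚₚ.+-comm 0ℚ (energyAt m 0))
    split-zero (suc (suc k)) = ≼-trans (⊕-monoˡ (energyAt m (suc k)) (split-zero (suc k))) (≼-reflexive (ℚₚ.+-assoc (energyAt m 0) (∑ (suc k) t) (energyAt m (suc k))))
    energy-m : energy m ≼ energyAt m 0 ⊕ X
    energy-m = split-zero n
    energy-1+m : energy (suc m) ≼ P
    energy-1+m = ≼-trans (≼-reflexive (cong energy (sym (+-identityʳ (suc m))))) (∑-term (λ i → energy (suc m + i)) (λ i → energy-nonNeg (suc m + i)) 0 1≤c)
    at-point : ∀ x → x < n → energyAt (suc m) x ≼ P
    at-point x x<n = ≼-trans (∑-term (energyAt (suc m)) (energyAt-nonNeg (suc m)) x x<n) energy-1+m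
    chain : ∀ a b c d → b ⊖ a ≡ (c ⊖ a) ⊕ (d ⊖ c) ⊕ ⊖ (d ⊖ b)
    chain = solve-∀ ℚ-ring
    detour : energyAt m 0 ≼ (1ℚ ⊕ 1ℚ ⊕ 1ℚ) ⊗ (P ⊕ X ⊕ P)
    detour = begin
      energyAt m 0 ≡⟨ cong sq (trans (chain (f 0) (f m) (f (suc m)) (f (suc m + m))) (cong (λ k → Δ (suc m) 0 ⊕ Δ m (suc m) ⊕ ⊖ (f k ⊖ f m)) (sym (+-suc m m)))) ⟩
      sq (Δ (suc m) 0 ⊕ Δ m (suc m) ⊕ ⊖ Δ (suc m) m) ≤⟨ sq-⊕₃ (Δ (suc m) 0) (Δ m (suc m)) (⊖ Δ (suc m) m) ⟩
      (1ℚ ⊕ 1ℚ ⊕ 1ℚ) ⊗ (energyAt (suc m) 0 ⊕ energyAt m (suc m) ⊕ sq (⊖ Δ (suc m) m)) ≡⟨ cong (λ k → (1ℚ ⊕ 1ℚ ⊕ 1ℚ) ⊗ (energyAt (suc m) 0 ⊕ energyAt m (suc m) ⊕ k)) (sq-neg (Δ (suc m) m)) ⟩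
      (1ℚ ⊕ 1ℚ ⊕ 1ℚ) ⊗ (energyAt (suc m) 0 ⊕ energyAt m (suc m) ⊕ energyAt (suc m) m)
        ≤⟨ ⊗-monoʳ (fromℕ-nonNeg 3) (⊕-mono (⊕-mono (at-point 0 (≤-trans (s≤s z≤n) 1+m<n)) (∑-term t t-nonNeg (suc m) 1+m<n)) (at-point m (<-trans (n<1+n m) 1+m<n))) ⟩
      (1ℚ ⊕ 1ℚ ⊕ 1ℚ) ⊗ (P ⊕ X ⊕ P) ∎
    collect : ∀ P X → (1ℚ ⊕ 1ℚ ⊕ 1ℚ ⊕ 1ℚ ⊕ 1ℚ ⊕ 1ℚ ⊕ 1ℚ) ⊗ (P ⊕ X) ≡ (1ℚ ⊕ 1ℚ ⊕ 1ℚ) ⊗ (P ⊕ X ⊕ P) ⊕ X ⊕ P ⊕ (1ℚ ⊕ 1ℚ ⊕ 1ℚ) ⊗ X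
    collect = solve-∀ ℚ-ring

  -- A step of length e from x is simulated by walking to a chord that starts at most 4 further on, and walking back after crossing it.
  compare-chords : ∀ m δ (q : ℕ → Bool) {{_ : NonZero n}} → δ ≤ 2 → (∀ x → x < n → ∃[ i ] i ≤ 4 × q ((x + i) % n) ≡ true) → let e = m + δ in
    ∑ 2 (λ j → energy (m + j)) ≼ fromℕ 602 ⊗ (∑ 1 (λ i → energy (1 + i)) ⊕ ∑ n (λ x → if q x then energyAt e x else 0ℚ))
  compare-chords m δ q δ≤2 near = begin
    0ℚ ⊕ energy (m + 0) ⊕ energy (m + 1) ≡⟨ cong (_⊕ energy (m + 1)) (trans (ℚₚ.+-identityˡ (energy (m + 0))) (cong energy (+-identityʳ m))) ⟩
    energy m ⊕ energy (m + 1) ≤⟨ ⊕-mono bound-m (≼-trans (energy-+ m 1) (⊗-monoʳ (fromℕ-nonNeg 2) (⊕-mono bound-m E₁≤Z))) ⟩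
    fromℕ 200 ⊗ Z ⊕ (1ℚ ⊕ 1ℚ) ⊗ (fromℕ 200 ⊗ Z ⊕ Z) ≡⟨ collect (fromℕ 200) Z ⟩
    (fromℕ 200 ⊕ (1ℚ ⊕ 1ℚ) ⊗ (fromℕ 200 ⊕ 1ℚ)) ⊗ Z ∎
    where
    open ℚₚ.≤-Reasoning
    e = m + δ
    E₁ = energy 1
    t : ℕ → ℚ
    -- The reduction modulo `n` makes `t` periodic, so its sums over shifted ranges agree.
    t x = if q (x % n) then energyAt e x else 0ℚ
    X = ∑ n (λ x → if q x then energyAt e x else 0ℚ)
    Z = ∑ 1 (λ i → energy (1 + i)) ⊕ X
    t-nonNeg : ∀ x → 0ℚ ≼ t x
    t-nonNeg x with q (x % n)
    ... | true  = energyAt-nonNeg e x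
    ... | false = ≼-refl
    X≡ : ∑ n t ≡ X
    X≡ = ∑-cong n (λ x x<n → cong (λ y → if q y then energyAt e x else 0ℚ) (m<n⇒m%n≡m x<n))
    t-periodic : ∀ x → t (x + n) ≡ t x
    t-periodic x = cong₂ (λ b y → if b then y else 0ℚ) (cong q ([m+n]%n≡m%n x n)) (energyAt-periodic e x)
    X-nonNeg : 0ℚ ≼ X
    X-nonNeg = ≼-trans (∑-nonNeg n t-nonNeg) (≼-reflexive X≡)
    E₁≤Z : E₁ ≼ Z
    E₁≤Z = ≼-trans (≼-reflexive (sym (ℚₚ.+-identityˡ E₁))) (a≼a⊕b X-nonNeg)
    U V W : ℕ → ℚ
    U x = fromℕ 4 ⊗ ∑ 4 (λ s → energyAt 1 (0 + x + s))
    V x = ∑ 5 (λ i → t (i + x))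
    W x = fromℕ 4 ⊗ ∑ 4 (λ s → energyAt 1 (e + x + s))
    chain : ∀ a b c d → b ⊖ a ≡ (c ⊖ a) ⊕ (d ⊖ c) ⊕ ⊖ (d ⊖ b)
    chain = solve-∀ ℚ-ring
    local : ∀ x → x < n → energyAt e x ≼ (1ℚ ⊕ 1ℚ ⊕ 1ℚ) ⊗ (U x ⊕ V x ⊕ W x)
    local x x<n with near x x<n
    ... | i , i≤4 , chord = begin
      energyAt e x ≡⟨ cong sq (trans (chain (f x) (f (x + e)) (f (x + i)) (f (x + i + e))) (cong (λ k → Δ i x ⊕ Δ e (x + i) ⊕ ⊖ (f k ⊖ f (x + e))) (swap-right x i e))) ⟩
      sq (Δ i x ⊕ Δ e (x + i) ⊕ ⊖ Δ i (x + e)) ≤⟨ sq-⊕₃ (Δ i x) (Δ e (x + i)) (⊖ Δ i (x + e)) ⟩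
      (1ℚ ⊕ 1ℚ ⊕ 1ℚ) ⊗ (energyAt i x ⊕ energyAt e (x + i) ⊕ sq (⊖ Δ i (x + e))) ≡⟨ cong (λ k → (1ℚ ⊕ 1ℚ ⊕ 1ℚ) ⊗ (energyAt i x ⊕ energyAt e (x + i) ⊕ k)) (trans (sq-neg (Δ i (x + e))) (cong (energyAt i) (+-comm x e))) ⟩
      (1ℚ ⊕ 1ℚ ⊕ 1ℚ) ⊗ (energyAt i x ⊕ energyAt e (x + i) ⊕ energyAt i (e + x))
        ≤⟨ ⊗-monoʳ (fromℕ-nonNeg 3) (⊕-mono (⊕-mono (unit-steps 4 i x i≤4) crossing) (unit-steps 4 i (e + x) i≤4)) ⟩
      (1ℚ ⊕ 1ℚ ⊕ 1ℚ) ⊗ (U x ⊕ V x ⊕ W x) ∎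
      where
      crossing : energyAt e (x + i) ≼ V x
      crossing = ≼-trans (≼-reflexive (sym (trans (cong t (+-comm i x)) (cong (if_then energyAt e (x + i) else 0ℚ) chord)))) (∑-term (λ i → t (i + x)) (λ i → t-nonNeg (i + x)) i (s≤s i≤4))
    V-total : ∑ n V ≡ fromℕ 5 ⊗ X
    V-total = trans (∑-swap n 5 (λ x i → t (i + x))) (trans (∑-cong 5 (λ i _ → trans (∑-shift n t t-periodic i) X≡)) (∑-const 5 X))
    total : ∑ n (λ x → (1ℚ ⊕ 1ℚ ⊕ 1ℚ) ⊗ (U x ⊕ V x ⊕ W x)) ≡ (1ℚ ⊕ 1ℚ ⊕ 1ℚ) ⊗ (fromℕ 16 ⊗ E₁ ⊕ fromℕ 5 ⊗ X ⊕ fromℕ 16 ⊗ E₁)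
    total = trans (∑-distribˡ-⊗ n (1ℚ ⊕ 1ℚ ⊕ 1ℚ) _) (cong ((1ℚ ⊕ 1ℚ ⊕ 1ℚ) ⊗_) (trans (∑-distrib-⊕ n (λ x → U x ⊕ V x) W)
      (cong₂ _⊕_ (trans (∑-distrib-⊕ n U V) (cong₂ _⊕_ (unit-steps-total 4 0) V-total)) (unit-steps-total 4 e))))
    bound-e : energy e ≼ fromℕ 96 ⊗ Z
    bound-e = begin
      energy e ≤⟨ ∑-mono n local ⟩
      ∑ n (λ x → (1ℚ ⊕ 1ℚ ⊕ 1ℚ) ⊗ (U x ⊕ V x ⊕ W x)) ≡⟨ total ⟩
      -- Each chord serves five starting points, and the two walks of at most 4 unit steps cost 16
      -- each. The 5 is raised to 16 + 16 so that a single factor 3·32 = 96 remains.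
      (1ℚ ⊕ 1ℚ ⊕ 1ℚ) ⊗ (fromℕ 16 ⊗ E₁ ⊕ fromℕ 5 ⊗ X ⊕ fromℕ 16 ⊗ E₁) ≤⟨ ⊗-monoʳ (fromℕ-nonNeg 3) (⊕-monoˡ (fromℕ 16 ⊗ E₁) (⊕-monoʳ (fromℕ 16 ⊗ E₁) (⊗-monoˡ X-nonNeg (fromℕ-mono {5} {32} (m≤m+n 5 27))))) ⟩
      (1ℚ ⊕ 1ℚ ⊕ 1ℚ) ⊗ (fromℕ 16 ⊗ E₁ ⊕ (fromℕ 16 ⊕ fromℕ 16) ⊗ X ⊕ fromℕ 16 ⊗ E₁) ≡⟨ merge (fromℕ 16) E₁ X ⟩
      (1ℚ ⊕ 1ℚ ⊕ 1ℚ) ⊗ (fromℕ 16 ⊕ fromℕ 16) ⊗ (0ℚ ⊕ E₁ ⊕ X) ∎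
      where
      merge : ∀ k E X → (1ℚ ⊕ 1ℚ ⊕ 1ℚ) ⊗ (k ⊗ E ⊕ (k ⊕ k) ⊗ X ⊕ k ⊗ E) ≡ (1ℚ ⊕ 1ℚ ⊕ 1ℚ) ⊗ (k ⊕ k) ⊗ (0ℚ ⊕ E ⊕ X)
      merge = solve-∀ ℚ-ring
    bound-m : energy m ≼ fromℕ 200 ⊗ Z
    bound-m = begin
      energy m ≤⟨ energy-cancel m δ ⟩
      -- The chord length exceeds `m` by at most two unit steps, which are walked back: 2(96 + 4) =
      -- 200. The generator m + 1 then costs 2(200 + 1), and the sum of the two is 602.
      (1ℚ ⊕ 1ℚ) ⊗ (energy e ⊕ energy δ) ≤⟨ ⊗-monoʳ (fromℕ-nonNeg 2) (⊕-mono bound-e (≼-trans (energy-unit-steps 2 δ δ≤2) (⊗-monoʳ (fromℕ-nonNeg 4) E₁≤Z))) ⟩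
      (1ℚ ⊕ 1ℚ) ⊗ (fromℕ 96 ⊗ Z ⊕ fromℕ 4 ⊗ Z) ≡⟨ merge (fromℕ 96) (fromℕ 4) Z ⟩
      (1ℚ ⊕ 1ℚ) ⊗ (fromℕ 96 ⊕ fromℕ 4) ⊗ Z ∎
      where
      merge : ∀ a b Z → (1ℚ ⊕ 1ℚ) ⊗ (a ⊗ Z ⊕ b ⊗ Z) ≡ (1ℚ ⊕ 1ℚ) ⊗ (a ⊕ b) ⊗ Z
      merge = solve-∀ ℚ-ring
    collect : ∀ k Z → k ⊗ Z ⊕ (1ℚ ⊕ 1ℚ) ⊗ (k ⊗ Z ⊕ Z) ≡ (k ⊕ (1ℚ ⊕ 1ℚ) ⊗ (k ⊕ 1ℚ)) ⊗ Z
    collect = solve-∀ ℚ-ring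

-- Regular graphs of degree at least √n

parity : ∀ d → ∃[ k ] (d ≡ 2 * k ⊎ d ≡ suc (2 * k))
parity zero    = 0 , inj₁ refl
parity (suc d) with parity d
... | k , inj₁ d≡ = k , inj₂ (cong suc d≡)
... | k , inj₂ d≡ = suc k , inj₁ (trans (cong suc d≡) (shape k))
  where
  shape : ∀ k → suc (suc (2 * k)) ≡ 2 * suc k
  shape = ℕ-Solver.solve-∀

-- `suc c′` is ⌈k/2⌉, the largest c for which c, ..., 2c - 1 all lie in 1, ..., k.
halve : ∀ k → 1 ≤ k → ∃[ c′ ] c′ + suc c′ ≤ k × k ≤ 2 * suc c′
halve k 1≤k with parity k
... | zero  , inj₁ refl = contradiction 1≤k (λ ())
... | suc t , inj₁ refl = t , ≤-trans (n≤1+n _) (≤-reflexive (shape t)) , ≤-refl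
  where
  shape : ∀ t → suc (t + suc t) ≡ 2 * suc t
  shape = ℕ-Solver.solve-∀
... | t     , inj₂ refl = t , ≤-reflexive (shape t) , ≤-trans (n≤1+n _) (≤-reflexive (shape′ t))
  where
  shape : ∀ t → t + suc t ≡ suc (2 * t)
  shape = ℕ-Solver.solve-∀
  shape′ : ∀ t → suc (suc (2 * t)) ≡ 2 * suc t
  shape′ = ℕ-Solver.solve-∀

half-large : ∀ h → 2 ≤ h → ∃[ r ] 1 ≤ r × r + r ≤ h × h ≤ 3 * r
half-large h 2≤h with parity h
... | zero  , inj₁ refl = contradiction 2≤h (λ ())
... | zero  , inj₂ refl = contradiction 2≤h (λ { (s≤s ()) })
... | suc r , inj₁ refl = suc r , s≤s z≤n , ≤-reflexive (cong (suc r +_) (sym (+-identityʳ (suc r)))) , *-monoˡ-≤ (suc r) {2} {3} (s≤s (s≤s z≤n))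
... | suc r , inj₂ refl = suc r , s≤s z≤n , ≤-trans (≤-reflexive (cong (suc r +_) (sym (+-identityʳ (suc r))))) (n≤1+n _) , +-monoˡ-≤ (2 * suc r) (s≤s z≤n)

module _ (n : ℕ) {{_ : NonZero n}} (lo len e : ℕ) (q : ℕ → Bool) where
  open Circulant n lo len e q

  linked-by-unit-steps : 1 < n → (∀ x → isEdge 1 x ≡ true) → ∀ x y → toℕ y ≡ suc (toℕ x) → Star Adj x y
  linked-by-unit-steps 1<n edge x y y≡ = Adj-forward {x} {y} 1 1<n (edge (toℕ x)) (sym (trans (cong (_% n) (trans (+-comm (toℕ x) 1) (sym y≡))) (m<n⇒m%n≡m (Finₚ.toℕ<n y)))) ◅ ε

  -- A unit step is a step m + 1 forward followed by a step m backward. The edge of length m is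
  -- required only at positive vertices, because in one of the graphs it is missing at 0.
  linked-by-detour : ∀ m → suc m < n → (∀ x → isEdge (suc m) x ≡ true) → (∀ x → isEdge m (suc x) ≡ true) →
    ∀ x y → toℕ y ≡ suc (toℕ x) → Star Adj x y
  linked-by-detour m 1+m<n up down x y y≡ = Adj-forward {x} {z} (suc m) 1+m<n (up (toℕ x)) z≡
    ◅ Adj-symmetric {y} {z} (Adj-forward {y} {z} m (<-trans (n<1+n m) 1+m<n) (subst (λ t → isEdge m t ≡ true) (sym y≡) (down (toℕ x))) (trans z≡ (cong (_% n) (trans (+-suc (toℕ x) m) (cong (_+ m) (sym y≡))))))
    ◅ ε
    where
    z = fromℕ< (m%n<n (toℕ x + suc m) n)
    z≡ : toℕ z ≡ (toℕ x + suc m) % n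
    z≡ = Finₚ.toℕ-fromℕ< (m%n<n (toℕ x + suc m) n)

-- κ = 5 comes from `compare-short-range`, A = 5 from d ≤ 5c, L = 0 since m = c, and Q = 25 from n ≤
-- d² ≤ 25c². The factor 24 is 4·6, from ℓ + 3 ≤ 4ℓ and S ≤ 6 in `dense-ratio`.
C₁ : ℕ
C₁ = coefficient 5 5 0 25 * 24

log-exists : ∀ n → 2 ≤ n → ∃[ ℓ ] 1 ≤ ℓ × 2 ^ ℓ ≤ n × n ≤ 2 ^ suc ℓ
log-exists n 2≤n with scale-exists 2 1 n ≤-refl ≤-refl (≤-trans (s≤s z≤n) 2≤n)
... | ℓ , lower , upper = ℓ , 1≤ℓ ℓ upper , ≤-trans (≤-reflexive (sym (*-identityˡ (2 ^ ℓ)))) lower , ≤-trans (<⇒≤ upper) (≤-reflexive (*-identityˡ (2 ^ suc ℓ)))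
  where
  1≤ℓ : ∀ ℓ → n < 1 * 2 ^ suc ℓ → 1 ≤ ℓ
  1≤ℓ zero    n<2 = contradiction 2≤n (<⇒≱ n<2)
  1≤ℓ (suc _) _   = s≤s z≤n

ℓ+3≤4ℓ : ∀ {ℓ} → 1 ≤ ℓ → ℓ + 3 ≤ 4 * ℓ
ℓ+3≤4ℓ {ℓ} 1≤ℓ = ≤-trans (+-monoʳ-≤ ℓ (*-monoʳ-≤ 3 1≤ℓ)) (≤-reflexive refl)

dense-ratio : ∀ n d k ℓ S → 1 ≤ ℓ → 2 ^ ℓ ≤ n → S ≤ 6 → k ≤ d → ∀ N →
  fromℕ (coefficient 5 5 0 25 * (ℓ + 3) * (S * k)) ≼ (constᴿ C₁ *ᴿ (constᴿ d *ᴿ logᴿ n)) N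
dense-ratio n d k ℓ S 1≤ℓ 2^ℓ≤n S≤6 k≤d N = bound (coefficient 5 5 0 25)
  where
  shape : ∀ a ℓ d → a * (4 * ℓ) * (6 * d) ≡ a * 24 * (d * ℓ)
  shape = ℕ-Solver.solve-∀
  bound : ∀ a → fromℕ (a * (ℓ + 3) * (S * k)) ≼ fromℕ (a * 24) ⊗ (fromℕ d ⊗ logᴿ n N)
  bound a = begin
    fromℕ (a * (ℓ + 3) * (S * k)) ≤⟨ fromℕ-mono (≤-trans (*-mono-≤ (*-monoʳ-≤ a (ℓ+3≤4ℓ 1≤ℓ)) (*-mono-≤ S≤6 k≤d)) (≤-reflexive (shape a ℓ d))) ⟩
    fromℕ (a * 24 * (d * ℓ)) ≡⟨ trans (fromℕ-homo-* (a * 24) (d * ℓ)) (cong (fromℕ (a * 24) ⊗_) (fromℕ-homo-* d ℓ)) ⟩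
    fromℕ (a * 24) ⊗ (fromℕ d ⊗ fromℕ ℓ) ≤⟨ ⊗-monoʳ (fromℕ-nonNeg (a * 24)) (⊗-monoʳ (fromℕ-nonNeg d) (logᴿ-≽ ℓ n 2^ℓ≤n N)) ⟩
    fromℕ (a * 24) ⊗ (fromℕ d ⊗ logᴿ n N) ∎
    where open ℚₚ.≤-Reasoning

module Dense (n d k : ℕ) {{_ : NonZero n}} (1≤k : 1 ≤ k) (2k≤d : 2 * k ≤ d) (d≤1+2k : d ≤ suc (2 * k)) (n≤d² : n ≤ d * d) (d<n : d < n) where

  c′ c : ℕ
  c′ = proj₁ (halve k 1≤k)
  c = suc c′

  fits : c′ + c ≤ k
  fits = proj₁ (proj₂ (halve k 1≤k))

  k≤d : k ≤ d
  k≤d = ≤-trans (m≤m+n k _) 2k≤d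

  d≤5c : d ≤ 5 * c
  d≤5c = begin
    d ≤⟨ d≤1+2k ⟩
    1 + 2 * k ≤⟨ +-mono-≤ {1} {c} (s≤s z≤n) (*-monoʳ-≤ 2 (proj₂ (proj₂ (halve k 1≤k)))) ⟩
    c + 2 * (2 * c) ≡⟨ shape c ⟩
    5 * c ∎
    where
    open ℕₚ.≤-Reasoning
    shape : ∀ c → c + 2 * (2 * c) ≡ 5 * c
    shape = ℕ-Solver.solve-∀

  n≤25c² : n ≤ 25 * (c * c)
  n≤25c² = ≤-trans n≤d² (≤-trans (*-mono-≤ d≤5c d≤5c) (≤-reflexive (shape c)))
    where
    shape : ∀ c → 5 * c * (5 * c) ≡ 25 * (c * c)
    shape = ℕ-Solver.solve-∀

  c≤n : 2 ^ 0 * c ≤ n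
  c≤n = ≤-trans (≤-reflexive (*-identityˡ c)) (≤-trans (m≤n+m c c′) (≤-trans fits (≤-trans k≤d (<⇒≤ d<n))))

  2≤d : 2 ≤ d
  2≤d = ≤-trans (*-monoʳ-≤ 2 1≤k) 2k≤d

  2≤n : 2 ≤ n
  2≤n = ≤-trans 2≤d (<⇒≤ d<n)

  -- `h` is the modulus of the distance: `n` for even d, and n/2 for odd d, where antipodal edges
  -- make opposite vertices equivalent for the broadcast bound.
  module Family (e : ℕ) (q : ℕ → Bool)
    (range-short : 2 * (1 + k) ≤ suc n)
    (extra-short : ∀ x → q x ≡ true → 1 ≤ e × 2 * e ≤ n × Circulant.inRange n 1 k e q e ≡ false)
    (extra-once : ∀ x → x < n → q x ≡ true → q ((x + e) % n) ≡ true → 2 * e ≢ n)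
    (h S : ℕ) (h∣n : h ∣ n) (2≤h : 2 ≤ h) (h≤n : h ≤ n) (n≤Sh : n ≤ S * h) (S≤2 : S ≤ 2)
    (extra-period : ∀ x → q x ≡ true → e ≡ h) where

    unit-edge : ∀ x → Circulant.isEdge n 1 k e q 1 x ≡ true
    unit-edge x = Circulant.isEdge-range n 1 k e q {1} x ≤-refl (s≤s 1≤k)

    open RatioBound n 1 k e q ≤-refl range-short extra-short extra-once (linked-by-unit-steps n 1 k e q 2≤n unit-edge) public

    bounded : (∀ v → Graph.degree graph v ≡ d) → ℛ graph ≤ᴿ constᴿ C₁ *ᴿ (constᴿ d *ᴿ logᴿ n)
    bounded regular = conclude (half-large h 2≤h) (log-exists n 2≤n)
      where
      short : ∀ g x → isEdge g x ≡ true → g ≤ k ⊎ g ≡ h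
      short g x edge with isEdge-elim g x edge
      ... | inj₁ (_ , g<)    = inj₁ (ℕ.s≤s⁻¹ g<)
      ... | inj₂ (refl , qx) = inj₂ (extra-period x qx)
      compare : ∀ f → Periodic.Spread.totalEnergy n (lift f) (lift-periodic f) c c (s≤s z≤n) ≤-refl ≼ fromℕ 5 ⊗ edgeEnergy f
      compare f = ≼-trans (EnergyComparison.compare-short-range n (lift f) (lift-periodic f) c′ k fits)
        (⊗-monoʳ (fromℕ-nonNeg 5) (a≼a⊕b {∑ k (λ i → Periodic.energy n (lift f) (lift-periodic f) (1 + i))} (∑-nonNeg n (λ x → if-nonNeg (q x) (Periodic.energyAt-nonNeg n (lift f) (lift-periodic f) e x)))))
        where
        if-nonNeg : ∀ b {t} → 0ℚ ≼ t → 0ℚ ≼ (if b then t else 0ℚ)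
        if-nonNeg true  0≤t = 0≤t
        if-nonNeg false _   = ≼-refl
      conclude : (∃[ r ] 1 ≤ r × r + r ≤ h × h ≤ 3 * r) → (∃[ ℓ ] 1 ≤ ℓ × 2 ^ ℓ ≤ n × n ≤ 2 ^ suc ℓ) → ℛ graph ≤ᴿ constᴿ C₁ *ᴿ (constᴿ d *ᴿ logᴿ n)
      conclude (r , 1≤r , 2r≤h , h≤3r) (ℓ , 1≤ℓ , 2^ℓ≤n , n≤2^) =
        Bound.ℛ-≤ᴿ d c c 0 25 5 5 h r (S * 3) k ℓ {{ℕ.>-nonZero (≤-trans (s≤s z≤n) 2≤h)}}
          (λ v → ≤-trans (≤-trans (s≤s z≤n) 2≤d) (≤-reflexive (sym (regular v)))) (λ v → ≤-reflexive (regular v)) d≤5c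
          (s≤s z≤n) ≤-refl (sym (*-identityˡ c)) c≤n n≤25c² (s≤s z≤n) (s≤s z≤n) compare
          h∣n h≤n 1≤k short 1≤r 2r≤h (≤-trans n≤Sh (≤-trans (*-monoʳ-≤ S h≤3r) (≤-reflexive (sym (ℕₚ.*-assoc S 3 r))))) n≤2^
          (constᴿ C₁ *ᴿ (constᴿ d *ᴿ logᴿ n)) (dense-ratio n d k ℓ (S * 3) 1≤ℓ 2^ℓ≤n (*-monoˡ-≤ 3 S≤2) k≤d)

dense-even : ∀ n k {{_ : NonZero n}} → 1 ≤ k → n ≤ 2 * k * (2 * k) → 2 * k < n →
  Σ[ G ∈ Graph n ] Regular G (2 * k) × ℛ G ≤ᴿ constᴿ C₁ *ᴿ (constᴿ (2 * k) *ᴿ logᴿ n)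
dense-even n k 1≤k n≤d² d<n = X.graph , regular , X.bounded regular
  where
  module D = Dense n (2 * k) k 1≤k ≤-refl (n≤1+n (2 * k)) n≤d² d<n
  range-short : 2 * (1 + k) ≤ suc n
  range-short = ≤-trans (≤-reflexive (shape k)) (s≤s d<n)
    where
    shape : ∀ k → 2 * (1 + k) ≡ suc (suc (2 * k))
    shape = ℕ-Solver.solve-∀

  module X = D.Family 0 (λ _ → false) range-short (λ _ ()) (λ _ _ ()) n 1 ∣-refl D.2≤n ≤-refl (≤-reflexive (sym (*-identityˡ n))) (s≤s z≤n) (λ _ ())
  regular : ∀ v → Graph.degree X.graph v ≡ 2 * k
  regular v = trans (X.degree-formula v) (shape k)
    where
    shape : ∀ k → k + 0 + (k + 0) ≡ 2 * k
    shape = ℕ-Solver.solve-∀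

dense-odd : ∀ e k {{_ : NonZero (2 * e)}} → 1 ≤ k → 2 * e ≤ suc (2 * k) * suc (2 * k) → suc (2 * k) < 2 * e →
  Σ[ G ∈ Graph (2 * e) ] Regular G (suc (2 * k)) × ℛ G ≤ᴿ constᴿ C₁ *ᴿ (constᴿ (suc (2 * k)) *ᴿ logᴿ (2 * e))
dense-odd e k 1≤k n≤d² d<n = X.graph , regular , X.bounded regular
  where
  n = 2 * e
  module D = Dense n (suc (2 * k)) k 1≤k (n≤1+n (2 * k)) ≤-refl n≤d² d<n
  -- Each antipodal edge starts at its end below `e`, so it is counted once and adds 1 to every
  -- degree.
  q : ℕ → Bool
  q x = does (x <? e)
  k<e : suc k ≤ e
  k<e = ℕₚ.*-cancelˡ-≤ 2 (≤-trans (≤-reflexive (shape k)) d<n)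
    where
    shape : ∀ k → 2 * suc k ≡ suc (suc (2 * k))
    shape = ℕ-Solver.solve-∀
  n≡e+e : n ≡ e + e
  n≡e+e = cong (e +_) (+-identityʳ e)
  range-short : 2 * (1 + k) ≤ suc n
  range-short = ≤-trans (*-monoʳ-≤ 2 k<e) (n≤1+n n)
  antipode-< : ∀ {x} → x < e → (x + e) % n ≡ x + e
  antipode-< x<e = m<n⇒m%n≡m (<-≤-trans (ℕₚ.+-monoˡ-< e x<e) (≤-reflexive (sym n≡e+e)))
  antipode-≥ : ∀ {x} → x < n → e ≤ x → (x + e) % n < e
  antipode-≥ {x} x<n e≤x = ≤-<-trans (≤-reflexive wrapped) y<e
    where
    y = x ∸ e
    y+e : y + e ≡ x
    y+e = m∸n+n≡m e≤x
    y<e : y < e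
    y<e = +-cancelʳ-< e y e (subst₂ _<_ (sym y+e) n≡e+e x<n)
    wrapped : (x + e) % n ≡ y
    wrapped = trans (cong (_% n) (trans (cong (_+ e) (sym y+e)) (trans (+-assoc y e e) (cong (y +_) (sym n≡e+e)))))
      (trans ([m+n]%n≡m%n y n) (m<n⇒m%n≡m (<-≤-trans y<e (m≤m+n e _))))
  extra-once : ∀ x → x < n → q x ≡ true → q ((x + e) % n) ≡ true → 2 * e ≢ n
  extra-once x _ qx qy _ = <-irrefl refl (≤-<-trans (m≤n+m e x) (subst (_< e) (antipode-< (does-elim (x <? e) qx)) (does-elim ((x + e) % n <? e) qy)))
  extra-short : ∀ x → q x ≡ true → 1 ≤ e × 2 * e ≤ n × Circulant.inRange n 1 k e q e ≡ false
  extra-short x _ = ≤-trans (s≤s z≤n) k<e , ≤-refl , cong₂ _∧_ {y = true} (dec-true (1 ≤? e) (≤-trans (s≤s z≤n) k<e)) (dec-false (e <? 1 + k) (≤⇒≯ k<e))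
  module X = D.Family e q range-short extra-short extra-once e 2 (divides 2 refl) (≤-trans (s≤s 1≤k) k<e) (m≤m+n e _) ≤-refl ≤-refl (λ _ _ → refl)
  regular : ∀ v → Graph.degree X.graph v ≡ suc (2 * k)
  regular v = trans (X.degree-formula v) (trans (cong (λ t → k + bit (q (toℕ v)) + (k + bit (q ((toℕ v + t) % n)))) (trans (cong (_∸ e) n≡e+e) (ℕₚ.m+n∸m≡n e e))) (one-of (toℕ v) (Finₚ.toℕ<n v)))
    where
    shape₁ : ∀ k → k + 1 + (k + 0) ≡ suc (2 * k)
    shape₁ = ℕ-Solver.solve-∀
    shape₂ : ∀ k → k + 0 + (k + 1) ≡ suc (2 * k)
    shape₂ = ℕ-Solver.solve-∀
    one-of : ∀ x → x < n → k + bit (q x) + (k + bit (q ((x + e) % n))) ≡ suc (2 * k)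
    one-of x x<n with ℕₚ.<-≤-connex x e
    ... | inj₁ x<e = trans (cong₂ (λ a b → k + bit a + (k + bit b)) (dec-true (x <? e) x<e) (dec-false ((x + e) % n <? e) (≤⇒≯ (≤-trans (m≤n+m e x) (≤-reflexive (sym (antipode-< x<e))))))) (shape₁ k)
    ... | inj₂ e≤x = trans (cong₂ (λ a b → k + bit a + (k + bit b)) (dec-false (x <? e) (≤⇒≯ e≤x)) (dec-true ((x + e) % n <? e) (antipode-≥ x<n e≤x))) (shape₂ k)

even-factor : ∀ n k → 2 ∣ n * suc (2 * k) → ∃[ e ] n ≡ 2 * e
even-factor n k 2∣ with parity n
... | e , inj₁ n≡ = e , n≡
... | a , inj₂ refl = contradiction (∣1⇒≡1 (∣m+n∣m⇒∣n (subst (2 ∣_) (shape a k) 2∣) (m∣m*n (a * suc (2 * k) + k)))) (λ ())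
  where
  shape : ∀ a k → suc (2 * a) * suc (2 * k) ≡ 2 * (a * suc (2 * k) + k) + 1
  shape = ℕ-Solver.solve-∀

dense : ∀ n d → n ≤ d * d → d < n → 2 ∣ n * d →
  Σ[ G ∈ Graph n ] Regular G d × ℛ G ≤ᴿ constᴿ C₁ *ᴿ (constᴿ d *ᴿ logᴿ n)
dense n d n≤d² d<n 2∣nd = conclude (parity d)
  where
  instance
    n-nonZero : NonZero n
    n-nonZero = ℕ.>-nonZero (≤-trans (s≤s z≤n) d<n)
  Goal : Set₁
  Goal = Σ[ G ∈ Graph n ] Regular G d × ℛ G ≤ᴿ constᴿ C₁ *ᴿ (constᴿ d *ᴿ logᴿ n)
  conclude : ∃[ k ] (d ≡ 2 * k ⊎ d ≡ suc (2 * k)) → Goal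
  conclude (zero  , inj₁ refl) = contradiction n≤d² (<⇒≱ d<n)
  conclude (suc k , inj₁ refl) = dense-even n (suc k) (s≤s z≤n) n≤d² d<n
  conclude (zero  , inj₂ refl) = contradiction n≤d² (<⇒≱ d<n)
  conclude (suc k , inj₂ refl) = odd-case (even-factor n (suc k) 2∣nd)
    where
    odd-case : ∃[ e ] n ≡ 2 * e → Goal
    odd-case (e , refl) = dense-odd e (suc k) (s≤s z≤n) n≤d² d<n

-- Almost regular graphs of degree at most √n

-- κ = 602 is the largest comparison loss of the three constructions, A = 5 comes from d + 1 ≤ 5c
-- and Q = 16 from n ≤ 16m²; the argument 1 is the value of L left by `coefficient-linear`. The
-- factor 24 is 4·3·2, from ℓ + 3 ≤ 4ℓ, S = 3 and K ≤ 2r.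
C₂ : ℕ
C₂ = coefficient 602 5 1 16 * 24

sparse-ratio : ∀ n L K r ℓ → L ≤ ℓ → 1 ≤ ℓ → 2 ^ ℓ ≤ n → K ≤ 2 * r → r * r ≤ n → ∀ N →
  fromℕ (coefficient 602 5 L 16 * (ℓ + 3) * (3 * K)) ≼ (constᴿ C₂ *ᴿ (√ᴿ n *ᴿ (logᴿ n *ᴿ logᴿ n))) N
sparse-ratio n L K r ℓ L≤ℓ 1≤ℓ 2^ℓ≤n K≤2r r²≤n N = bound (coefficient 602 5 L 16) (coefficient 602 5 1 16) (coefficient-linear 602 5 L 16 ℓ L≤ℓ 1≤ℓ)
  where
  shape : ∀ a ℓ r → a * ℓ * (4 * ℓ) * (3 * (2 * r)) ≡ a * 24 * (r * (ℓ * ℓ))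
  shape = ℕ-Solver.solve-∀
  ℓ≤log : fromℕ ℓ ≼ logᴿ n N
  ℓ≤log = logᴿ-≽ ℓ n 2^ℓ≤n N
  0≤log : 0ℚ ≼ logᴿ n N
  0≤log = ≼-trans (fromℕ-nonNeg ℓ) ℓ≤log
  bound : ∀ a b → a ≤ b * ℓ → fromℕ (a * (ℓ + 3) * (3 * K)) ≼ fromℕ (b * 24) ⊗ (√ᴿ n N ⊗ (logᴿ n N ⊗ logᴿ n N))
  bound a b a≤bℓ = begin
    fromℕ (a * (ℓ + 3) * (3 * K)) ≤⟨ fromℕ-mono (≤-trans (*-mono-≤ (*-mono-≤ a≤bℓ (ℓ+3≤4ℓ 1≤ℓ)) (*-monoʳ-≤ 3 K≤2r)) (≤-reflexive (shape b ℓ r))) ⟩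
    fromℕ (b * 24 * (r * (ℓ * ℓ))) ≡⟨ trans (fromℕ-homo-* (b * 24) (r * (ℓ * ℓ))) (cong (fromℕ (b * 24) ⊗_) (trans (fromℕ-homo-* r (ℓ * ℓ)) (cong (fromℕ r ⊗_) (fromℕ-homo-* ℓ ℓ)))) ⟩
    fromℕ (b * 24) ⊗ (fromℕ r ⊗ (fromℕ ℓ ⊗ fromℕ ℓ)) ≤⟨ ⊗-monoʳ (fromℕ-nonNeg (b * 24)) (⊗-mono (fromℕ-nonNeg r) (⊗-nonNeg 0≤log 0≤log) (√ᴿ-≽ r n r²≤n N) (⊗-mono (fromℕ-nonNeg ℓ) 0≤log ℓ≤log ℓ≤log)) ⟩
    fromℕ (b * 24) ⊗ (√ᴿ n N ⊗ (logᴿ n N ⊗ logᴿ n N)) ∎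
    where open ℚₚ.≤-Reasoning

2^-cancel-≤ : ∀ a b → 2 ^ a ≤ 2 ^ b → a ≤ b
2^-cancel-≤ a b h with a ≤? b
... | yes a≤b = a≤b
... | no  a≰b = contradiction h (<⇒≱ (ℕₚ.^-monoʳ-< 2 (s≤s (s≤s z≤n)) (≰⇒> a≰b)))

SparseGraph : ℕ → ℕ → Set₁
SparseGraph n d = Σ[ G ∈ Graph n ] MinDegree G d × MaxDegree G (d + 1) × ℛ G ≤ᴿ constᴿ C₂ *ᴿ (√ᴿ n *ᴿ (logᴿ n *ᴿ logᴿ n))

-- The common part of the three sparse constructions. The bounds `K ≤ 2 * r` and `r * r ≤ n` express
-- that all steps have length at most 2√n; degrees are checked on residues through the degree
-- formula.
module Sparse (n d c m L K r : ℕ) {{_ : NonZero n}} (1≤d : 1 ≤ d) (1≤c : 1 ≤ c) (m≡ : m ≡ 2 ^ L * c) (c≤m : c ≤ m) (2m≤n : 2 * m ≤ n) (span : 2 ^ L * m ≤ n)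
  (n≤16m² : n ≤ 16 * (m * m)) (1≤K : 1 ≤ K) (K≤2r : K ≤ 2 * r) (r²≤n : r * r ≤ n) (d+1≤5c : d + 1 ≤ 5 * c)
  (lo len e : ℕ) (q : ℕ → Bool)
  (1≤lo : 1 ≤ lo) (range-short : 2 * (lo + len) ≤ suc n)
  (extra-short : ∀ x → q x ≡ true → 1 ≤ e × 2 * e ≤ n × Circulant.inRange n lo len e q e ≡ false)
  (extra-once : ∀ x → x < n → q x ≡ true → q ((x + e) % n) ≡ true → 2 * e ≢ n)
  (linked : ∀ x y → toℕ y ≡ suc (toℕ x) → Star (Circulant.Adj n lo len e q) x y)
  (range≤K : lo + len ≤ suc K) (e≤K : e ≤ K) where

  open RatioBound n lo len e q 1≤lo range-short extra-short extra-once linked public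

  2≤n : 2 ≤ n
  2≤n = ≤-trans (*-monoʳ-≤ 2 (≤-trans 1≤c c≤m)) 2m≤n

  degreeAt : ℕ → ℕ
  degreeAt x = len + bit (q x) + (len + bit (q ((x + (n ∸ e)) % n)))

  module _ (compare : ∀ f → Periodic.Spread.totalEnergy n (lift f) (lift-periodic f) c m 1≤c c≤m ≼ fromℕ 602 ⊗ edgeEnergy f)
    (lower : ∀ x → x < n → d ≤ degreeAt x) (upper : ∀ x → x < n → degreeAt x ≤ d + 1)
    (a b : ℕ) (a<n : a < n) (b<n : b < n) (a-min : degreeAt a ≡ d) (b-max : degreeAt b ≡ d + 1) where

    bounded : ℛ graph ≤ᴿ constᴿ C₂ *ᴿ (√ᴿ n *ᴿ (logᴿ n *ᴿ logᴿ n))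
    bounded = conclude (half-large n 2≤n) (log-exists n 2≤n)
      where
      lower′ : ∀ v → d ≤ Graph.degree graph v
      lower′ v = ≤-trans (lower (toℕ v) (Finₚ.toℕ<n v)) (≤-reflexive (sym (degree-formula v)))
      upper′ : ∀ v → Graph.degree graph v ≤ d + 1
      upper′ v = ≤-trans (≤-reflexive (degree-formula v)) (upper (toℕ v) (Finₚ.toℕ<n v))
      short : ∀ g x → isEdge g x ≡ true → g ≤ K ⊎ g ≡ n
      short g x edge with isEdge-elim g x edge
      ... | inj₁ (_ , g<)   = inj₁ (ℕ.s≤s⁻¹ (≤-trans g< range≤K))
      ... | inj₂ (refl , _) = inj₁ e≤K
      2^L≤m : 2 ^ L ≤ m
      2^L≤m = ≤-trans (≤-reflexive (sym (*-identityʳ (2 ^ L)))) (≤-trans (*-monoʳ-≤ (2 ^ L) 1≤c) (≤-reflexive (sym m≡)))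
      conclude : (∃[ r ] 1 ≤ r × r + r ≤ n × n ≤ 3 * r) → (∃[ ℓ ] 1 ≤ ℓ × 2 ^ ℓ ≤ n × n ≤ 2 ^ suc ℓ) → ℛ graph ≤ᴿ constᴿ C₂ *ᴿ (√ᴿ n *ᴿ (logᴿ n *ᴿ logᴿ n))
      conclude (s , 1≤s , 2s≤n , n≤3s) (ℓ , 1≤ℓ , 2^ℓ≤n , n≤2^) =
        Bound.ℛ-≤ᴿ (d + 1) c m L 16 602 5 n s 3 K ℓ (λ v → ≤-trans 1≤d (lower′ v)) upper′ d+1≤5c
          1≤c c≤m m≡ span n≤16m² (s≤s z≤n) (s≤s z≤n) compare ∣-refl ≤-refl 1≤K short 1≤s 2s≤n n≤3s n≤2^
          (constᴿ C₂ *ᴿ (√ᴿ n *ᴿ (logᴿ n *ᴿ logᴿ n))) (sparse-ratio n L K r ℓ L≤ℓ 1≤ℓ 2^ℓ≤n K≤2r r²≤n)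
        where
        L≤ℓ : L ≤ ℓ
        L≤ℓ = ℕ.s≤s⁻¹ (2^-cancel-≤ (suc L) (suc ℓ) (≤-trans (*-monoʳ-≤ 2 2^L≤m) (≤-trans 2m≤n n≤2^)))

    sparse : SparseGraph n d
    sparse = graph
      , ((λ v → ≤-trans (lower (toℕ v) (Finₚ.toℕ<n v)) (≤-reflexive (sym (degree-formula v)))) , fromℕ< a<n , attained a<n a-min)
      , ((λ v → ≤-trans (≤-reflexive (degree-formula v)) (upper (toℕ v) (Finₚ.toℕ<n v))) , fromℕ< b<n , attained b<n b-max)
      , bounded
      where
      attained : ∀ {x k} (x<n : x < n) → degreeAt x ≡ k → Graph.degree graph (fromℕ< x<n) ≡ k
      attained x<n eq = trans (degree-formula (fromℕ< x<n)) (trans (cong degreeAt (Finₚ.toℕ-fromℕ< x<n)) eq)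

-- Choice of the step length

4^≡2^*2^ : ∀ L → 4 ^ L ≡ 2 ^ L * 2 ^ L
4^≡2^*2^ zero    = refl
4^≡2^*2^ (suc L) = trans (cong (4 *_) (4^≡2^*2^ L)) (shape (2 ^ L))
  where
  shape : ∀ t → 4 * (t * t) ≡ 2 * t * (2 * t)
  shape = ℕ-Solver.solve-∀

bit≤1 : ∀ b → bit b ≤ 1
bit≤1 true  = s≤s z≤n
bit≤1 false = z≤n

-- `L` is the largest exponent with 4c²·4^L ≤ n, so m = 2^L c satisfies 4m² ≤ n < 16m². The 4 leaves
-- room for steps up to 2m to stay below n/2; the bound `9 ≤ n` settles m = 1, where 4m² ≤ n would
-- only give 4m ≤ n.
module StepLength (n c : ℕ) (1≤c : 1 ≤ c) (4c²≤n : 4 * (c * c) ≤ n) (9≤n : 9 ≤ n) where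

  private
    scale = scale-exists 4 (4 * (c * c)) n (s≤s (s≤s z≤n)) (*-mono-≤ {1} {4} (s≤s z≤n) (*-mono-≤ 1≤c 1≤c)) 4c²≤n

  L m : ℕ
  L = proj₁ scale
  m = 2 ^ L * c

  private
    4^L : 4 ^ L ≡ 2 ^ L * 2 ^ L
    4^L = 4^≡2^*2^ L
    shape : ∀ c t → 4 * (c * c) * (t * t) ≡ 4 * (t * c * (t * c))
    shape = ℕ-Solver.solve-∀
    shape′ : ∀ c t → 4 * (c * c) * (4 * (t * t)) ≡ 16 * (t * c * (t * c))
    shape′ = ℕ-Solver.solve-∀

  4m²≤n : 4 * (m * m) ≤ n
  4m²≤n = ≤-trans (≤-reflexive (sym (trans (cong (4 * (c * c) *_) 4^L) (shape c (2 ^ L))))) (proj₁ (proj₂ scale))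

  n<16m² : n < 16 * (m * m)
  n<16m² = <-≤-trans (proj₂ (proj₂ scale)) (≤-reflexive (trans (cong (λ t → 4 * (c * c) * (4 * t)) 4^L) (shape′ c (2 ^ L))))

  1≤2^L : 1 ≤ 2 ^ L
  1≤2^L = ℕₚ.m^n>0 2 L

  c≤m : c ≤ m
  c≤m = ≤-trans (≤-reflexive (sym (*-identityˡ c))) (*-monoˡ-≤ c 1≤2^L)

  1≤m : 1 ≤ m
  1≤m = ≤-trans 1≤c c≤m

  4m<n : 4 * m < n
  4m<n = bound m 4m²≤n
    where
    shape″ : ∀ k → suc (4 * suc (suc k)) + (4 * k * suc (suc k) + 4 * suc k + 3) ≡ 4 * (suc (suc k) * suc (suc k))
    shape″ = ℕ-Solver.solve-∀
    bound : ∀ m → 4 * (m * m) ≤ n → 4 * m < n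
    bound zero          _ = ≤-trans (s≤s z≤n) 9≤n
    bound (suc zero)    _ = ≤-trans (s≤s (s≤s (s≤s (s≤s (s≤s z≤n))))) 9≤n
    bound (suc (suc k)) h = ≤-trans (≤-trans (m≤m+n _ _) (≤-reflexive (shape″ k))) h

  2m≤n : 2 * m ≤ n
  2m≤n = ≤-trans (*-monoˡ-≤ m {2} {4} (s≤s (s≤s z≤n))) (<⇒≤ 4m<n)

  span : 2 ^ L * m ≤ n
  span = ≤-trans (*-monoˡ-≤ m (≤-trans (≤-reflexive (sym (*-identityʳ (2 ^ L)))) (*-monoʳ-≤ (2 ^ L) 1≤c)))
    (≤-trans (m≤m+n (m * m) _) 4m²≤n)

  m+c≤2m : m + c ≤ 2 * m
  m+c≤2m = +-monoʳ-≤ m (≤-trans c≤m (≤-reflexive (sym (+-identityʳ m))))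

  m+c≤2[2m] : m + c ≤ 2 * (2 * m)
  m+c≤2[2m] = ≤-trans m+c≤2m (m≤m+n (2 * m) _)

  [2m]²≤n : 2 * m * (2 * m) ≤ n
  [2m]²≤n = ≤-trans (≤-reflexive (eq m)) 4m²≤n
    where
    eq : ∀ m → 2 * m * (2 * m) ≡ 4 * (m * m)
    eq = ℕ-Solver.solve-∀

  range-short : 2 * (m + suc c) ≤ suc n
  range-short = ≤-trans (≤-reflexive (eq m c)) (s≤s (≤-trans (s≤s (*-monoʳ-≤ 2 m+c≤2m)) (≤-trans (≤-reflexive (cong suc (eq′ m))) 4m<n)))
    where
    eq : ∀ m c → 2 * (m + suc c) ≡ suc (suc (2 * (m + c)))
    eq = ℕ-Solver.solve-∀
    eq′ : ∀ m → 2 * (2 * m) ≡ 4 * m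
    eq′ = ℕ-Solver.solve-∀

  1+m<n : suc m < n
  1+m<n = <-≤-trans (s≤s (m<m+n m (≤-trans 1≤m (m≤m+n m (m + (m + 0)))))) 4m<n

-- The c + 1 generators m, ..., m + c give every vertex degree d = 2(c + 1). The added edge between
-- 0 and 1 raises two degrees to d + 1; it is new because m ≥ 2, and vertex 2 keeps degree d.
sparse-even : ∀ n c → 1 ≤ c → 2 * suc c * (2 * suc c) ≤ n → SparseGraph n (2 * suc c)
sparse-even n c 1≤c d²≤n = X.sparse compare lower upper 2 0 2<n (≤-trans (s≤s z≤n) 16≤n) at-2 at-0
  where
  16≤n : 16 ≤ n
  16≤n = ≤-trans (*-mono-≤ {4} {2 * suc c} {4} (*-monoʳ-≤ 2 (s≤s 1≤c)) (*-monoʳ-≤ 2 (s≤s 1≤c))) d²≤n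
  instance
    n-nonZero : NonZero n
    n-nonZero = ℕ.>-nonZero (≤-trans (s≤s z≤n) 16≤n)
  shape : ∀ c → 4 * (c * c) + (8 * c + 4) ≡ 2 * suc c * (2 * suc c)
  shape = ℕ-Solver.solve-∀
  open StepLength n c 1≤c (≤-trans (≤-trans (m≤m+n _ _) (≤-reflexive (shape c))) d²≤n) (≤-trans (m≤m+n 9 7) 16≤n)
  q : ℕ → Bool
  q x = does (x ≟ 0)
  2≤m : 2 ≤ m
  2≤m = ≰⇒> (λ m≤1 → <-irrefl refl (<-≤-trans n<16m² (≤-trans (*-monoʳ-≤ 16 (*-mono-≤ m≤1 m≤1)) 16≤n)))
  2<n : 2 < n
  2<n = ≤-trans (m≤m+n 3 13) 16≤n
  extra-short : ∀ x → q x ≡ true → 1 ≤ 1 × 2 * 1 ≤ n × Circulant.inRange n m (suc c) 1 q 1 ≡ false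
  extra-short _ _ = ≤-refl , <⇒≤ 2<n , cong (_∧ does (1 <? m + suc c)) (dec-false (m ≤? 1) (<⇒≱ 2≤m))
  linked : ∀ x y → toℕ y ≡ suc (toℕ x) → Star (Circulant.Adj n m (suc c) 1 q) x y
  linked = linked-by-detour n m (suc c) 1 q m 1+m<n
    (λ x → Circulant.isEdge-range n m (suc c) 1 q {suc m} x (n≤1+n m) (≤-trans (s≤s (≤-trans (≤-reflexive (+-comm 1 m)) (+-monoʳ-≤ m 1≤c))) (≤-reflexive (sym (+-suc m c)))))
    (λ x → Circulant.isEdge-range n m (suc c) 1 q {m} (suc x) ≤-refl (m<m+n m (s≤s z≤n)))
  d+1≤5c : 2 * suc c + 1 ≤ 5 * c
  d+1≤5c = ≤-trans (≤-reflexive (eq c)) (≤-trans (+-monoʳ-≤ (2 * c) (*-monoʳ-≤ 3 1≤c)) (≤-reflexive (eq′ c)))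
    where
    eq : ∀ c → 2 * suc c + 1 ≡ 2 * c + 3 * 1
    eq = ℕ-Solver.solve-∀
    eq′ : ∀ c → 2 * c + 3 * c ≡ 5 * c
    eq′ = ℕ-Solver.solve-∀
  module X = Sparse n (2 * suc c) c m L (m + c) (2 * m) (s≤s z≤n) 1≤c refl c≤m 2m≤n span (<⇒≤ n<16m²) (≤-trans 1≤m (m≤m+n m c)) m+c≤2[2m] [2m]²≤n d+1≤5c
    m (suc c) 1 q 1≤m range-short extra-short (λ _ _ _ _ → <⇒≢ 2<n) linked (≤-reflexive (+-suc m c)) (≤-trans 1≤m (m≤m+n m c))
  compare : ∀ f → Periodic.Spread.totalEnergy n (X.lift f) (X.lift-periodic f) c m 1≤c c≤m ≼ fromℕ 602 ⊗ X.edgeEnergy f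
  compare f = ≼-trans (a≼a⊕b {E} X-nonNeg) (≼-trans (≼-reflexive (sym (ℚₚ.*-identityˡ (X.edgeEnergy f)))) (⊗-monoˡ {b = fromℕ 602} (⊕-nonNeg {E} E-nonNeg X-nonNeg) (fromℕ-mono {1} {602} (s≤s z≤n))))
    where
    open Periodic n (X.lift f) (X.lift-periodic f)
    E = ∑ (suc c) (λ j → energy (m + j))
    E-nonNeg : 0ℚ ≼ E
    E-nonNeg = ∑-nonNeg (suc c) (λ j → energy-nonNeg (m + j))
    t-nonNeg : ∀ x → 0ℚ ≼ (if q x then energyAt 1 x else 0ℚ)
    t-nonNeg zero    = energyAt-nonNeg 1 0
    t-nonNeg (suc x) = ≼-refl
    X-nonNeg : 0ℚ ≼ ∑ n (λ x → if q x then energyAt 1 x else 0ℚ)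
    X-nonNeg = ∑-nonNeg n t-nonNeg
  previous : ∀ y → suc y < n → (suc y + (n ∸ 1)) % n ≡ y
  previous y 1+y<n = trans (cong (_% n) (trans (sym (+-suc y (n ∸ 1))) (cong (y +_) (m+[n∸m]≡n {1} (≤-trans (s≤s z≤n) 16≤n))))) (trans ([m+n]%n≡m%n y n) (m<n⇒m%n≡m (<-trans (n<1+n y) 1+y<n)))
  n-1≢0 : (n ∸ 1) % n ≢ 0
  n-1≢0 eq = <-irrefl (sym (trans (sym (m<n⇒m%n≡m (∸-monoʳ-< {n} {1} {0} (s≤s z≤n) (≤-trans (s≤s z≤n) 16≤n)))) eq)) (ℕₚ.m<n⇒0<n∸m (<-trans (s≤s (s≤s z≤n)) 2<n))
  shape₂ : ∀ c → suc c + 0 + (suc c + 0) ≡ 2 * suc c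
  shape₂ = ℕ-Solver.solve-∀
  shape₃ : ∀ c → suc c + 1 + (suc c + 0) ≡ 2 * suc c + 1
  shape₃ = ℕ-Solver.solve-∀
  shape₄ : ∀ c → suc c + 0 + (suc c + 1) ≡ 2 * suc c + 1
  shape₄ = ℕ-Solver.solve-∀
  at-0 : X.degreeAt 0 ≡ 2 * suc c + 1
  at-0 = trans (cong (λ t → suc c + 1 + (suc c + bit t)) (dec-false ((n ∸ 1) % n ≟ 0) n-1≢0)) (shape₃ c)
  at-2 : X.degreeAt 2 ≡ 2 * suc c
  at-2 = trans (cong (λ t → suc c + 0 + (suc c + bit (q t))) (previous 1 2<n)) (shape₂ c)
  lower : ∀ x → x < n → 2 * suc c ≤ X.degreeAt x
  lower x _ = ≤-trans (≤-reflexive (sym (shape₂ c))) (+-mono-≤ (+-monoʳ-≤ (suc c) z≤n) (+-monoʳ-≤ (suc c) z≤n))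
  upper : ∀ x → x < n → X.degreeAt x ≤ 2 * suc c + 1
  upper zero    _   = ≤-reflexive at-0
  upper (suc y) y<n = ≤-trans (+-monoʳ-≤ (suc c + 0) (+-monoʳ-≤ (suc c) (bit≤1 (q ((suc y + (n ∸ 1)) % n))))) (≤-reflexive (shape₄ c))

-- All generators m, ..., m + c would give degree d + 1 = 2c + 2 everywhere. Omitting the edge from
-- 0 to m lowers two degrees to d. To express this, `m` is taken out of the range and made the extra
-- generator, selected at every vertex but 0.
sparse-odd : ∀ n c → 1 ≤ c → suc (2 * c) * suc (2 * c) ≤ n → SparseGraph n (suc (2 * c))
sparse-odd n c 1≤c d²≤n = X.sparse compare lower upper 0 (suc m) (≤-trans (s≤s z≤n) 9≤n) 1+m<n at-0 at-1+m
  where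
  9≤n : 9 ≤ n
  9≤n = ≤-trans (*-mono-≤ {3} {suc (2 * c)} {3} (s≤s (*-monoʳ-≤ 2 1≤c)) (s≤s (*-monoʳ-≤ 2 1≤c))) d²≤n
  instance
    n-nonZero : NonZero n
    n-nonZero = ℕ.>-nonZero (≤-trans (s≤s z≤n) 9≤n)
  shape : ∀ c → 4 * (c * c) + (4 * c + 1) ≡ suc (2 * c) * suc (2 * c)
  shape = ℕ-Solver.solve-∀
  open StepLength n c 1≤c (≤-trans (≤-trans (m≤m+n _ _) (≤-reflexive (shape c))) d²≤n) 9≤n
  q : ℕ → Bool
  q x = not (does (x ≟ 0))
  extra-short : ∀ x → q x ≡ true → 1 ≤ m × 2 * m ≤ n × Circulant.inRange n (suc m) c m q m ≡ false
  extra-short _ _ = 1≤m , 2m≤n , cong (_∧ does (m <? suc m + c)) (dec-false (suc m ≤? m) (<⇒≱ (n<1+n m)))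
  2m<n : 2 * m < n
  2m<n = ≤-<-trans (*-monoˡ-≤ m {2} {4} (s≤s (s≤s z≤n))) 4m<n
  linked : ∀ x y → toℕ y ≡ suc (toℕ x) → Star (Circulant.Adj n (suc m) c m q) x y
  linked = linked-by-detour n (suc m) c m q m 1+m<n
    (λ x → Circulant.isEdge-range n (suc m) c m q {suc m} x ≤-refl (m<m+n (suc m) 1≤c))
    (λ x → Circulant.isEdge-extra n (suc m) c m q (suc x) refl)
  d+1≤5c : suc (2 * c) + 1 ≤ 5 * c
  d+1≤5c = ≤-trans (≤-reflexive (eq c)) (≤-trans (+-monoʳ-≤ (2 * c) (≤-trans (n≤1+n 2) (*-monoʳ-≤ 3 1≤c))) (≤-reflexive (eq′ c)))
    where
    eq : ∀ c → suc (2 * c) + 1 ≡ 2 * c + 2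
    eq = ℕ-Solver.solve-∀
    eq′ : ∀ c → 2 * c + 3 * c ≡ 5 * c
    eq′ = ℕ-Solver.solve-∀
  module X = Sparse n (suc (2 * c)) c m L (m + c) (2 * m) (s≤s z≤n) 1≤c refl c≤m 2m≤n span (<⇒≤ n<16m²) (≤-trans 1≤m (m≤m+n m c)) m+c≤2[2m] [2m]²≤n d+1≤5c
    (suc m) c m q (s≤s z≤n) (≤-trans (≤-reflexive (cong (2 *_) (sym (+-suc m c)))) range-short) extra-short (λ _ _ _ _ → <⇒≢ 2m<n) linked ≤-refl (m≤m+n m c)
  compare : ∀ f → Periodic.Spread.totalEnergy n (X.lift f) (X.lift-periodic f) c m 1≤c c≤m ≼ fromℕ 602 ⊗ X.edgeEnergy f
  compare f = ≼-trans (EnergyComparison.compare-missing-edge n (X.lift f) (X.lift-periodic f) c m 1≤c 1+m<n)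
    (⊗-monoˡ {b = fromℕ 602} (⊕-nonNeg (∑-nonNeg c (λ i → energy-nonNeg (suc m + i))) (∑-nonNeg n t-nonNeg)) (fromℕ-mono {7} {602} (m≤m+n 7 595)))
    where
    open Periodic n (X.lift f) (X.lift-periodic f)
    t-nonNeg : ∀ x → 0ℚ ≼ (if q x then energyAt m x else 0ℚ)
    t-nonNeg zero    = ≼-refl
    t-nonNeg (suc x) = energyAt-nonNeg m (suc x)
  m≤n = <⇒≤ (<-trans (n<1+n m) 1+m<n)
  n-m≢0 : (n ∸ m) % n ≢ 0
  n-m≢0 eq = <-irrefl (sym (trans (sym (m<n⇒m%n≡m (∸-monoʳ-< {n} {m} {0} 1≤m m≤n))) eq)) (ℕₚ.m<n⇒0<n∸m (<-trans (n<1+n m) 1+m<n))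
  shape₁ : ∀ c → c + 0 + (c + 1) ≡ suc (2 * c)
  shape₁ = ℕ-Solver.solve-∀
  shape₂ : ∀ c → c + 1 + (c + 1) ≡ suc (2 * c) + 1
  shape₂ = ℕ-Solver.solve-∀
  shape₃ : ∀ c → c + 1 + (c + 0) ≡ suc (2 * c)
  shape₃ = ℕ-Solver.solve-∀
  at-0 : X.degreeAt 0 ≡ suc (2 * c)
  at-0 = trans (cong (λ t → c + 0 + (c + bit (not t))) (dec-false ((n ∸ m) % n ≟ 0) n-m≢0)) (shape₁ c)
  at-1+m : X.degreeAt (suc m) ≡ suc (2 * c) + 1
  at-1+m = trans (cong (λ t → c + 1 + (c + bit (q t))) wrap) (shape₂ c)
    where
    wrap : (suc m + (n ∸ m)) % n ≡ 1
    wrap = trans (cong (_% n) (cong suc (m+[n∸m]≡n m≤n))) (trans ([m+n]%n≡m%n 1 n) (m<n⇒m%n≡m (≤-trans (s≤s (s≤s z≤n)) 9≤n)))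
  lower : ∀ x → x < n → suc (2 * c) ≤ X.degreeAt x
  lower zero    _ = ≤-reflexive (sym at-0)
  lower (suc y) _ = ≤-trans (≤-reflexive (sym (shape₃ c))) (+-monoʳ-≤ (c + 1) (+-monoʳ-≤ c z≤n))
  upper : ∀ x → x < n → X.degreeAt x ≤ suc (2 * c) + 1
  upper x _ = ≤-trans (+-mono-≤ (+-monoʳ-≤ c (bit≤1 (q x))) (+-monoʳ-≤ c (bit≤1 (q ((x + (n ∸ m)) % n))))) (≤-reflexive (shape₂ c))

-- Degree two: a cycle with chords

2^L%5≢0 : ∀ L → 2 ^ L % 5 ≢ 0
2^L%5≢0 zero    ()
2^L%5≢0 (suc L) eq = double (2 ^ L % 5) (m%n<n (2 ^ L) 5) (2^L%5≢0 L) (trans (sym (%-distribˡ-* 2 (2 ^ L) 5)) eq)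
  where
  double : ∀ r → r < 5 → r ≢ 0 → (2 * r) % 5 ≢ 0
  double 0 _ r≢0 _ = r≢0 refl
  double 1 _ _ ()
  double 2 _ _ ()
  double 3 _ _ ()
  double 4 _ _ ()
  double (suc (suc (suc (suc (suc _))))) (s≤s (s≤s (s≤s (s≤s (s≤s ()))))) _ _

suc-%5-≢ : ∀ r → r < 5 → (r + 1) % 5 ≢ r
suc-%5-≢ 0 _ ()
suc-%5-≢ 1 _ ()
suc-%5-≢ 2 _ ()
suc-%5-≢ 3 _ ()
suc-%5-≢ 4 _ ()
suc-%5-≢ (suc (suc (suc (suc (suc _))))) (s≤s (s≤s (s≤s (s≤s (s≤s ())))))

3m≤n : ∀ {m n} → 3 ≤ m → m * m ≤ n → m + (m + m) ≤ n
3m≤n {m} 3≤m m²≤n = ≤-trans (≤-reflexive (cong (λ t → m + (m + t)) (sym (+-identityʳ m)))) (≤-trans (*-monoˡ-≤ m 3≤m) m²≤n)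

-- The residue of e modulo 5 keeps the two ends of the chords x, x + e (5 ∣ x) apart, also for the chords that pass over n.
chord-length : ∀ n m → 2 ≤ m → m * m ≤ n → m % 5 ≢ 0 →
  ∃[ δ ] δ ≤ 2 × 2 * (m + δ) ≤ n × (m + δ) % 5 ≢ 0 × (m + δ) % 5 ≢ n % 5
chord-length n m 2≤m m²≤n m≢0 with m % 5 ≟ n % 5
-- Only the residues 0 and `n % 5` are forbidden, so one of the three lengths m, m + 1, m + 2 is
-- admissible. What remains is the room 2(m + δ) ≤ n, which for small m is read off from the
-- residues.
... | no m≢n = 0 , z≤n , subst (λ t → 2 * t ≤ n) (sym (+-identityʳ m)) (≤-trans (*-monoˡ-≤ m 2≤m) m²≤n)
  , subst (λ t → t % 5 ≢ 0) (sym (+-identityʳ m)) m≢0 , subst (λ t → t % 5 ≢ n % 5) (sym (+-identityʳ m)) m≢n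
... | yes m≡n with (m + 1) % 5 ≟ 0
...   | no m+1≢0 = 1 , s≤s z≤n , room m 2≤m m²≤n m≡n , m+1≢0 ,
  λ eq → suc-%5-≢ (m % 5) (m%n<n m 5) (trans ([m%n+o]%n≡[m+o]%n 5 m 1) (trans eq (sym m≡n)))
  where
  small : ∀ n → 4 ≤ n → 2 ≡ n % 5 → 6 ≤ n
  small (suc (suc (suc (suc (suc (suc n)))))) _ _ = s≤s (s≤s (s≤s (s≤s (s≤s (s≤s z≤n)))))
  small 0 () _
  small 1 (s≤s ()) _
  small 2 (s≤s (s≤s ())) _
  small 3 (s≤s (s≤s (s≤s ()))) _
  small 4 _ ()
  small 5 _ ()
  shape : ∀ m → 2 * (m + 1) ≡ m + (m + 2)
  shape = ℕ-Solver.solve-∀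
  room : ∀ m → 2 ≤ m → m * m ≤ n → m % 5 ≡ n % 5 → 2 * (m + 1) ≤ n
  room 1 (s≤s ()) _ _
  room 2 _ 4≤n 2≡n = small n 4≤n 2≡n
  room m@(suc (suc (suc _))) _ m²≤n _ = ≤-trans (≤-reflexive (shape m)) (≤-trans (+-monoʳ-≤ m (+-monoʳ-≤ m (s≤s (s≤s z≤n)))) (3m≤n {m} (s≤s (s≤s (s≤s z≤n))) m²≤n))
...   | yes m+1≡0 = 2 , ≤-refl , room m 2≤m m+1≡0 m²≤n , (λ eq → contradiction (trans (sym m+2≡1) eq) (λ ())) ,
  λ eq → contradiction (trans (sym (trans (sym ([m%n+o]%n≡[m+o]%n 5 m 1)) (cong (λ t → (t + 1) % 5) (trans m≡n (trans (sym eq) m+2≡1))))) m+1≡0) (λ ())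
  where
  m+2≡1 : (m + 2) % 5 ≡ 1
  m+2≡1 = trans (cong (_% 5) (sym (+-assoc m 1 1))) (trans (sym ([m%n+o]%n≡[m+o]%n 5 (m + 1) 1)) (cong (λ t → (t + 1) % 5) m+1≡0))
  shape : ∀ m → 2 * (m + 2) ≡ m + (m + 4)
  shape = ℕ-Solver.solve-∀
  room : ∀ m → 2 ≤ m → (m + 1) % 5 ≡ 0 → m * m ≤ n → 2 * (m + 2) ≤ n
  room 1 (s≤s ()) _ _
  room 2 _ () _
  room 3 _ () _
  room m@(suc (suc (suc (suc _)))) _ _ m²≤n = ≤-trans (≤-reflexive (shape m)) (≤-trans (+-monoʳ-≤ m (+-monoʳ-≤ m (s≤s (s≤s (s≤s (s≤s z≤n)))))) (3m≤n {m} (s≤s (s≤s (s≤s z≤n))) m²≤n))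

-- If no chord ends where one starts, each vertex lies on at most one chord and the degrees are 2
-- and 3. The spacing 5 is prime to the powers of two used as `m`, has enough residues to avoid the
-- two forbidden ones by a small correction, and keeps a chord within four unit steps of every
-- vertex.
module Chords (n e : ℕ) {{_ : NonZero n}} (2≤e : 2 ≤ e) (2e≤n : 2 * e ≤ n) (e≢0 : e % 5 ≢ 0) (e≢n : e % 5 ≢ n % 5) where

  q : ℕ → Bool
  q x = does (x % 5 ≟ 0)

  e<n : e < n
  e<n = <-≤-trans (m<m+n e (≤-trans (s≤s z≤n) (≤-trans 2≤e (m≤m+n e 0)))) 2e≤n

  2<n : 2 < n
  2<n = ≤-<-trans 2≤e e<n

  chord-nearby : ∀ x → x < n → ∃[ i ] i ≤ 4 × q ((x + i) % n) ≡ true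
  chord-nearby x x<n with x + (4 ∸ (x + 4) % 5) <? n
  -- The number i = 4 - (x + 4) % 5 is the distance from `x` to the next multiple of 5. If that
  -- multiple is n or larger, vertex 0 is reached after at most as many steps and is itself a chord
  -- start.
  ... | yes x+i<n = i , m∸n≤m 4 ((x + 4) % 5) , dec-true ((x + i) % n % 5 ≟ 0) (trans (cong (_% 5) (m<n⇒m%n≡m x+i<n)) multiple)
    where
    i = 4 ∸ (x + 4) % 5
    t = (x + 4) % 5
    t≤4 : t ≤ 4
    t≤4 = ℕ.s≤s⁻¹ (m%n<n (x + 4) 5)
    quotient = (x + 4) ℕ/./ 5
    rearranged : x + i ≡ quotient * 5
    rearranged = ℕₚ.+-cancelʳ-≡ t (x + i) (quotient * 5) (trans (+-assoc x i t) (trans (cong (x +_) (m∸n+n≡m t≤4)) (trans (m≡m%n+[m/n]*n (x + 4) 5) (+-comm t (quotient * 5)))))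
    multiple : (x + i) % 5 ≡ 0
    multiple = trans (cong (_% 5) rearranged) (m*n%n≡0 quotient 5)
  ... | no x+i≮n = n ∸ x , ≤-trans (ℕₚ.m≤n+o⇒m∸n≤o n x (≮⇒≥ x+i≮n)) (m∸n≤m 4 ((x + 4) % 5)) ,
    cong q (trans (cong (_% n) (m+[n∸m]≡n (<⇒≤ x<n))) (n%n≡0 n))

  ends-apart : ∀ x → x < n → q x ≡ true → q ((x + e) % n) ≢ true
  ends-apart x x<n qx qy = apart (does-elim (x % 5 ≟ 0) qx) (does-elim ((x + e) % n % 5 ≟ 0) qy)
    where
    x+e≡e : x % 5 ≡ 0 → (x + e) % 5 ≡ e % 5
    x+e≡e x≡0 = trans (sym ([m%n+o]%n≡[m+o]%n 5 x e)) (cong (λ t → (t + e) % 5) x≡0)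
    apart : x % 5 ≡ 0 → (x + e) % n % 5 ≢ 0
    apart x≡0 y≡0 with x + e <? n
    ... | yes x+e<n = e≢0 (trans (sym (x+e≡e x≡0)) (trans (cong (_% 5) (sym (m<n⇒m%n≡m x+e<n))) y≡0))
    ... | no  x+e≮n = e≢n (trans (sym (x+e≡e x≡0)) (trans (cong (_% 5) (sym w+n)) (trans (sym ([m%n+o]%n≡[m+o]%n 5 w n)) (cong (λ t → (t + n) % 5) w≡0))))
      where
      w = x + e ∸ n
      w+n : w + n ≡ x + e
      w+n = m∸n+n≡m (≮⇒≥ x+e≮n)
      w<n : w < n
      w<n = +-cancelʳ-< n w n (≤-<-trans (≤-reflexive w+n) (ℕₚ.+-mono-< x<n e<n))
      w≡0 : w % 5 ≡ 0
      w≡0 = trans (cong (_% 5) (sym (trans (cong (_% n) (sym w+n)) (trans ([m+n]%n≡m%n w n) (m<n⇒m%n≡m w<n))))) y≡0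

  start-not-end : ∀ x → x < n → q x ≡ true → q ((x + (n ∸ e)) % n) ≡ false
  start-not-end x x<n qx with q ((x + (n ∸ e)) % n) in qy
  ... | false = refl
  ... | true  = contradiction (trans (cong q returned) qx) (ends-apart ((x + (n ∸ e)) % n) (m%n<n (x + (n ∸ e)) n) qy)
    where
    returned : ((x + (n ∸ e)) % n + e) % n ≡ x
    returned = trans ([m%n+o]%n≡[m+o]%n n (x + (n ∸ e)) e) (trans (cong (_% n) (trans (+-assoc x (n ∸ e) e) (cong (x +_) (m∸n+n≡m (<⇒≤ e<n))))) (trans ([m+n]%n≡m%n x n) (m<n⇒m%n≡m x<n)))

  past-end : ∀ t → t < n → (e + t + (n ∸ e)) % n ≡ t
  past-end t t<n = trans (cong (_% n) (trans (shuffle e t (n ∸ e)) (cong (t +_) (m+[n∸m]≡n (<⇒≤ e<n))))) (trans ([m+n]%n≡m%n t n) (m<n⇒m%n≡m t<n))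
    where
    shuffle : ∀ e t k → e + t + k ≡ t + (e + k)
    shuffle = ℕ-Solver.solve-∀

  e+t<n : ∀ {t} → t < e → e + t < n
  e+t<n t<e = <-≤-trans (ℕₚ.+-monoʳ-< e (<-≤-trans t<e (≤-reflexive (sym (+-identityʳ e))))) 2e≤n

  degreeAt : ℕ → ℕ
  degreeAt x = 1 + bit (q x) + (1 + bit (q ((x + (n ∸ e)) % n)))

  degreeAt-0 : degreeAt 0 ≡ 3
  degreeAt-0 = cong (λ b → 1 + 1 + (1 + bit b)) (start-not-end 0 (≤-trans (s≤s z≤n) 2<n) refl)

  degreeAt-≤3 : ∀ x → x < n → degreeAt x ≤ 3
  degreeAt-≤3 x x<n with q x in qx
  ... | true  = ≤-reflexive (cong (λ b → 1 + 1 + (1 + bit b)) (start-not-end x x<n qx))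
  ... | false = +-monoʳ-≤ 2 (bit≤1 (q ((x + (n ∸ e)) % n)))

  -- A chord ending at e + 1 or e + 2 would start at 1 or 2, which are not multiples of 5. At most
  -- one of e + 1 and e + 2 is itself a multiple of 5; the other one lies on no chord.
  degree-two-vertex : ∃[ v ] v < n × degreeAt v ≡ 2
  degree-two-vertex with (e + 1) % 5 ≟ 0
  ... | no e+1≢0 = e + 1 , e+t<n 2≤e , cong₂ (λ a b → 1 + bit a + (1 + bit b)) (dec-false ((e + 1) % 5 ≟ 0) e+1≢0) (cong q (past-end 1 (<-trans (s≤s (s≤s z≤n)) 2<n)))
  ... | yes e+1≡0 = e + 2 , e+t<n 2<e , cong₂ (λ a b → 1 + bit a + (1 + bit b)) (dec-false ((e + 2) % 5 ≟ 0) e+2≢0) (cong q (past-end 2 2<n))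
    where
    2<e : 2 < e
    2<e = ℕₚ.≤∧≢⇒< 2≤e (λ { refl → contradiction e+1≡0 (λ ()) })
    e+2≢0 : (e + 2) % 5 ≢ 0
    e+2≢0 eq = contradiction (trans (sym (trans (cong (_% 5) (sym (+-assoc e 1 1))) (trans (sym ([m%n+o]%n≡[m+o]%n 5 (e + 1) 1)) (cong (λ t → (t + 1) % 5) e+1≡0)))) eq) (λ ())

sparse-two : ∀ n → 4 ≤ n → SparseGraph n 2
sparse-two n 4≤n = X.sparse compare (λ x _ → lower x) degreeAt-≤3 v 0 v<n (≤-trans (s≤s z≤n) 4≤n) v-min degreeAt-0
  where
  instance
    n-nonZero : NonZero n
    n-nonZero = ℕ.>-nonZero (≤-trans (s≤s z≤n) 4≤n)
  -- This makes m = 2^L the largest power of two with m² ≤ n, so m ≤ √n < 2m.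
  scale = scale-exists 4 1 n (s≤s (s≤s z≤n)) ≤-refl (≤-trans (s≤s z≤n) 4≤n)
  L = proj₁ scale
  m = 2 ^ L
  m²≤n : m * m ≤ n
  m²≤n = ≤-trans (≤-reflexive (trans (sym (4^≡2^*2^ L)) (sym (*-identityˡ (4 ^ L))))) (proj₁ (proj₂ scale))
  n≤16m² : n ≤ 16 * (m * m)
  n≤16m² = ≤-trans (<⇒≤ (proj₂ (proj₂ scale))) (≤-trans (≤-reflexive (trans (*-identityˡ (4 * 4 ^ L)) (cong (4 *_) (4^≡2^*2^ L)))) (*-monoˡ-≤ (m * m) (m≤m+n 4 12)))
  2≤m : 2 ≤ m
  2≤m = ℕₚ.^-monoʳ-≤ 2 (1≤L L (proj₂ (proj₂ scale)))
    where
    1≤L : ∀ L → n < 1 * 4 ^ suc L → 1 ≤ L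
    1≤L zero    n<4 = contradiction 4≤n (<⇒≱ n<4)
    1≤L (suc _) _   = s≤s z≤n
  chosen = chord-length n m 2≤m m²≤n (2^L%5≢0 L)
  δ = proj₁ chosen
  δ≤2 = proj₁ (proj₂ chosen)
  e = m + δ
  2e≤n = proj₁ (proj₂ (proj₂ chosen))
  2≤e : 2 ≤ e
  2≤e = ≤-trans 2≤m (m≤m+n m δ)
  open Chords n e 2≤e 2e≤n (proj₁ (proj₂ (proj₂ (proj₂ chosen)))) (proj₂ (proj₂ (proj₂ (proj₂ chosen))))
  lower : ∀ x → 2 ≤ degreeAt x
  lower x = +-mono-≤ {1} {1 + bit (q x)} {1} (s≤s z≤n) (s≤s z≤n)
  v = proj₁ degree-two-vertex
  v<n = proj₁ (proj₂ degree-two-vertex)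
  v-min = proj₂ (proj₂ degree-two-vertex)
  extra-short : ∀ x → q x ≡ true → 1 ≤ e × 2 * e ≤ n × Circulant.inRange n 1 1 e q e ≡ false
  extra-short _ _ = <⇒≤ 2≤e , 2e≤n , cong₂ _∧_ {y = true} (dec-true (1 ≤? e) (<⇒≤ 2≤e)) (dec-false (e <? 2) (≤⇒≯ 2≤e))
  linked : ∀ x y → toℕ y ≡ suc (toℕ x) → Star (Circulant.Adj n 1 1 e q) x y
  linked = linked-by-unit-steps n 1 1 e q (<-trans (s≤s (s≤s z≤n)) 2<n) (λ x → Circulant.isEdge-range n 1 1 e q {1} x ≤-refl ≤-refl)
  module X = Sparse n 2 1 m L e m (s≤s z≤n) ≤-refl (sym (*-identityʳ m)) (<⇒≤ 2≤m) (≤-trans (*-monoˡ-≤ m 2≤m) m²≤n) m²≤n n≤16m² (<⇒≤ 2≤e)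
    (+-monoʳ-≤ m (≤-trans δ≤2 (≤-trans 2≤m (≤-reflexive (sym (+-identityʳ m)))))) m²≤n (s≤s (s≤s (s≤s z≤n)))
    1 1 e q ≤-refl (≤-trans 4≤n (n≤1+n n)) extra-short (λ x x<n qx qy → contradiction qy (ends-apart x x<n qx)) linked (s≤s (<⇒≤ 2≤e)) ≤-refl
  compare : ∀ f → Periodic.Spread.totalEnergy n (X.lift f) (X.lift-periodic f) 1 m ≤-refl (<⇒≤ 2≤m) ≼ fromℕ 602 ⊗ X.edgeEnergy f
  compare f = EnergyComparison.compare-chords n (X.lift f) (X.lift-periodic f) m δ q δ≤2 chord-nearby

sparse : ∀ n d → 2 ≤ d → d * d ≤ n → SparseGraph n d
sparse n d 2≤d d²≤n = conclude (parity d)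
  where
  conclude : ∃[ k ] (d ≡ 2 * k ⊎ d ≡ suc (2 * k)) → SparseGraph n d
  conclude (0           , inj₁ refl) = contradiction 2≤d (λ ())
  conclude (1           , inj₁ refl) = sparse-two n d²≤n
  conclude (suc (suc c) , inj₁ refl) = sparse-even n (suc c) (s≤s z≤n) d²≤n
  conclude (0           , inj₂ refl) = contradiction 2≤d (λ { (s≤s ()) })
  conclude (suc c       , inj₂ refl) = sparse-odd n (suc c) (s≤s z≤n) d²≤n

-- A d-regular graph on n vertices exists only if n d is even, by counting edge ends. In the second
-- part d = 1 would force a path, whose cover time is of order n² and broadcast time of order n, so
-- the ratio would be of order n; hence d starts at 2. Squares replace the comparisons with √n.
theorem4p15 : (∃[ C ] ∀ (n d : ℕ) → n ≤ d * d → d < n → 2 ∣ n * d →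
    Σ[ G ∈ Graph n ] Regular G d × ℛ G ≤ᴿ constᴿ C *ᴿ (constᴿ d *ᴿ logᴿ n))
    ×
    (∃[ C ] ∀ (n d : ℕ) → 2 ≤ d → d * d ≤ n →
    Σ[ G ∈ Graph n ] MinDegree G d × MaxDegree G (d + 1)
    × ℛ G ≤ᴿ constᴿ C *ᴿ (√ᴿ n *ᴿ (logᴿ n *ᴿ logᴿ n)))
theorem4p15 = (C₁ , dense) , (C₂ , sparse)
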